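{- The worst-case running time of the algorithm MRSD_Bipartition on a weighted complete graph $G=(V,E)$ with $n=|V|\ge 2$ vertices is $O(n^3)$.
   Context: Running time is measured in the usual unit-cost RAM model (arithmetic operations on and comparisons of weights take constant time), with the high-level steps of the algorithm implemented by suitable standard algorithms and data structures. A weighted complete graph $G=(V,E)$ is a finite simple undirected complete graph in which each edge $(u,v)$ carries a positive weight $d(u,v)=d(v,u)>0$; put $d(u,u)=0$. A partition of $V$ into $k$ clusters is a family $P=\{C_1,\dots,C_k\}$ of non-empty pairwise disjoint sets with union $V$. The split of $P$ is $s(P)=\min_i s(C_i)$, where $s(C_i)=\min\{d(p,q): p\in C_i,\ q\in C_j,\ j\neq i\}$. The diameter of $P$ is $d(P)=\max_i d(C_i)$, where $d(C)=\max_{p,q\in C}d(p,q)$. If $d(P)=0$, the ratio $s(P)/d(P)$ is read as $+\infty$. Merging two vertices $u,v$ of a weighted complete graph means replacing them by one new vertex (a supervertex) whose edge to any remaining vertex $x$ has weight $\max\{d(u,x),d(v,x)\}$; all other edges and weights are unchanged and the edge $(u,v)$ is removed. If $G'$ is obtained from $G$ by successive merges, each vertex of $G'$ corresponds to the set of vertices of $G$ merged into it, and a partition $P'$ of the vertices of $G'$ induces a partition $P$ of $V$ by replacing each supervertex by the vertices of $G$ merged into it. Algorithm MRSD_Bipartition. Input: $G$. Set $Cost:=0$, $solution:=\emptyset$. Construct a minimum spanning tree $T_{min}$ of $G$; let $L$ be the list of its edges in ascending order of weight; set $G':=G$. While $|L|\ge 1$ do: (1) construct a maximum spanning tree $T_{max}$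 of $G'$ (a spanning tree of largest total weight); let $P'$ be the bipartition of the vertices of $G'$ into the two color classes of the proper 2-coloring of the tree $T_{max}$; let $P$ be the partition of $V$ induced by $P'$; (2) if $s(P)/d(P)>Cost$ (with $s,d$ computed in $G$), set $Cost:=s(P)/d(P)$ and $solution:=P$; (3) while $L$ is non-empty and its first edge $(p,q)$ satisfies $d(p,q)\le s(P)$: merge the two vertices of $G'$ that contain $p$ and $q$ respectively, and remove $(p,q)$ from $L$. Return $solution$. -}

module Defs where

open import Algebra.Structures using (IsCommutativeRing)
open import Data.Bool.Base using (if_then_else_)
open import Data.Fin.Base using (Fin; toℕ; fromℕ<; remQuot)
open import Data.Fin.Properties using () renaming (_≟_ to _≟ᶠ_)
open import Data.Fin.Subset using (Subset; ⊤; _∈_)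
import Data.Fin.Subset as Subset
open import Data.List.Base using (List; []; _∷_; _++_; _∷ʳ_; map; foldr; concatMap; allFin; length; head; drop)
open import Data.List.Membership.Propositional using () renaming (_∈_ to _∈ˡ_)
open import Data.List.Relation.Binary.Permutation.Propositional using (_↭_)
open import Data.List.Relation.Unary.All using (All)
open import Data.List.Relation.Unary.Any using (_─_)
open import Data.List.Relation.Unary.Linked using (Linked)
open import Data.Maybe.Base using (Maybe; just; nothing)
open import Data.Nat.Base using (ℕ; zero; suc)
import Data.Nat.Base as ℕ
import Data.Nat.Properties as ℕ
open import Data.Product.Base using (∃₂; ∃-syntax; _×_; _,_; uncurry)
open import Function.Base using (_∘_)
open import Relation.Binary.Construct.Closure.Equivalence using (EqClosure)
import Relation.Binary.Construct.Add.Supremum.Strict as Supremum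
import Relation.Binary.Construct.StrictToNonStrict as NonStrict
open import Relation.Binary.Definitions using (Decidable)
open import Relation.Binary.PropositionalEquality.Core using (_≡_; _≢_)
open import Relation.Binary.Structures using (IsStrictTotalOrder)
open import Relation.Nullary.Construct.Add.Supremum using (_⁺; ⊤⁺; [_])
open import Relation.Nullary.Decidable.Core using (does; yes; no)
open import Relation.Nullary.Negation.Core using (¬_)

------------------------------------------------------------------------
-- Weights

-- The standard library has no real numbers.  Weights are taken from an
-- arbitrary ordered field whose order is decidable, as the unit-cost
-- comparisons of weights presuppose; the real numbers, classically, and
-- ℚ are instances.  The value of 0# ⁻¹ is unspecified.

record OrderedField : Set₁ where
  infixl 7 _*_ _/_
  infixl 6 _+_ _-_
  infix  4 _<_
  field
    Carrier            : Set
    _+_ _*_            : Carrier → Carrier → Carrier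
    -_ _⁻¹             : Carrier → Carrier
    0# 1#              : Carrier
    _<_                : Carrier → Carrier → Set
    isCommutativeRing  : IsCommutativeRing _≡_ _+_ _*_ -_ 0# 1#
    0≢1                : 0# ≢ 1#
    ⁻¹-inverse         : ∀ x → x ≢ 0# → x * x ⁻¹ ≡ 1#
    isStrictTotalOrder : IsStrictTotalOrder _≡_ _<_
    +-monoˡ-<          : ∀ z {x y} → x < y → x + z < y + z
    *-pos              : ∀ {x y} → 0# < x → 0# < y → 0# < x * y

  open IsStrictTotalOrder isStrictTotalOrder public
    using (compare; _<?_; _≟_)
  open NonStrict _≡_ _<_ public using (_≤_)
  open Supremum _<_ public using (_<⁺_; <⁺-dec)

  _≤?_ : Decidable _≤_
  _≤?_ = NonStrict.decidable′ _≡_ _<_ compare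

  _-_ _/_ max : Carrier → Carrier → Carrier
  x - y   = x + (- y)
  x / y   = x * y ⁻¹
  max x y = if does (x <? y) then y else x

  sum : List Carrier → Carrier
  sum = foldr _+_ 0#

  IsMinimum IsMaximum : (Carrier → Set) → Carrier → Set
  IsMinimum S m = S m × (∀ w → S w → m ≤ w)
  IsMaximum S m = S m × (∀ w → S w → w ≤ m)

------------------------------------------------------------------------
-- Trees and partitions

Edge : ℕ → Set
Edge n = Fin n × Fin n

-- Edges are undirected: an edge may be listed in either orientation.
Joined : ∀ {n} → List (Edge n) → Fin n → Fin n → Set
Joined T = EqClosure (λ u v → (u , v) ∈ˡ T)

-- A cycle is an edge together with a walk between its ends that avoids
-- it.  This also rules out loops and repeated edges.
Acyclic : ∀ {n} → List (Edge n) → Set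
Acyclic T = ∀ {u v} (e : (u , v) ∈ˡ T) → ¬ Joined (T ─ e) u v

record IsSpanningTree {n} (V : Subset n) (T : List (Edge n)) : Set where
  field
    edges     : All (λ (u , v) → u ∈ V × v ∈ V × u ≢ v) T
    connected : ∀ {u v} → u ∈ V → v ∈ V → Joined T u v
    acyclic   : Acyclic T

record Partition (n k : ℕ) : Set where
  field
    cluster  : Fin n → Fin k
    nonEmpty : ∀ i → ∃[ x ] cluster x ≡ i

open Partition public

writeEdges : ∀ {n} → List (Edge n) → List ℕ
writeEdges = concatMap λ (u , v) → toℕ u ∷ toℕ v ∷ []

writePartition : ∀ {n k} → Partition n k → List ℕ
writePartition {n} P = map (toℕ ∘ cluster P) (allFin n)

writeResult : ∀ {n k} → Maybe (Partition n k) → List ℕ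
writeResult nothing  = []
writeResult (just P) = writePartition P

------------------------------------------------------------------------
-- Weighted complete graphs, and the algorithm

record WeightedCompleteGraph (K : OrderedField) (n : ℕ) : Set where
  open OrderedField K
  field
    d          : Fin n → Fin n → Carrier
    d-sym      : ∀ u v → d u v ≡ d v u
    d-diagonal : ∀ u → d u u ≡ 0#
    d-positive : ∀ {u v} → u ≢ v → 0# < d u v

rename : ∀ {n} → Fin n → Fin n → Fin n → Fin n
rename u v x = if does (x ≟ᶠ v) then u else x

module _ {K : OrderedField} where
  open OrderedField K

  -- A graph obtained by merges from a graph on Fin n.  A supervertex is
  -- named by one of the elements of Fin n merged into it; only the
  -- weights between members of `vertices` are meaningful.
  record Merged (n : ℕ) : Set where
    constructor merged
    field
      vertices : Subset n
      weight   : Fin n → Fin n → Carrier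

  open Merged public

  unmerged : ∀ {n} → WeightedCompleteGraph K n → Merged n
  unmerged G = merged ⊤ (WeightedCompleteGraph.d G)

  -- The supervertex made from u and v takes over the name u.
  merge : ∀ {n} → Fin n → Fin n → Merged n → Merged n
  merge u v (merged V w) = merged (V Subset.- v) w′
    where
    w′ : _ → _ → Carrier
    w′ x y with x ≟ᶠ u | y ≟ᶠ u
    ... | yes _ | yes _ = w u u
    ... | yes _ | no  _ = max (w u y) (w v y)
    ... | no  _ | yes _ = max (w x u) (w x v)
    ... | no  _ | no  _ = w x y

  totalWeight : ∀ {n} → Merged n → List (Edge n) → Carrier
  totalWeight H T = sum (map (uncurry (weight H)) T)

  record IsMinimumSpanningTree {n} (H : Merged n) (T : List (Edge n)) : Set where
    field
      spanning : IsSpanningTree (vertices H) T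
      minimum  : ∀ T′ → IsSpanningTree (vertices H) T′ → totalWeight H T ≤ totalWeight H T′

  record IsMaximumSpanningTree {n} (H : Merged n) (T : List (Edge n)) : Set where
    field
      spanning : IsSpanningTree (vertices H) T
      maximum  : ∀ T′ → IsSpanningTree (vertices H) T′ → totalWeight H T′ ≤ totalWeight H T

  -- The value of s(P)/d(P).
  ratio : Carrier → Carrier → Carrier ⁺
  ratio s δ = if does (δ ≟ 0#) then ⊤⁺ else [ s / δ ]

  module _ {n : ℕ} (G : WeightedCompleteGraph K n) where
    open WeightedCompleteGraph G using (d)

    module _ {k : ℕ} (P : Partition n k) where

      IsClusterSplit IsClusterDiameter : Fin k → Carrier → Set
      IsClusterSplit i = IsMinimum λ w →
        ∃₂ λ p q → cluster P p ≡ i × cluster P q ≢ i × w ≡ d p q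
      IsClusterDiameter i = IsMaximum λ w →
        ∃₂ λ p q → cluster P p ≡ i × cluster P q ≡ i × w ≡ d p q

      IsSplit IsDiameter : Carrier → Set
      IsSplit    = IsMinimum λ w → ∃[ i ] IsClusterSplit i w
      IsDiameter = IsMaximum λ w → ∃[ i ] IsClusterDiameter i w

    record IsSortedMST (L : List (Edge n)) : Set where
      field
        tree      : List (Edge n)
        tree-min  : IsMinimumSpanningTree (unmerged G) tree
        listed    : L ↭ tree
        ascending : Linked (λ (p , q) (p′ , q′) → d p q ≤ d p′ q′) L

    -- `class x` is the vertex of G′ that contains x.
    record State : Set where
      constructor state
      field
        cost     : Carrier ⁺
        solution : Maybe (Partition n 2)
        L        : List (Edge n)
        G′       : Merged n
        class    : Fin n → Fin n

    open State

    start : List (Edge n) → State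
    start L = state [ 0# ] nothing L (unmerged G) (λ x → x)

    -- One choice of T_max, P′, P for the current G′.
    record IsRound (σ : State) (T : List (Edge n)) (P : Partition n 2) : Set where
      field
        T-max        : IsMaximumSpanningTree (G′ σ) T
        colour       : Fin n → Fin 2
        proper       : All (λ (u , v) → colour u ≢ colour v) T
        induced      : ∀ x → cluster P x ≡ colour (class σ x)
        s δ          : Carrier
        s-isSplit    : IsSplit P s
        δ-isDiameter : IsDiameter P δ

    improve : Partition n 2 → Carrier ⁺ → State → State
    improve P r σ = if does (<⁺-dec _<?_ (cost σ) r)
      then record σ { cost = r ; solution = just P }
      else σ

    mergeUpTo : Carrier → State → State
    mergeUpTo s (state c S L₀ H π) = go L₀ H π
      where
      go : List (Edge n) → Merged n → (Fin n → Fin n) → State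
      go []            H π = state c S [] H π
      go ((p , q) ∷ L) H π =
        if does (d p q ≤? s)
        then go L (merge (π p) (π q) H) (rename (π p) (π q) ∘ π)
        else state c S ((p , q) ∷ L) H π

    after : ∀ {σ T P} → IsRound σ T P → State
    after {σ} {T} {P} r = mergeUpTo s (improve P (ratio s δ) σ)
      where open IsRound r

    -- Complete executions of the outer loop, with the choices made in
    -- each round and the solution returned.
    data Loop : State → List (List (Edge n) × Partition n 2) → Maybe (Partition n 2) → Set where
      return : ∀ {σ} → ¬ (1 ℕ.≤ length (L σ)) → Loop σ [] (solution σ)
      round  : ∀ {σ T P rs R} → 1 ℕ.≤ length (L σ) →
               (r : IsRound σ T P) → Loop (after r) rs R → Loop σ ((T , P) ∷ rs) R

    record Execution : Set where
      field
        sortedTree : List (Edge n)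
        isSorted   : IsSortedMST sortedTree
        rounds     : List (List (Edge n) × Partition n 2)
        result     : Maybe (Partition n 2)
        loop       : Loop (start sortedTree) rounds result

  -- The trace of an execution: L, then T_max and P for each round, then
  -- the solution returned.
  trace : ∀ {n} {G : WeightedCompleteGraph K n} → Execution G → List ℕ
  trace E =
    writeEdges sortedTree
      ++ concatMap (λ (T , P) → writeEdges T ++ writePartition P) rounds
      ++ writeResult result
    where open Execution E

------------------------------------------------------------------------
-- Unit-cost random access machines

-- A machine has an integer memory (natural numbers, initially 0), a
-- weight memory (elements of the field), both with indirect addressing
-- through the integer memory, and a write-only output tape.  Integer
-- multiplication is deliberately absent: with it, unit cost would not be
-- a realistic measure.

data WeightOp : Set where
  add sub mul div : WeightOp

data Instr : Set where
  set          : (i c : ℕ)   → Instr              -- M[i] := c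
  add sub      : (i j k : ℕ) → Instr              -- M[i] := M[j] ± M[k]   (sub is truncated)
  load         : (i j : ℕ)   → Instr              -- M[i] := M[M[j]]
  store        : (i j : ℕ)   → Instr              -- M[M[i]] := M[j]
  wzero wone   : (i : ℕ)     → Instr              -- W[i] := 0, 1
  wop          : WeightOp → (i j k : ℕ) → Instr   -- W[i] := W[j] op W[k]
  wload        : (i j : ℕ)   → Instr              -- W[i] := W[M[j]]
  wstore       : (i j : ℕ)   → Instr              -- W[M[i]] := W[j]
  jump         : (l : ℕ)     → Instr
  jumpLess     : (i j l : ℕ) → Instr              -- if M[i] < M[j] goto l
  wjumpLess    : (i j l : ℕ) → Instr              -- if W[i] < W[j] goto l
  print        : (i : ℕ)     → Instr              -- output M[i]

Program : Set
Program = List Instr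

-- The weight matrix is supplied from this address on, so that the cells
-- below it are free for directly addressed variables.
inputBase : ℕ
inputBase = 64

fetch : Program → ℕ → Maybe Instr
fetch program pc = head (drop pc program)

infixl 9 _[_↦_]

_[_↦_] : {A : Set} → (ℕ → A) → ℕ → A → ℕ → A
(m [ i ↦ a ]) j = if does (j ℕ.≟ i) then a else m j

module _ {K : OrderedField} where
  open OrderedField K using (Carrier; 0#; 1#; _<?_)
  private module K = OrderedField K

  record Config : Set where
    constructor config
    field
      pc     : ℕ
      M      : ℕ → ℕ
      W      : ℕ → Carrier
      output : List ℕ

  apply : WeightOp → Carrier → Carrier → Carrier
  apply add = K._+_
  apply sub = K._-_
  apply mul = K._*_
  apply div = K._/_

  exec : Instr → Config → Config
  exec (set i c)           (config pc M W o) = config (suc pc) (M [ i ↦ c ]) W o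
  exec (add i j k)         (config pc M W o) = config (suc pc) (M [ i ↦ M j ℕ.+ M k ]) W o
  exec (sub i j k)         (config pc M W o) = config (suc pc) (M [ i ↦ M j ℕ.∸ M k ]) W o
  exec (load i j)          (config pc M W o) = config (suc pc) (M [ i ↦ M (M j) ]) W o
  exec (store i j)         (config pc M W o) = config (suc pc) (M [ M i ↦ M j ]) W o
  exec (wzero i)           (config pc M W o) = config (suc pc) M (W [ i ↦ 0# ]) o
  exec (wone i)            (config pc M W o) = config (suc pc) M (W [ i ↦ 1# ]) o
  exec (wop op i j k)      (config pc M W o) = config (suc pc) M (W [ i ↦ apply op (W j) (W k) ]) o
  exec (wload i j)         (config pc M W o) = config (suc pc) M (W [ i ↦ W (M j) ]) o
  exec (wstore i j)        (config pc M W o) = config (suc pc) M (W [ M i ↦ W j ]) o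
  exec (jump l)            (config pc M W o) = config l M W o
  exec (jumpLess i j l)    (config pc M W o) = config (if does (M i ℕ.<? M j) then l else suc pc) M W o
  exec (wjumpLess i j l)   (config pc M W o) = config (if does (W i <? W j) then l else suc pc) M W o
  exec (print i)           (config pc M W o) = config (suc pc) M W (o ∷ʳ M i)

  -- program ⊢ γ ⇓[ t ] γ′: from γ the machine halts, by leaving the
  -- program, in γ′ after executing exactly t instructions.
  data _⊢_⇓[_]_ (program : Program) : Config → ℕ → Config → Set where
    halt : ∀ {γ} → fetch program (Config.pc γ) ≡ nothing → program ⊢ γ ⇓[ 0 ] γ
    next : ∀ {γ γ′ t instr} → fetch program (Config.pc γ) ≡ just instr →
           program ⊢ exec instr γ ⇓[ t ] γ′ → program ⊢ γ ⇓[ suc t ] γ′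

  -- M[0] = n and W[inputBase + u * n + v] = d(u,v); everything else is 0.
  initial : ∀ {n} → WeightedCompleteGraph K n → Config
  initial {n} G = config 0 M₀ W₀ []
    where
    M₀ : ℕ → ℕ
    M₀ zero    = n
    M₀ (suc _) = 0
    W₀ : ℕ → Carrier
    W₀ a with inputBase ℕ.≤? a | a ℕ.∸ inputBase ℕ.<? n ℕ.* n
    ... | yes _ | yes p = uncurry (WeightedCompleteGraph.d G) (remQuot n (fromℕ< p))
    ... | _     | _     = 0#

-- Started on G, the program carries out some execution of the algorithm,
-- as witnessed by its output, and halts after exactly t instructions.
_carriesOutMRSDon_inTime_ : Program → ∀ {K n} → WeightedCompleteGraph K n → ℕ → Set
program carriesOutMRSDon G inTime t =
  ∃[ E ] ∃[ γ ] program ⊢ initial G ⇓[ t ] γ × Config.output γ ≡ trace {G = G} E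

module Submission where

-- Kruskal's algorithm, with n scans of all pairs, yields L and, once and
-- for all, a maximum spanning tree A of G.  Merging keeps the larger of two
-- weights, so a maximum spanning tree of G′ is found among the edges of A
-- by Kruskal's algorithm started from the supervertices as components;
-- this takes quadratic time per round, as do s(P), d(P) and the merges.
-- The rest of L is at all times a greedy edge sequence for G′.  Hence
-- its first edge is no heavier than s(P), every round shortens L, and there
-- are fewer than n rounds.  Greedy sequences are optimal by exchange.
-- The machine program is compiled from a language whose loops range over
-- the vertices, so that the nesting depth of the loops, here 3, is the
-- exponent of the running time.

open import Defs
open import Algebra.Structures using (IsCommutativeRing)
open import Data.Bool.Base using (if_then_else_; true; false; T; not)
open import Data.Empty using (⊥; ⊥-elim)
open import Data.Fin using (#_)
open import Data.Fin.Base using (Fin; zero; suc; toℕ; fromℕ<; _↑ˡ_; remQuot; combine)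
open import Data.Fin.Properties using () renaming (_≟_ to _≟ᶠ_)
import Data.Fin.Properties as Fin
open import Data.Fin.Subset using (Subset; ⊤; ∣_∣) renaming (_∈_ to _∈ˢ_)
import Data.Fin.Subset as Subset
open import Data.Fin.Subset.Properties using (∈⊤; ∣⊤∣≡n; x∈p⇒∣p-x∣<∣p∣; x∈p∧x≢y⇒x∈p-y; p─q⊆p)
open import Data.List.Base
  using (List; []; _∷_; _++_; _∷ʳ_; map; concatMap; foldl; length; head; drop; tabulate; allFin)
open import Data.List.Membership.Propositional using (_∈_; _∉_)
open import Data.List.Membership.Propositional.Properties using (∈-allFin)
import Data.List.Properties as List
open import Data.List.Relation.Binary.Permutation.Propositional using (↭-refl)
open import Data.List.Relation.Unary.All using (All; []; _∷_)
import Data.List.Relation.Unary.All as All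
open import Data.List.Relation.Unary.AllPairs using ([]; _∷_)
open import Data.List.Relation.Unary.Any using (_─_; here; there)
open import Data.List.Relation.Unary.Linked using (Linked; []; [-]; _∷_)
open import Data.List.Relation.Unary.Unique.Propositional using (Unique)
open import Data.List.Relation.Unary.Unique.Propositional.Properties using (allFin⁺)
open import Data.Maybe.Base using (Maybe; just; nothing)
import Data.Nat.Base as ℕ
open import Data.Nat.Base using (ℕ; zero; suc)
open import Data.Nat.DivMod using (_%_; [m+kn]%n≡m%n; m<n⇒m%n≡m)
import Data.Nat.Properties as ℕ
open import Data.Nat.Tactic.RingSolver using (solve-∀)
open import Data.Product.Base using (∃-syntax; _×_; _,_; proj₁; proj₂; uncurry)
open import Data.Sum.Base using (_⊎_; inj₁; inj₂)
open import Data.Unit.Base using (tt) renaming (⊤ to Unit)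
open import Data.Vec.Base using (_∷_; here; there)
open import Function.Base using (_∘_; id)
import Level
open import Relation.Binary.Core using (Rel)
import Relation.Binary.Construct.Closure.Equivalence as EqClosure
import Relation.Binary.Construct.On as On
import Relation.Binary.Construct.StrictToNonStrict as NonStrict
open import Relation.Binary.Definitions using (tri<; tri≈; tri>)
open import Relation.Binary.PropositionalEquality
open import Relation.Binary.Structures using (IsEquivalence; IsTotalOrder; IsStrictTotalOrder)
open import Relation.Nullary.Construct.Add.Supremum using (_⁺; ⊤⁺; [_])
open import Relation.Nullary.Decidable using (Dec; yes; no; does; dec-true; dec-false)
open import Relation.Nullary.Negation.Core using (¬_; contradiction)

-- The obstacle is that Kruskal's algorithm by repeated scans is already cubic, so it may be run
-- only a constant number of times. The rounds therefore manage with two fixed edge lists and the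
-- class labels. The weights of G′ are never stored in the machine; they occur only in the
-- specification, where they are characterised as maxima of `d` over pairs of classes. Connectivity
-- is handled through labellings `Fin n → Fin n` compared by their kernels: contracted
-- supervertices, the components of a Kruskal run and the machine's label arrays are all of this
-- kind. Walks and cycles appear only where the definition of a spanning tree is met. Arrays agree
-- with the intended labellings only pointwise, so the notions built on labellings are shown to
-- depend on the kernel alone. An execution may choose its trees freely, so ties need no convention:
-- greediness asks each edge to be optimal and nothing more. The assumption that n is at least 2
-- lets the vertices 0 and 1 serve as colours and flags.

private variable
  n : ℕ
  B : Set

-- Spanning trees and greedy edge sequences

-- A labelling of the vertices stands for the partition into its fibres.

unite : (Fin n → Fin n) → Fin n → Fin n → Fin n → Fin n
unite π p q x = rename (π p) (π q) (π x)

infix 4 _⊑_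
-- A record rather than a bare function type, so that both labellings can be inferred from a proof.
record _⊑_ (π ρ : Fin n → Fin n) : Set where
  constructor coarser
  field ⊑-apply : ∀ {x y} → π x ≡ π y → ρ x ≡ ρ y

open _⊑_

⊑-refl : ∀ {π : Fin n → Fin n} → π ⊑ π
⊑-refl = coarser id

⊑-cong : ∀ {π ρ : Fin n → Fin n} → (∀ x → π x ≡ ρ x) → π ⊑ ρ
⊑-cong π≗ρ = coarser λ {x} {y} eq → trans (sym (π≗ρ x)) (trans eq (π≗ρ y))

⊑-trans : ∀ {π ρ σ : Fin n → Fin n} → π ⊑ ρ → ρ ⊑ σ → π ⊑ σ
⊑-trans (coarser f) (coarser g) = coarser (g ∘ f)

United : (Fin n → Fin n) → (p q x y : Fin n) → Set
United π p q x y = π x ≡ π y ⊎ (π x ≡ π p × π y ≡ π q) ⊎ (π x ≡ π q × π y ≡ π p)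

rename-same : (u v : Fin n) → rename u v v ≡ u
rename-same u v with v ≟ᶠ v
... | yes _ = refl
... | no  v≢v = contradiction refl v≢v

rename-other : (u v : Fin n) {x : Fin n} → x ≢ v → rename u v x ≡ x
rename-other u v {x} x≢v with x ≟ᶠ v
... | yes x≡v = contradiction x≡v x≢v
... | no  _   = refl

rename-target : (u v : Fin n) → rename u v u ≡ u
rename-target u v with u ≟ᶠ v
... | yes _ = refl
... | no  _ = refl

rename-∈ : ∀ {S : Subset n} {u v x} → u ∈ˢ S → u ≢ v → x ∈ˢ S → rename u v x ∈ˢ S Subset.- v
rename-∈ {v = v} {x} u∈S u≢v x∈S with x ≟ᶠ v
... | yes _   = x∈p∧x≢y⇒x∈p-y u∈S u≢v
... | no  x≢v = x∈p∧x≢y⇒x∈p-y x∈S x≢v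

module _ (π : Fin n → Fin n) (p q : Fin n) where

  unite-coarsens : π ⊑ unite π p q
  unite-coarsens = coarser (cong (rename (π p) (π q)))

  unite-unites : unite π p q p ≡ unite π p q q
  unite-unites = trans (rename-target (π p) (π q)) (sym (rename-same (π p) (π q)))

  unite-inv : ∀ {x y} → unite π p q x ≡ unite π p q y → United π p q x y
  unite-inv {x} {y} eq with π x ≟ᶠ π q | π y ≟ᶠ π q
  ... | yes x~q | yes y~q = inj₁ (trans x~q (sym y~q))
  ... | yes x~q | no  _   = inj₂ (inj₂ (x~q , sym eq))
  ... | no  _   | yes y~q = inj₂ (inj₁ (eq , y~q))
  ... | no  _   | no  _   = inj₁ eq

  -- The relation is arbitrary because two kinds are used: kernels of labellings, and reachability
  -- along a list of edges.
  unite-least-rel : ∀ {E : Rel (Fin n) Level.zero} → IsEquivalence E →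
                    (∀ {x y} → π x ≡ π y → E x y) → E p q →
                    ∀ {x y} → unite π p q x ≡ unite π p q y → E x y
  unite-least-rel isE π⊆E p~q eq with unite-inv eq
  ... | inj₁ x~y               = π⊆E x~y
  ... | inj₂ (inj₁ (xp , yq)) = IsEquivalence.trans isE (π⊆E xp)
                                   (IsEquivalence.trans isE p~q (π⊆E (sym yq)))
  ... | inj₂ (inj₂ (xq , yp)) = IsEquivalence.trans isE (π⊆E xq)
                                   (IsEquivalence.trans isE (IsEquivalence.sym isE p~q) (π⊆E (sym yp)))

  unite-least : ∀ {ρ} → π ⊑ ρ → ρ p ≡ ρ q → unite π p q ⊑ ρ
  unite-least {ρ} (coarser f) eq =
    coarser (unite-least-rel (On.isEquivalence ρ isEquivalence) f eq)

  unite-complete : ∀ {x y} → United π p q x y → unite π p q x ≡ unite π p q y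
  unite-complete (inj₁ x~y)             = ⊑-apply unite-coarsens x~y
  unite-complete (inj₂ (inj₁ (xp , yq))) =
    trans (⊑-apply unite-coarsens xp) (trans unite-unites (⊑-apply unite-coarsens (sym yq)))
  unite-complete (inj₂ (inj₂ (xq , yp))) =
    trans (⊑-apply unite-coarsens xq) (trans (sym unite-unites) (⊑-apply unite-coarsens (sym yp)))

unite-cong : ∀ {π ρ : Fin n → Fin n} → (∀ x → π x ≡ ρ x) → ∀ p q x → unite π p q x ≡ unite ρ p q x
unite-cong {π = π} {ρ} π≗ρ p q x =
  trans (cong₂ (λ u v → rename u v (π x)) (π≗ρ p) (π≗ρ q)) (cong (rename (ρ p) (ρ q)) (π≗ρ x))

-- The matroid exchange in its smallest instance: if the edge uv joins the separate classes of p and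
-- q, then both edges run between the same two classes.
unite-swap : ∀ (π : Fin n → Fin n) u v p q → π p ≢ π q →
             unite π u v p ≡ unite π u v q → unite π p q u ≡ unite π p q v
unite-swap π u v p q p≁q eq with unite-inv π u v eq
... | inj₁ p~q               = contradiction p~q p≁q
... | inj₂ (inj₁ (pu , qv)) = unite-complete π p q (inj₂ (inj₁ (sym pu , sym qv)))
... | inj₂ (inj₂ (pv , qu)) = unite-complete π p q (inj₂ (inj₂ (sym qu , sym pv)))

unite-mono : ∀ {π ρ : Fin n → Fin n} p q → π ⊑ ρ → unite π p q ⊑ unite ρ p q
unite-mono {π = π} {ρ} p q π⊑ρ =
  unite-least π p q (⊑-trans π⊑ρ (unite-coarsens ρ p q)) (unite-unites ρ p q)

unite-comm : ∀ (π : Fin n → Fin n) p q u v →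
             unite (unite π p q) u v ⊑ unite (unite π u v) p q
unite-comm π p q u v = unite-least (unite π p q) u v
  (unite-least π p q (⊑-trans (unite-coarsens π u v) (unite-coarsens (unite π u v) p q))
                     (unite-unites (unite π u v) p q))
  (⊑-apply (unite-coarsens (unite π u v) p q) (unite-unites π u v))

-- Forests relative to a labelling, and the exchange of edges

uniteAll : (Fin n → Fin n) → List (Edge n) → Fin n → Fin n
uniteAll π []            = π
uniteAll π ((u , v) ∷ T) = uniteAll (unite π u v) T

Trivial : (Fin n → Fin n) → Set
Trivial π = ∀ x y → π x ≡ π y

uniteAll-coarsens : ∀ {π : Fin n → Fin n} T → π ⊑ uniteAll π T
uniteAll-coarsens         []            = ⊑-refl
uniteAll-coarsens {π = π} ((u , v) ∷ T) = ⊑-trans (unite-coarsens π u v) (uniteAll-coarsens T)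

uniteAll-mono : ∀ {π ρ : Fin n → Fin n} T → π ⊑ ρ → uniteAll π T ⊑ uniteAll ρ T
uniteAll-mono []            π⊑ρ = π⊑ρ
uniteAll-mono ((u , v) ∷ T) π⊑ρ = uniteAll-mono T (unite-mono u v π⊑ρ)

uniteAll-unites : ∀ {π : Fin n → Fin n} {T u v} → (u , v) ∈ T → uniteAll π T u ≡ uniteAll π T v
uniteAll-unites {π = π} {T = (u , v) ∷ T} (here refl) = ⊑-apply (uniteAll-coarsens T) (unite-unites π u v)
uniteAll-unites                           (there e)   = uniteAll-unites e

uniteAll-least : ∀ {E : Rel (Fin n) Level.zero} → IsEquivalence E →
                 ∀ {π} T → (∀ {x y} → π x ≡ π y → E x y) → (∀ {u v} → (u , v) ∈ T → E u v) →
                 ∀ {x y} → uniteAll π T x ≡ uniteAll π T y → E x y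
uniteAll-least isE         []            π⊆E T⊆E = π⊆E
uniteAll-least isE {π = π} ((u , v) ∷ T) π⊆E T⊆E =
  uniteAll-least isE {π = unite π u v} T (unite-least-rel π u v isE π⊆E (T⊆E (here refl))) (λ e → T⊆E (there e))

-- Forest π T: no edge of T closes a cycle when the kernel classes of π
-- are contracted.
Forest : (Fin n → Fin n) → List (Edge n) → Set
Forest π []            = Unit
Forest π ((u , v) ∷ T) = π u ≢ π v × Forest (unite π u v) T

Forest-refine : ∀ {π ρ : Fin n → Fin n} T → ρ ⊑ π → Forest π T → Forest ρ T
Forest-refine []            ρ⊑π _         = tt
Forest-refine ((u , v) ∷ T) ρ⊑π (u≁v , F) = u≁v ∘ ⊑-apply ρ⊑π , Forest-refine T (unite-mono u v ρ⊑π) F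

Forest-edge : ∀ {π : Fin n → Fin n} {T u v} → Forest π T → (u , v) ∈ T → π u ≢ π v
Forest-edge                           (u≁v , _) (here refl) = u≁v
Forest-edge {π = π} {T = (u , v) ∷ T} (_   , F) (there e)   =
  Forest-edge F e ∘ ⊑-apply (unite-coarsens π u v)

-- The edge pq is pushed past the edges of `T` one at a time: `unite-comm` permits the exchange of
-- order, and `unite-swap` keeps p and q apart, as otherwise uv would have closed a cycle.
Forest-unite : ∀ {π : Fin n → Fin n} {p q} T → π p ≢ π q → Forest (unite π p q) T →
               uniteAll π T p ≢ uniteAll π T q
Forest-unite                 []            p≁q _         = p≁q
Forest-unite {π = π} {p} {q} ((u , v) ∷ T) p≁q (u≁v , F) =
  Forest-unite {π = unite π u v} T (u≁v ∘ unite-swap π u v p q p≁q)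
    (Forest-refine T (unite-comm π u v p q) F)

Forest⇒acyclic : ∀ {π : Fin n → Fin n} {T u v} → Forest π T → (e : (u , v) ∈ T) →
                 uniteAll π (T ─ e) u ≢ uniteAll π (T ─ e) v
Forest⇒acyclic {T = _ ∷ T} (u≁v , F) (here refl) = Forest-unite T u≁v F
Forest⇒acyclic             (_   , F) (there e)   = Forest⇒acyclic F e

-- Deleting a later edge leaves the head in place, so by computation the hypothesis at `there e` is
-- the hypothesis for the tail over the united labelling.
acyclic⇒Forest : ∀ {π : Fin n → Fin n} T →
                 (∀ {u v} (e : (u , v) ∈ T) → uniteAll π (T ─ e) u ≢ uniteAll π (T ─ e) v) → Forest π T
acyclic⇒Forest []      acyclic = tt
acyclic⇒Forest (_ ∷ T) acyclic =
  acyclic (here refl) ∘ ⊑-apply (uniteAll-coarsens T) , acyclic⇒Forest T (λ e → acyclic (there e))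

-- The removed edge is the first one of T that connects p and q.
exchange : ∀ {π : Fin n → Fin n} {p q} T → Forest π T → π p ≢ π q → uniteAll π T p ≡ uniteAll π T q →
           ∃[ u ] ∃[ v ] ∃[ e ] Forest (unite π p q) (_─_ {P = _≡_ (u , v)} T e) ×
             uniteAll π T ⊑ uniteAll (unite π p q) (T ─ e)
exchange []            _ p≁q p~q = contradiction p~q p≁q
exchange {π = π} {p} {q} ((u , v) ∷ T) (u≁v , F) p≁q p~q
  with unite π u v p ≟ᶠ unite π u v q
... | yes eq = u , v , here refl
             , Forest-refine T (unite-least π p q (unite-coarsens π u v) eq) F
             , uniteAll-mono T (unite-least π u v (unite-coarsens π p q) (unite-swap π u v p q p≁q eq))
... | no neq with exchange {π = unite π u v} {p} {q} T F neq p~q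
...   | u′ , v′ , e , F′ , ⊑′ = u′ , v′ , there e
             , (neq ∘ unite-swap π p q u v u≁v , Forest-refine (T ─ e) (unite-comm π p q u v) F′)
             , ⊑-trans ⊑′ (uniteAll-mono (T ─ e) (unite-comm π u v p q))

-- Spanning trees as forests over a labelling by representatives

module _ {V : Subset n} {π : Fin n → Fin n} (π-fixes : ∀ {x} → x ∈ˢ V → π x ≡ x) where

  -- The equivalence given to `uniteAll-least` is reachability between the representatives `π x` and
  -- `π y`. On `V` a vertex is its own representative, so both ends can be transported back.
  uniteAll⇒Joined : ∀ S → (∀ {u v} → (u , v) ∈ S → u ∈ˢ V × v ∈ˢ V) →
                    ∀ {x y} → x ∈ˢ V → y ∈ˢ V → uniteAll π S x ≡ uniteAll π S y → Joined S x y
  uniteAll⇒Joined S S⊆V {x} {y} x∈V y∈V eq =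
    subst₂ (Joined S) (π-fixes x∈V) (π-fixes y∈V)
      (uniteAll-least (On.isEquivalence π (EqClosure.isEquivalence _)) S
        (λ {a} πa≡πb → subst (Joined S (π a)) πa≡πb (EqClosure.reflexive _))
        (λ e → subst₂ (Joined S) (sym (π-fixes (proj₁ (S⊆V e)))) (sym (π-fixes (proj₂ (S⊆V e))))
                 (EqClosure.return e))
        eq)

  Joined⇒uniteAll : ∀ S {x y} → Joined S x y → uniteAll π S x ≡ uniteAll π S y
  Joined⇒uniteAll S = EqClosure.gfold isEquivalence (uniteAll π S) uniteAll-unites

─-⊆ : ∀ {x y : B} {xs} (e : x ∈ xs) → y ∈ (xs ─ e) → y ∈ xs
─-⊆ (here _)  i         = there i
─-⊆ (there e) (here eq) = here eq
─-⊆ (there e) (there i) = there (─-⊆ e i)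

module _ {V : Subset n} {π : Fin n → Fin n}
         (π-in : ∀ x → π x ∈ˢ V) (π-fixes : ∀ {x} → x ∈ˢ V → π x ≡ x) where

  forest⇒spanning : ∀ {T} → (∀ {u v} → (u , v) ∈ T → u ∈ˢ V × v ∈ˢ V) → Forest π T →
                    Trivial (uniteAll π T) → IsSpanningTree V T
  forest⇒spanning {T} T⊆V F triv = record
    { edges     = All.tabulate λ e →
        proj₁ (T⊆V e) , proj₂ (T⊆V e) , λ u≡v → Forest-edge F e (cong π u≡v)
    ; connected = λ {u} {v} u∈V v∈V → uniteAll⇒Joined π-fixes T T⊆V u∈V v∈V (triv u v)
    ; acyclic   = λ e J → Forest⇒acyclic F e (Joined⇒uniteAll π-fixes (T ─ e) J)
    }

  module _ {T} (S : IsSpanningTree V T) where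
    open IsSpanningTree S

    spanning-⊆ : ∀ {u v} → (u , v) ∈ T → u ∈ˢ V × v ∈ˢ V
    spanning-⊆ e = proj₁ (All.lookup edges e) , proj₁ (proj₂ (All.lookup edges e))

    spanning-forest : Forest π T
    spanning-forest = acyclic⇒Forest T λ e eq →
      let u∈V , v∈V = spanning-⊆ e in
      acyclic e (uniteAll⇒Joined π-fixes (T ─ e) (spanning-⊆ ∘ ─-⊆ e) u∈V v∈V eq)

    spanning-trivial : Trivial (uniteAll π T)
    spanning-trivial x y = trans (sym (shrink x)) (trans (Joined⇒uniteAll π-fixes T (connected (π-in x) (π-in y))) (shrink y))
      where
      -- Connectedness speaks only of members of `V`; any other vertex is reached through its
      -- representative, whose label it shares from the start.
      shrink : ∀ x → uniteAll π T (π x) ≡ uniteAll π T x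
      shrink x = ⊑-apply (uniteAll-coarsens T) (π-fixes (π-in x))

-- The two orientations of the order let Kruskal's algorithm be treated
-- once for minimum and once for maximum spanning trees.
data Dir : Set where
  up down : Dir

-- Ordered fields and the optimality of greedy sequences

module _ {K : OrderedField} where
  open OrderedField K
  open IsCommutativeRing isCommutativeRing using (+-comm; +-assoc)
  private
    module < = IsStrictTotalOrder isStrictTotalOrder
    module ≤ = IsTotalOrder (NonStrict.isTotalOrder _≡_ _<_ isStrictTotalOrder)

  +-mono-≤ : ∀ {a b c d} → a ≤ b → c ≤ d → a + c ≤ b + d
  +-mono-≤ {a} {b} {c} {d} a≤b c≤d = ≤.trans (left c a≤b)
    (subst₂ _≤_ (+-comm c b) (+-comm d b) (left b c≤d))
    where
    left : ∀ z {x y} → x ≤ y → x + z ≤ y + z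
    left z (inj₁ x<y)  = inj₁ (+-monoˡ-< z x<y)
    left z (inj₂ refl) = inj₂ refl

  ≮⇒≥ : ∀ {x y} → ¬ (x < y) → y ≤ x
  ≮⇒≥ {x} {y} x≮y with ≤.total x y
  ... | inj₁ (inj₁ x<y) = contradiction x<y x≮y
  ... | inj₁ (inj₂ x≡y) = inj₂ (sym x≡y)
  ... | inj₂ y≤x        = y≤x

  max-≥ˡ : ∀ x y → x ≤ max x y
  max-≥ˡ x y with x <? y
  ... | yes x<y = inj₁ x<y
  ... | no  _   = inj₂ refl

  max-≥ʳ : ∀ x y → y ≤ max x y
  max-≥ʳ x y with x <? y
  ... | yes _   = inj₂ refl
  ... | no  x≮y = ≮⇒≥ x≮y

  max-sel : ∀ x y → max x y ≡ x ⊎ max x y ≡ y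
  max-sel x y with x <? y
  ... | yes _ = inj₂ refl
  ... | no  _ = inj₁ refl

  infix 4 _≤[_]_
  _≤[_]_ : Carrier → Dir → Carrier → Set
  x ≤[ up ]   y = x ≤ y
  x ≤[ down ] y = y ≤ x

  ≤[]-refl : ∀ D {x} → x ≤[ D ] x
  ≤[]-refl up   = ≤.refl
  ≤[]-refl down = ≤.refl

  ≤[]-trans : ∀ D {x y z} → x ≤[ D ] y → y ≤[ D ] z → x ≤[ D ] z
  ≤[]-trans up   x≤y y≤z = ≤.trans x≤y y≤z
  ≤[]-trans down y≤x z≤y = ≤.trans z≤y y≤x

  ≤[]-mono : ∀ D {a b c d} → a ≤[ D ] b → c ≤[ D ] d → a + c ≤[ D ] b + d
  ≤[]-mono up   = +-mono-≤
  ≤[]-mono down = +-mono-≤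

  module _ (D : Dir) (H : Merged {K} n) where

    -- The runs of Kruskal's algorithm, where `π` records the components reached so far. Every tail
    -- is again greedy over its own labelling, which is what lets the list `L` be followed through
    -- the merges.
    data Greedy (π : Fin n → Fin n) : List (Edge n) → Set where
      done : Trivial π → Greedy π []
      step : ∀ {p q T} → p ∈ˢ vertices H → q ∈ˢ vertices H → π p ≢ π q →
             (∀ {x y} → x ∈ˢ vertices H → y ∈ˢ vertices H → π x ≢ π y →
                weight H p q ≤[ D ] weight H x y) →
             Greedy (unite π p q) T → Greedy π ((p , q) ∷ T)

  module _ {D : Dir} {H : Merged {K} n} where

    Greedy-⊆ : ∀ {π T u v} → Greedy D H π T → (u , v) ∈ T → u ∈ˢ vertices H × v ∈ˢ vertices H
    Greedy-⊆ (step p∈V q∈V _ _ _) (here refl) = p∈V , q∈V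
    Greedy-⊆ (step _   _   _ _ g) (there e)   = Greedy-⊆ g e

    Greedy-forest : ∀ {π T} → Greedy D H π T → Forest π T
    Greedy-forest (done _)           = tt
    Greedy-forest (step _ _ p≁q _ g) = p≁q , Greedy-forest g

    Greedy-trivial : ∀ {π T} → Greedy D H π T → Trivial (uniteAll π T)
    Greedy-trivial (done triv)      = triv
    Greedy-trivial (step _ _ _ _ g) = Greedy-trivial g

    Greedy-first : ∀ {π p q T x y} → Greedy D H π ((p , q) ∷ T) → x ∈ˢ vertices H → y ∈ˢ vertices H → π x ≢ π y →
                   weight H p q ≤[ D ] weight H x y
    Greedy-first (step _ _ _ best _) = best

    -- This stands in for function extensionality when a label array is known only pointwise.
    Greedy-resp : ∀ {π ρ T} → π ⊑ ρ → ρ ⊑ π → Greedy D H π T → Greedy D H ρ T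
    Greedy-resp π⊑ρ ρ⊑π (done triv) = done λ x y → ⊑-apply π⊑ρ (triv x y)
    Greedy-resp π⊑ρ ρ⊑π (step {p} {q} p∈V q∈V p≁q best g) =
      step p∈V q∈V (p≁q ∘ ⊑-apply ρ⊑π) (λ x∈V y∈V x≁y → best x∈V y∈V (x≁y ∘ ⊑-apply π⊑ρ))
        (Greedy-resp (unite-mono p q π⊑ρ) (unite-mono p q ρ⊑π) g)

    Greedy-nonempty : ∀ {π x y} → π x ≢ π y → ¬ Greedy D H π []
    Greedy-nonempty x≁y (done triv) = x≁y (triv _ _)

    -- The second edge joins different classes of a coarser labelling, so it was already a candidate
    -- when the first was chosen.
    Greedy-sorted : ∀ {π T} → Greedy D H π T →
                    Linked (λ (p , q) (p′ , q′) → weight H p q ≤[ D ] weight H p′ q′) T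
    Greedy-sorted (done _)                                          = []
    Greedy-sorted (step _ _ _ best (done _))                        = [-]
    Greedy-sorted {π} (step {p} {q} _ _ _ best g@(step p∈V q∈V p≁q _ _)) =
      best p∈V q∈V (p≁q ∘ ⊑-apply (unite-coarsens π p q)) ∷ Greedy-sorted g

    totalWeight-─ : ∀ {u v T} (e : (u , v) ∈ T) →
                    totalWeight H T ≡ weight H u v + totalWeight H (T ─ e)
    totalWeight-─             (here refl) = refl
    totalWeight-─ {u} {v} {(a , b) ∷ T} (there e) = begin
      weight H a b + totalWeight H T                            ≡⟨ cong (weight H a b +_) (totalWeight-─ e) ⟩
      weight H a b + (weight H u v + totalWeight H (T ─ e))     ≡⟨ +-assoc _ _ _ ⟨
      (weight H a b + weight H u v) + totalWeight H (T ─ e)     ≡⟨ cong (_+ totalWeight H (T ─ e)) (+-comm _ _) ⟩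
      (weight H u v + weight H a b) + totalWeight H (T ─ e)     ≡⟨ +-assoc _ _ _ ⟩
      weight H u v + (weight H a b + totalWeight H (T ─ e))     ∎
      where open ≡-Reasoning

    -- Induction on the greedy sequence. The edge that `exchange` deletes from `T′` joins different
    -- classes of `π`, since `T′` is a forest over `π`, so the greedy edge is at least as good. What
    -- remains of `T′` is a spanning forest over the united labelling, and the exchanged tree itself
    -- is never formed.
    Greedy-optimal : ∀ {π T} → Greedy D H π T → ∀ T′ → Forest π T′ →
                     (∀ {u v} → (u , v) ∈ T′ → u ∈ˢ vertices H × v ∈ˢ vertices H) →
                     Trivial (uniteAll π T′) → totalWeight H T ≤[ D ] totalWeight H T′
    Greedy-optimal (done triv) []       _          _   _ = ≤[]-refl D
    Greedy-optimal (done triv) (_ ∷ _) (u≁v , _) _   _ = contradiction (triv _ _) u≁v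
    Greedy-optimal (step {p} {q} _ _ p≁q best g) T′ F T′⊆V triv
      with exchange T′ F p≁q (triv p q)
    ... | u , v , e , F′ , ⊑′ =
      subst (_ ≤[ D ]_) (sym (totalWeight-─ e))
        (≤[]-mono D (best (proj₁ (T′⊆V e)) (proj₂ (T′⊆V e)) (Forest-edge F e))
          (Greedy-optimal g (T′ ─ e) F′ (T′⊆V ∘ ─-⊆ e) (λ x y → ⊑-apply ⊑′ (triv x y))))

    module _ {π : Fin n → Fin n} (π-in : ∀ x → π x ∈ˢ vertices H)
             (π-fixes : ∀ {x} → x ∈ˢ vertices H → π x ≡ x) {T} (g : Greedy D H π T) where

      Greedy-spanning : IsSpanningTree (vertices H) T
      Greedy-spanning = forest⇒spanning π-in π-fixes (Greedy-⊆ g) (Greedy-forest g) (Greedy-trivial g)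

      Greedy-optimum : ∀ T′ → IsSpanningTree (vertices H) T′ → totalWeight H T ≤[ D ] totalWeight H T′
      Greedy-optimum T′ S = Greedy-optimal g T′ (spanning-forest π-in π-fixes S)
        (spanning-⊆ π-in π-fixes S) (spanning-trivial π-in π-fixes S)

  -- Merged graphs as contractions, and their maximum spanning trees

  module _ {n} (G : WeightedCompleteGraph K n) where
    open WeightedCompleteGraph G

    -- `attained` and `bounded` together say that the weight between two distinct supervertices is
    -- the maximum of `d` over the pairs between their classes, without computing a maximum over
    -- sets.
    record IsContraction (π : Fin n → Fin n) (H : Merged {K} n) : Set where
      field
        π-in     : ∀ x → π x ∈ˢ vertices H
        π-fixes  : ∀ {x} → x ∈ˢ vertices H → π x ≡ x
        attained : ∀ {x y} → x ∈ˢ vertices H → y ∈ˢ vertices H → x ≢ y →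
                   ∃[ a ] ∃[ b ] π a ≡ x × π b ≡ y × weight H x y ≡ d a b
        bounded  : ∀ {a b} → π a ≢ π b → d a b ≤ weight H (π a) (π b)

    contraction-id : IsContraction id (unmerged G)
    contraction-id = record
      { π-in     = λ _ → ∈⊤
      ; π-fixes  = λ _ → refl
      ; attained = λ {x} {y} _ _ _ → x , y , refl , refl , refl
      ; bounded  = λ _ → ≤.refl
      }

    rename-≢ : ∀ {u v x z : Fin n} → z ≢ u → rename u v x ≡ z → x ≡ z
    rename-≢ {v = v} {x} z≢u eq with x ≟ᶠ v
    ... | yes _ = contradiction (sym eq) z≢u
    ... | no  _ = eq

    rename-≡ : ∀ {u v x : Fin n} → rename u v x ≡ u → x ≡ u ⊎ x ≡ v
    rename-≡ {v = v} {x} eq with x ≟ᶠ v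
    ... | yes x≡v = inj₂ x≡v
    ... | no  _   = inj₁ eq

    x∉p-x : ∀ {m} (V : Subset m) {x y} → y ∈ˢ V Subset.- x → y ≢ x
    x∉p-x (_ ∷ _) {zero}  (there _)   = λ ()
    x∉p-x (_ ∷ V) {suc x} here        = λ ()
    x∉p-x (_ ∷ V) {suc x} (there y∈V) = x∉p-x V y∈V ∘ Fin.suc-injective

    -- Only the class named u changes, to the union of the classes of u and v, and a maximum over a
    -- union is the `max` of the two maxima. The cases are those of the weight in `merge`.
    contraction-merge : ∀ {π H p q} → IsContraction π H → π p ≢ π q →
                        IsContraction (unite π p q) (merge (π p) (π q) H)
    contraction-merge {π} {H} {p} {q} C p≁q = record
      { π-in = π′-in ; π-fixes = π′-fixes ; attained = attained′ ; bounded = bounded′ }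
      where
      open IsContraction C
      V = vertices H
      w = weight H
      u = π p
      v = π q

      π′-in : ∀ x → rename u v (π x) ∈ˢ V Subset.- v
      π′-in x = rename-∈ (π-in p) p≁q (π-in x)

      stays : ∀ {x} → x ∈ˢ V Subset.- v → x ∈ˢ V
      stays = p─q⊆p V _

      π′-fixes : ∀ {x} → x ∈ˢ V Subset.- v → rename u v (π x) ≡ x
      π′-fixes x∈V′ = trans (cong (rename u v) (π-fixes (stays x∈V′))) (rename-other u v (x∉p-x V x∈V′))

      keeps : ∀ {a x} → x ∈ˢ V Subset.- v → π a ≡ x → rename u v (π a) ≡ x
      keeps x∈V′ refl = rename-other u v (x∉p-x V x∈V′)

      absorbs : ∀ {a} → π a ≡ v → rename u v (π a) ≡ u
      absorbs eq = trans (cong (rename u v) eq) (rename-same u v)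

      attained′ : ∀ {x y} → x ∈ˢ V Subset.- v → y ∈ˢ V Subset.- v → x ≢ y →
                  ∃[ a ] ∃[ b ] rename u v (π a) ≡ x × rename u v (π b) ≡ y × weight (merge u v H) x y ≡ d a b
      attained′ {x} {y} x∈V′ y∈V′ x≢y with x ≟ᶠ u | y ≟ᶠ u
      ... | yes refl | yes refl = contradiction refl x≢y
      ... | yes refl | no _ with max-sel (w u y) (w v y)
      ...   | inj₁ eq = let a , b , ax , by , eq′ = attained (stays x∈V′) (stays y∈V′) x≢y in
                        a , b , keeps x∈V′ ax , keeps y∈V′ by , trans eq eq′
      ...   | inj₂ eq = let a , b , ax , by , eq′ = attained (π-in q) (stays y∈V′) (x∉p-x V y∈V′ ∘ sym) in
                        a , b , absorbs ax , keeps y∈V′ by , trans eq eq′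
      attained′ {x} {y} x∈V′ y∈V′ x≢y | no _ | yes refl with max-sel (w x u) (w x v)
      ...   | inj₁ eq = let a , b , ax , by , eq′ = attained (stays x∈V′) (stays y∈V′) x≢y in
                        a , b , keeps x∈V′ ax , keeps y∈V′ by , trans eq eq′
      ...   | inj₂ eq = let a , b , ax , by , eq′ = attained (stays x∈V′) (π-in q) (x∉p-x V x∈V′) in
                        a , b , keeps x∈V′ ax , absorbs by , trans eq eq′
      attained′ {x} {y} x∈V′ y∈V′ x≢y | no _ | no _ =
        let a , b , ax , by , eq = attained (stays x∈V′) (stays y∈V′) x≢y in
        a , b , keeps x∈V′ ax , keeps y∈V′ by , eq

      below : ∀ {a b x y} → π a ≡ x → π b ≡ y → x ≢ y → d a b ≤ w x y
      below refl refl = bounded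

      bounded′ : ∀ {a b} → rename u v (π a) ≢ rename u v (π b) →
                 d a b ≤ weight (merge u v H) (rename u v (π a)) (rename u v (π b))
      -- The two new names are replaced by variables with equations, so that comparing them with u
      -- makes the merged weight reduce.
      bounded′ {a} {b} a≁b = go refl refl a≁b
        where
        go : ∀ {x y} → rename u v (π a) ≡ x → rename u v (π b) ≡ y → x ≢ y →
             d a b ≤ weight (merge u v H) x y
        go {x} {y} ax by x≢y with x ≟ᶠ u | y ≟ᶠ u
        ... | yes refl | yes refl = contradiction refl x≢y
        ... | yes refl | no y≢u with rename-≡ ax
        ...   | inj₁ eq = ≤.trans (below eq (rename-≢ y≢u by) x≢y) (max-≥ˡ _ _)
        ...   | inj₂ eq = ≤.trans (below eq (rename-≢ y≢u by) v≢y) (max-≥ʳ _ _)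
          where
          v≢y : v ≢ y
          v≢y refl = y≢u (trans (sym by) (absorbs (rename-≢ y≢u by)))
        go {x} {y} ax by x≢y | no x≢u | yes refl with rename-≡ by
        ...   | inj₁ eq = ≤.trans (below (rename-≢ x≢u ax) eq x≢y) (max-≥ˡ _ _)
        ...   | inj₂ eq = ≤.trans (below (rename-≢ x≢u ax) eq x≢v) (max-≥ʳ _ _)
          where
          x≢v : x ≢ v
          x≢v refl = x≢u (trans (sym ax) (absorbs (rename-≢ x≢u ax)))
        go {x} {y} ax by x≢y | no x≢u | no y≢u = below (rename-≢ x≢u ax) (rename-≢ y≢u by) x≢y

    -- Kruskal's algorithm on the contraction by π, restricted to the edges A
    -- of a maximum spanning tree of G.
    kept : (π λ′ : Fin n → Fin n) → List (Edge n) → List (Edge n)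
    kept π λ′ []            = []
    kept π λ′ ((p , q) ∷ A) = if does (λ′ (π p) ≟ᶠ λ′ (π q)) then kept π λ′ A
      else (π p , π q) ∷ kept π (unite λ′ (π p) (π q)) A

    kept-cong : ∀ π {λ′ ρ} A → (∀ x → λ′ x ≡ ρ x) → kept π λ′ A ≡ kept π ρ A
    kept-cong π           []            λ≗ρ = refl
    kept-cong π {λ′} {ρ} ((p , q) ∷ A) λ≗ρ with λ′ (π p) ≟ᶠ λ′ (π q) | ρ (π p) ≟ᶠ ρ (π q)
    ... | yes _   | yes _   = kept-cong π A λ≗ρ
    ... | yes p~q | no  p≁q = contradiction (trans (sym (λ≗ρ (π p))) (trans p~q (λ≗ρ (π q)))) p≁q
    ... | no  p≁q | yes p~q = contradiction (trans (λ≗ρ (π p)) (trans p~q (sym (λ≗ρ (π q))))) p≁q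
    ... | no  _   | no  _   = cong ((π p , π q) ∷_) (kept-cong π A (unite-cong λ≗ρ (π p) (π q)))

    -- Two Kruskal runs in parallel: `ρ` holds the components in G and `λ′` the coarser ones in G′.
    -- A candidate edge of G′ has the weight of some pair of G. This pair crosses `λ′`, hence `ρ`,
    -- and so was beaten by the current edge pq of `A`, whose weight in G′ is at least that in G.
    kept-greedy : ∀ {π H} → IsContraction π H → ∀ {ρ λ′} A → π ⊑ λ′ → ρ ⊑ λ′ →
                  Greedy down (unmerged G) ρ A → Greedy down H λ′ (kept π λ′ A)
    kept-greedy C [] π⊑λ ρ⊑λ (done triv) = done λ x y → ⊑-apply ρ⊑λ (triv x y)
    kept-greedy {π} {H} C {ρ} {λ′} ((p , q) ∷ A) π⊑λ ρ⊑λ (step _ _ _ best g) = go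
      where
      open IsContraction C
      coarsens = unite-coarsens λ′ (π p) (π q)
      rep : ∀ x → λ′ (π x) ≡ λ′ x
      rep x = ⊑-apply π⊑λ (π-fixes (π-in x))
      united : unite λ′ (π p) (π q) p ≡ unite λ′ (π p) (π q) q
      united = unite-complete λ′ (π p) (π q) (inj₂ (inj₁ (sym (rep p) , sym (rep q))))
      heaviest : λ′ (π p) ≢ λ′ (π q) →
                 ∀ {x y} → x ∈ˢ vertices H → y ∈ˢ vertices H → λ′ x ≢ λ′ y → weight H x y ≤ weight H (π p) (π q)
      heaviest p≁q {x} {y} x∈V y∈V x≁y with attained x∈V y∈V (λ x≡y → x≁y (cong λ′ x≡y))
      ... | a , b , refl , refl , eq =
        subst (_≤ weight H (π p) (π q)) (sym eq)
          (≤.trans (best ∈⊤ ∈⊤ (λ a~b → x≁y (trans (rep a) (trans (⊑-apply ρ⊑λ a~b) (sym (rep b))))))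
                   (bounded (p≁q ∘ cong λ′)))
      go : Greedy down H λ′ (kept π λ′ ((p , q) ∷ A))
      go with λ′ (π p) ≟ᶠ λ′ (π q)
      -- A skipped edge is united in `ρ` alone; this stays below `λ′`, which has already identified
      -- its ends.
      ... | yes p~q = kept-greedy C A π⊑λ (unite-least ρ p q ρ⊑λ (trans (sym (rep p)) (trans p~q (rep q)))) g
      ... | no  p≁q = step (π-in p) (π-in q) p≁q (heaviest p≁q)
                        (kept-greedy C A (⊑-trans π⊑λ coarsens)
                          (unite-least ρ p q (⊑-trans ρ⊑λ coarsens) united) g)

    contraction-cong : ∀ {π ρ H} → (∀ x → π x ≡ ρ x) → IsContraction π H → IsContraction ρ H
    contraction-cong {H = H} π≗ρ C = record
      { π-in     = λ x → subst (_∈ˢ vertices H) (π≗ρ x) (π-in x)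
      ; π-fixes  = λ x∈V → trans (sym (π≗ρ _)) (π-fixes x∈V)
      ; attained = λ x∈V y∈V x≢y → let a , b , ax , by , eq = attained x∈V y∈V x≢y in
                     a , b , trans (sym (π≗ρ a)) ax , trans (sym (π≗ρ b)) by , eq
      ; bounded  = λ {a} {b} a≁b → subst₂ (λ x y → d a b ≤ weight H x y) (π≗ρ a) (π≗ρ b)
                     (bounded (λ a~b → a≁b (trans (sym (π≗ρ a)) (trans a~b (π≗ρ b)))))
      }
      where open IsContraction C

-- A command language and its compilation

module _ where
  open import Data.Nat.Base using (_+_; _*_; _∸_; _^_; _⊔_; _≤_; _<_; s≤s; z≤n)

  infixr 5 _⨾_

  -- Scalars and array entries are vertices, registers are weights. There is no arithmetic on
  -- vertices, so indices are always in range; literals are 0 and 1, which are vertices. Every loop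
  -- runs exactly n times, so a time bound can be read off the syntax.
  data Cmd : Set where
    skip      : Cmd
    _⨾_       : Cmd → Cmd → Cmd
    mv        : (i j : ℕ) → Cmd
    lit       : (i : ℕ) (b : Fin 2) → Cmd
    ld        : (i : ℕ) (a : Fin 13) (j : ℕ) → Cmd
    st        : (a : Fin 13) (i j : ℕ) → Cmd
    dist      : (r : Fin 8) (i j : ℕ) → Cmd
    wdiv      : (r s t : Fin 8) → Cmd
    print     : (i : ℕ) → Cmd
    ifEq      : (i j : ℕ) → Cmd → Cmd → Cmd
    ifLess    : (r s : Fin 8) → Cmd → Cmd → Cmd
    for       : (i : ℕ) → Cmd → Cmd

  -- Cells below 64 are temporaries; the rest of the memory is split into 16
  -- interleaved arrays: scalars, loop counters, row addresses of the weight
  -- matrix, and the 13 arrays of the command language.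
  addr : Fin 16 → ℕ → ℕ
  addr a k = 64 + (16 * k + toℕ a)

  scalar counter : ℕ → ℕ
  scalar  = addr zero
  counter = addr (suc zero)

  rowArray : Fin 16
  rowArray = suc (suc zero)

  array : Fin 13 → Fin 16
  array a = suc (suc (suc a))

  -- The machine does not multiply, so the factor 16 is obtained by four doublings; hence a power of
  -- two as the number of interleaved arrays. The address is left in cell 2.
  locate : Fin 16 → ℕ → Program
  locate a j = add 2 j j ∷ add 2 2 2 ∷ add 2 2 2 ∷ add 2 2 2 ∷ set 3 (64 + toℕ a) ∷ add 2 2 3 ∷ []

  -- Accumulating the address makes it agree by computation with a program counter that has stepped
  -- through the same instructions.
  advance : ℕ → Program → ℕ
  advance b []      = b
  advance b (_ ∷ p) = advance (suc b) p

  -- Cell 0 keeps n and serves as the limit. The parameter `d` is the nesting depth, so each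
  -- enclosing loop has a counter of its own, apart from the scalars that commands can assign.
  loop : (d b : ℕ) → Program → Program
  loop d b body =
    set (counter d) 0 ∷ jumpLess (counter d) 0 (3 + b) ∷ jump (3 + advance (3 + b) body) ∷
    body ++ set 1 1 ∷ add (counter d) (counter d) 1 ∷ jump (1 + b) ∷ []

  -- Copying is addition of a zero put in cell 1. Equality is tested by two strict comparisons, each
  -- leading to the second branch; for `ifLess` the second branch is placed first.
  compile : Cmd → (d b : ℕ) → Program
  compile skip             d b = []
  compile (c ⨾ c′)         d b = let p = compile c d b in p ++ compile c′ d (advance b p)
  compile (mv i j)         d b = set 1 0 ∷ add (scalar i) (scalar j) 1 ∷ []
  compile (lit i c)        d b = set (scalar i) (toℕ c) ∷ []
  compile (ld i a j)       d b = locate (array a) (scalar j) ++ load (scalar i) 2 ∷ []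
  compile (st a i j)       d b = locate (array a) (scalar i) ++ store 2 (scalar j) ∷ []
  compile (dist r i j)     d b = locate rowArray (scalar i) ++ load 2 2 ∷ add 2 2 (scalar j) ∷ wload (toℕ r) 2 ∷ []
  compile (wdiv r s t)     d b = wop div (toℕ r) (toℕ s) (toℕ t) ∷ []
  compile (print i)        d b = print (scalar i) ∷ []
  compile (ifEq i j c c′)  d b =
    let p  = compile c d (2 + b)
        b′ = 1 + advance (2 + b) p
        p′ = compile c′ d b′
    in jumpLess (scalar i) (scalar j) b′ ∷ jumpLess (scalar j) (scalar i) b′ ∷
       p ++ jump (advance b′ p′) ∷ p′
  compile (ifLess r s c c′) d b =
    let p′ = compile c′ d (1 + b)
        b′ = 1 + advance (1 + b) p′
        p  = compile c d b′
    in wjumpLess (toℕ r) (toℕ s) b′ ∷ p′ ++ jump (advance b′ p) ∷ p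
  compile (for i c)        d b =
    loop d b (set 1 0 ∷ add (scalar i) (counter d) 1 ∷ compile c (suc d) (5 + b))

  -- The compiled command takes at most `coef c * N ^ depth c` instructions. The 9 for a loop comes
  -- from 6 instructions of overhead per iteration and 3 outside, as 6N + 3 is at most 9N.
  coef depth : Cmd → ℕ
  coef skip              = 0
  coef (c ⨾ c′)          = coef c + coef c′
  coef (mv _ _)          = 2
  coef (lit _ _)         = 1
  coef (ld _ _ _)        = 7
  coef (st _ _ _)        = 7
  coef (dist _ _ _)      = 9
  coef (wdiv _ _ _)      = 1
  coef (print _)         = 1
  coef (ifEq _ _ c c′)   = 3 + (coef c + coef c′)
  coef (ifLess _ _ c c′) = 2 + (coef c + coef c′)
  coef (for _ c)         = 9 + coef c

  depth (c ⨾ c′)          = depth c ⊔ depth c′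
  depth (ifEq _ _ c c′)   = depth c ⊔ depth c′
  depth (ifLess _ _ c c′) = depth c ⊔ depth c′
  depth (for _ c)         = suc (depth c)
  depth _                 = 0

  -- Without multiplication the row addresses of the weight matrix are tabulated once by repeated
  -- addition; cell 4 carries the next one.
  rows : Program
  rows = set 4 64 ∷ loop 0 1 (locate rowArray (counter 0) ++ store 2 4 ∷ add 4 4 0 ∷ [])

  assemble : Cmd → Program
  assemble c = rows ++ compile c 0 (advance 0 rows)

  -- Opaque, since otherwise loops over 2 + m vertices would be unrolled
  -- twice whenever their semantics is normalised.
  opaque
    everyone : ∀ n → List (Fin n)
    everyone n = allFin n

    everyone-allFin : ∀ n → everyone n ≡ allFin n
    everyone-allFin n = refl

  -- Memory updates, addresses and the placement of code

  ↦-same : ∀ (f : ℕ → B) i {v} → (f [ i ↦ v ]) i ≡ v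
  ↦-same f i rewrite dec-true (i ℕ.≟ i) refl = refl

  ↦-other : ∀ (f : ℕ → B) {i j v} → j ≢ i → (f [ i ↦ v ]) j ≡ f j
  ↦-other f {i} {j} j≢i rewrite dec-false (j ℕ.≟ i) j≢i = refl

  -- The residue modulo 16 identifies the array, after which the index cancels.
  addr-injective : ∀ {a b : Fin 16} {k l} → addr a k ≡ addr b l → a ≡ b × k ≡ l
  addr-injective {a} {b} {k} {l} eq = a≡b , k≡l
    where
    eq′ : 16 * k + toℕ a ≡ 16 * l + toℕ b
    eq′ = ℕ.+-cancelˡ-≡ 64 _ _ eq
    residue : ∀ k (a : Fin 16) → (16 * k + toℕ a) % 16 ≡ toℕ a
    residue k a = begin
      (16 * k + toℕ a) % 16 ≡⟨ cong (_% 16) (ℕ.+-comm (16 * k) (toℕ a)) ⟩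
      (toℕ a + 16 * k) % 16 ≡⟨ cong (λ x → (toℕ a + x) % 16) (ℕ.*-comm 16 k) ⟩
      (toℕ a + k * 16) % 16 ≡⟨ [m+kn]%n≡m%n (toℕ a) k 16 ⟩
      toℕ a % 16            ≡⟨ m<n⇒m%n≡m (Fin.toℕ<n a) ⟩
      toℕ a                 ∎
      where open ≡-Reasoning
    a≡b : a ≡ b
    a≡b = Fin.toℕ-injective (trans (sym (residue k a)) (trans (cong (_% 16) eq′) (residue l b)))
    k≡l : k ≡ l
    k≡l = ℕ.*-cancelˡ-≡ k l 16 (ℕ.+-cancelʳ-≡ (toℕ a) _ _ (trans eq′ (cong (λ c → 16 * l + toℕ c) (sym a≡b))))

  ↦-array : ∀ (f : ℕ → B) {a b : Fin 16} {k l v} → b ≢ a → (f [ addr a k ↦ v ]) (addr b l) ≡ f (addr b l)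
  ↦-array f {a} {b} {k} {l} b≢a = ↦-other f (b≢a ∘ proj₁ ∘ addr-injective {b} {a} {l} {k})

  ↦-index : ∀ (f : ℕ → B) {a : Fin 16} {k l v} → l ≢ k → (f [ addr a k ↦ v ]) (addr a l) ≡ f (addr a l)
  ↦-index f {a} {k} {l} l≢k = ↦-other f (l≢k ∘ proj₂ ∘ addr-injective {a} {a} {l} {k})

  infixl 9 _[_≔_]
  _[_≔_] : (Fin n → B) → Fin n → B → Fin n → B
  (f [ x ≔ v ]) y = if does (y ≟ᶠ x) then v else f y

  locate-addr : ∀ a x → let y = x + x ; z = y + y ; w = z + z in (w + w) + (64 + toℕ a) ≡ addr a x
  locate-addr a x = sixteen x 64 (toℕ a)
    where
    sixteen : ∀ x c r → let y = x + x ; z = y + y ; w = z + z in (w + w) + (c + r) ≡ c + (16 * x + r)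
    sixteen = solve-∀

  -- The memory left by `locate`, update by update, so that executing the code reduces to it.
  located : Fin 16 → ℕ → (ℕ → ℕ) → ℕ → ℕ
  located a x M = let y = x + x ; z = y + y ; w = z + z in
    M [ 2 ↦ y ] [ 2 ↦ z ] [ 2 ↦ w ] [ 2 ↦ w + w ] [ 3 ↦ 64 + toℕ a ] [ 2 ↦ (w + w) + (64 + toℕ a) ]

  CodeAt : Program → ℕ → Program → Set
  CodeAt P b []      = Unit
  CodeAt P b (i ∷ p) = fetch P b ≡ just i × CodeAt P (suc b) p

  CodeAt-++ : ∀ {P} b p {q} → CodeAt P b (p ++ q) → CodeAt P b p × CodeAt P (advance b p) q
  CodeAt-++ b []      at       = tt , at
  CodeAt-++ b (_ ∷ p) (f , at) = let l , r = CodeAt-++ (suc b) p at in (f , l) , r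

  CodeAt-self : ∀ P → CodeAt P 0 P
  CodeAt-self P = go P 0 refl
    where
    drop-suc : ∀ {i p} b (P : Program) → drop b P ≡ i ∷ p → drop (suc b) P ≡ p
    drop-suc zero    (_ ∷ P) refl = refl
    drop-suc (suc b) (_ ∷ P) eq   = drop-suc b P eq
    go : ∀ p b → drop b P ≡ p → CodeAt P b p
    go []      b eq = tt
    go (i ∷ p) b eq = cong head eq , go p (suc b) (drop-suc b P eq)

  fetch-end : ∀ P → fetch P (advance 0 P) ≡ nothing
  fetch-end P = trans (cong (fetch P) (advance-length 0 P)) (go P)
    where
    advance-length : ∀ b (p : Program) → advance b p ≡ length p + b
    advance-length b []      = refl
    advance-length b (_ ∷ p) = trans (advance-length (suc b) p) (ℕ.+-suc _ b)
    go : ∀ P → fetch P (length P + 0) ≡ nothing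
    go []      = refl
    go (_ ∷ P) = go P

  advance-++ : ∀ b p {q} → advance b (p ++ q) ≡ advance (advance b p) q
  advance-++ b []      = refl
  advance-++ b (_ ∷ p) = advance-++ (suc b) p

  -- Runs of the machine and the rule for loops

  module _ {K : OrderedField} where
    open OrderedField K using (Carrier; _/_; _<?_)

    infix 3 _⊢_⟶[_]_
    data _⊢_⟶[_]_ (P : Program) : Config {K} → ℕ → Config {K} → Set where
      []   : ∀ {γ} → P ⊢ γ ⟶[ 0 ] γ
      step : ∀ {γ γ′ t i} → fetch P (Config.pc γ) ≡ just i → P ⊢ exec i γ ⟶[ t ] γ′ → P ⊢ γ ⟶[ suc t ] γ′

    _◅◅_ : ∀ {P γ γ′ γ″ t t′} → P ⊢ γ ⟶[ t ] γ′ → P ⊢ γ′ ⟶[ t′ ] γ″ → P ⊢ γ ⟶[ t + t′ ] γ″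
    []       ◅◅ s = s
    step f r ◅◅ s = step f (r ◅◅ s)

    ⟶⇒⇓ : ∀ {P γ γ′ t} → P ⊢ γ ⟶[ t ] γ′ → fetch P (Config.pc γ′) ≡ nothing → P ⊢ γ ⇓[ t ] γ′
    ⟶⇒⇓ []         end = halt end
    ⟶⇒⇓ (step f r) end = next f (⟶⇒⇓ r end)

    departing : ∀ {P b b′ M W o t γ} → b′ ≡ b → P ⊢ config b M W o ⟶[ t ] γ → P ⊢ config b′ M W o ⟶[ t ] γ
    departing refl r = r

    arriving : ∀ {P e e′ M W o t γ} → e′ ≡ e → P ⊢ γ ⟶[ t ] config e M W o → P ⊢ γ ⟶[ t ] config e′ M W o
    arriving refl r = r

    Memory : Set₁
    Memory = (ℕ → ℕ) → (ℕ → Carrier) → List ℕ → Set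

    Reaches : Program → (b : ℕ) (M : ℕ → ℕ) (W : ℕ → Carrier) (o : List ℕ) (e bound : ℕ) → Memory → Set
    Reaches P b M W o e bound Q =
      ∃[ M′ ] ∃[ W′ ] ∃[ o′ ] ∃[ t ] P ⊢ config b M W o ⟶[ t ] config e M′ W′ o′ × Q M′ W′ o′ × t ≤ bound

    module _ {P : Program} {n d b : ℕ} {body : Program} {bound : ℕ} (I : ℕ → Memory)
             (I-size : ∀ {k M W o} → I k M W o → M 0 ≡ n)
             (run : ∀ {k M W o} → k < n → I k M W o → M (counter d) ≡ k →
                    Reaches P (3 + b) M W o (advance (3 + b) body) bound λ M′ W′ o′ →
                      M′ (counter d) ≡ k × I (suc k) (M′ [ 1 ↦ 1 ] [ counter d ↦ suc k ]) W′ o′)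
             (at : CodeAt P b (loop d b body))
             where

      private
        at-body = CodeAt-++ (3 + b) body (proj₂ (proj₂ (proj₂ at)))
        at-tail = proj₂ at-body

      -- Induction on the number `j` of iterations left. Besides the body an iteration costs the
      -- test, two instructions to increment the counter and the jump back; the final 2 are the
      -- failing test and the jump out. The invariant is required after the increment, so it has to
      -- tolerate the writes to cell 1 and to the counter.
      loop-from : ∀ k j {M W o} → k + j ≡ n → I k M W o → M (counter d) ≡ k →
                  Reaches P (1 + b) M W o (advance b (loop d b body)) (j * (4 + bound) + 2) (I n)
      loop-from k zero {M} {W} {o} eq inv c≡k =
        M , W , o , 2 , step (proj₁ (proj₂ at)) (departing stop
          (arriving (advance-++ (3 + b) body) (step (proj₁ (proj₂ (proj₂ at))) [])))
          , subst (λ k → I k M W o) k≡n inv , ℕ.≤-refl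
        where
        k≡n = trans (sym (ℕ.+-identityʳ k)) eq
        stop : (if does (M (counter d) ℕ.<? M 0) then 3 + b else 2 + b) ≡ 2 + b
        stop rewrite c≡k | I-size inv | k≡n | dec-false (n ℕ.<? n) (ℕ.<-irrefl refl) = refl
      loop-from k (suc j) {M} {W} {o} eq inv c≡k =
        let M′ , W′ , o′ , t , r , (c≡k′ , inv′) , t≤ = run k<n inv c≡k
            inc = trans (cong (_+ 1) c≡k′) (ℕ.+-comm k 1)
            M₂ , W₂ , o₂ , t₂ , r₂ , inv₂ , t₂≤ =
              loop-from (suc k) j (trans (sym (ℕ.+-suc k j)) eq)
                (subst (λ x → I (suc k) (M′ [ 1 ↦ 1 ] [ counter d ↦ x ]) W′ o′) (sym inc) inv′)
                (trans (↦-same (M′ [ 1 ↦ 1 ]) (counter d)) inc)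
            r₃ = step (proj₁ at-tail) (step (proj₁ (proj₂ at-tail)) (step (proj₁ (proj₂ (proj₂ at-tail))) r₂))
        in M₂ , W₂ , o₂ , _
           , step (proj₁ (proj₂ at)) (departing continue (r ◅◅ r₃))
           , inv₂ , time t t₂ t≤ t₂≤
        where
        k<n : k < n
        k<n = subst (suc k ≤_) eq (subst (suc k ≤_) (sym (ℕ.+-suc k j)) (s≤s (ℕ.m≤m+n k j)))
        continue : (if does (M (counter d) ℕ.<? M 0) then 3 + b else 2 + b) ≡ 3 + b
        continue rewrite c≡k | I-size inv | dec-true (k ℕ.<? n) k<n = refl
        time : ∀ t t₂ → t ≤ bound → t₂ ≤ j * (4 + bound) + 2 →
               suc (t + suc (suc (suc t₂))) ≤ (4 + bound + j * (4 + bound)) + 2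
        time t t₂ t≤ t₂≤ = begin
          suc (t + suc (suc (suc t₂)))              ≡⟨ lemma t t₂ ⟩
          4 + t + t₂                                ≤⟨ ℕ.+-mono-≤ (ℕ.+-monoʳ-≤ 4 t≤) t₂≤ ⟩
          4 + bound + (j * (4 + bound) + 2)         ≡⟨ ℕ.+-assoc (4 + bound) (j * (4 + bound)) 2 ⟨
          4 + bound + j * (4 + bound) + 2           ∎
          where
          open ℕ.≤-Reasoning
          lemma : ∀ t t₂ → suc (t + suc (suc (suc t₂))) ≡ 4 + t + t₂
          lemma = solve-∀

      loop-runs : ∀ {M W o} → I 0 (M [ counter d ↦ 0 ]) W o →
                  Reaches P b M W o (advance b (loop d b body)) (n * (4 + bound) + 3) (I n)
      loop-runs {M} inv with loop-from 0 n refl inv (↦-same M (counter d))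
      ... | M′ , W′ , o′ , t , r , q , t≤ = M′ , W′ , o′ , suc t , step (proj₁ at) r , q
          , subst (suc t ≤_) (sym (ℕ.+-suc (n * (4 + bound)) 2)) (s≤s t≤)

  -- Semantics of commands and correctness of their compilation

  module Interpreter {K : OrderedField} {m : ℕ} (G : WeightedCompleteGraph K (2 + m)) where
    open OrderedField K using (Carrier; 0#; _/_; _<?_)
    open WeightedCompleteGraph G using (d)
    private
      N = 2 + m

    record Store : Set where
      constructor store
      field
        V   : ℕ → Fin N
        A   : Fin 13 → Fin N → Fin N
        R   : Fin 8 → Carrier
        out : List ℕ

    open Store

    setV : ℕ → Fin N → Store → Store
    setV i x σ = record σ { V = V σ [ i ↦ x ] }

    setA : Fin 13 → Fin N → Fin N → Store → Store
    setA a x y σ = record σ { A = A σ [ a ≔ A σ a [ x ≔ y ] ] }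

    setR : Fin 8 → Carrier → Store → Store
    setR r w σ = record σ { R = R σ [ r ≔ w ] }

    eval : Cmd → Store → Store
    eval skip              σ = σ
    eval (c ⨾ c′)          σ = eval c′ (eval c σ)
    eval (mv i j)          σ = setV i (V σ j) σ
    eval (lit i c)         σ = setV i (c ↑ˡ m) σ
    eval (ld i a j)        σ = setV i (A σ a (V σ j)) σ
    eval (st a i j)        σ = setA a (V σ i) (V σ j) σ
    eval (dist r i j)      σ = setR r (d (V σ i) (V σ j)) σ
    eval (wdiv r s t)      σ = setR r (R σ s / R σ t) σ
    eval (print i)         σ = record σ { out = out σ ∷ʳ toℕ (V σ i) }
    eval (ifEq i j c c′)   σ = if does (V σ i ≟ᶠ V σ j) then eval c σ else eval c′ σ
    eval (ifLess r s c c′) σ = if does (R σ r <? R σ s) then eval c σ else eval c′ σ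
    eval (for i c)         σ = foldl (λ σ x → eval c (setV i x σ)) σ (everyone N)

    -- Nothing is said of the temporaries in integer cells 1 to 63 nor of the loop counters:
    -- compiled code may overwrite the former, and the latter are tracked separately in `run`.
    record Represents (σ : Store) (M : ℕ → ℕ) (W : ℕ → Carrier) (o : List ℕ) : Set where
      field
        size    : M 0 ≡ N
        scalars : ∀ i → M (scalar i) ≡ toℕ (V σ i)
        arrays  : ∀ a x → M (addr (array a) (toℕ x)) ≡ toℕ (A σ a x)
        rowsAt  : ∀ (u : Fin N) → M (addr rowArray (toℕ u)) ≡ 64 + N * toℕ u
        weights : ∀ r → W (toℕ r) ≡ R σ r
        matrix  : ∀ (u v : Fin N) → W (64 + (N * toℕ u + toℕ v)) ≡ d u v
        output  : o ≡ out σ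

    open Represents

    represents-cong : ∀ {σ W o} M M′ → Represents σ M W o → M′ 0 ≡ M 0 →
                      (∀ a k → a ≢ suc zero → M′ (addr a k) ≡ M (addr a k)) → Represents σ M′ W o
    represents-cong M M′ s eq eqs = record
      { size    = trans eq (size s)
      ; scalars = λ i → trans (eqs zero i (λ ())) (scalars s i)
      ; arrays  = λ a x → trans (eqs (array a) (toℕ x) (λ ())) (arrays s a x)
      ; rowsAt  = λ u → trans (eqs rowArray (toℕ u) (λ ())) (rowsAt s u)
      ; weights = weights s
      ; matrix  = matrix s
      ; output  = output s
      }

    represents-counter : ∀ {σ W o} M k {v} → Represents σ M W o → Represents σ (M [ counter k ↦ v ]) W o
    represents-counter M k {v} s = represents-cong M (M [ counter k ↦ v ]) s refl λ a l a≢1 → ↦-array M {suc zero} {a} {k} {l} a≢1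

    represents-setV : ∀ {σ W o} M i x {v} → Represents σ M W o → v ≡ toℕ x →
                      Represents (setV i x σ) (M [ scalar i ↦ v ]) W o
    represents-setV {σ} M i x {v} s eq = record
      { size    = size s
      ; scalars = scalars′
      ; arrays  = λ a x → trans (↦-array M {zero} {array a} {i} {toℕ x} (λ ())) (arrays s a x)
      ; rowsAt  = λ u → trans (↦-array M {zero} {rowArray} {i} {toℕ u} (λ ())) (rowsAt s u)
      ; weights = weights s
      ; matrix  = matrix s
      ; output  = output s
      }
      where
      scalars′ : ∀ j → (M [ scalar i ↦ v ]) (scalar j) ≡ toℕ ((V σ [ i ↦ x ]) j)
      scalars′ j with j ℕ.≟ i
      ... | yes refl = trans (↦-same M (scalar i)) (trans eq (cong toℕ (sym (↦-same (V σ) i))))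
      ... | no  j≢i  = trans (↦-index M {zero} {i} {j} j≢i) (trans (scalars s j) (cong toℕ (sym (↦-other (V σ) j≢i))))

    represents-setA : ∀ {σ W o} M a x y {v} → Represents σ M W o → v ≡ toℕ y →
                      Represents (setA a x y σ) (M [ addr (array a) (toℕ x) ↦ v ]) W o
    represents-setA {σ} M a x y {v} s eq = record
      { size    = size s
      ; scalars = λ i → trans (↦-array M {array a} {zero} {toℕ x} {i} (λ ())) (scalars s i)
      ; arrays  = arrays′
      ; rowsAt  = λ u → trans (↦-array M {array a} {rowArray} {toℕ x} {toℕ u} (λ ())) (rowsAt s u)
      ; weights = weights s
      ; matrix  = matrix s
      ; output  = output s
      }
      where
      arrays′ : ∀ b z → (M [ addr (array a) (toℕ x) ↦ v ]) (addr (array b) (toℕ z)) ≡ toℕ (A (setA a x y σ) b z)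
      arrays′ b z with b ≟ᶠ a
      ... | no  b≢a  = trans (↦-array M {array a} {array b} {toℕ x} {toℕ z}
                         (b≢a ∘ Fin.suc-injective ∘ Fin.suc-injective ∘ Fin.suc-injective)) (arrays s b z)
      ... | yes refl with z ≟ᶠ x
      ...   | yes refl = trans (↦-same M (addr (array a) (toℕ x))) eq
      ...   | no  z≢x  = trans (↦-index M {array a} {toℕ x} {toℕ z} (z≢x ∘ Fin.toℕ-injective)) (arrays s a z)

    represents-setR : ∀ {σ M o} W r w {v} → Represents σ M W o → v ≡ w →
                      Represents (setR r w σ) M (W [ toℕ r ↦ v ]) o
    represents-setR {σ} W r w {v} s eq = record
      { size    = size s
      ; scalars = scalars s
      ; arrays  = arrays s
      ; rowsAt  = rowsAt s
      ; weights = weights′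
      ; matrix  = λ u v → trans (↦-other W (high u v)) (matrix s u v)
      ; output  = output s
      }
      where
      weights′ : ∀ q → (W [ toℕ r ↦ v ]) (toℕ q) ≡ (R σ [ r ≔ w ]) q
      weights′ q with q ≟ᶠ r
      ... | yes refl = trans (↦-same W (toℕ r)) eq
      ... | no  q≢r  = trans (↦-other W (q≢r ∘ Fin.toℕ-injective)) (weights s q)
      high : ∀ (u v : Fin N) → 64 + (N * toℕ u + toℕ v) ≢ toℕ r
      high u v eq = ℕ.<⇒≢ (ℕ.<-≤-trans (Fin.toℕ<n r) (ℕ.≤-trans (ℕ.m≤m+n 8 56) (ℕ.m≤m+n 64 _))) (sym eq)

    bound : Cmd → ℕ
    bound c = coef c * N ^ depth c

    at-most : ∀ k {t D} → t ≤ k → t ≤ k * N ^ D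
    at-most k {t} {D} t≤k = ℕ.≤-trans t≤k (subst (_≤ k * N ^ D) (ℕ.*-identityʳ k)
      (ℕ.*-monoʳ-≤ k (ℕ.m^n>0 N D)))

    sum-bound : ∀ {t t′} k k′ D D′ → t ≤ k * N ^ D → t′ ≤ k′ * N ^ D′ → t + t′ ≤ (k + k′) * N ^ (D ⊔ D′)
    sum-bound {t} {t′} k k′ D D′ t≤ t′≤ = begin
      t + t′                                  ≤⟨ ℕ.+-mono-≤ t≤ t′≤ ⟩
      k * N ^ D + k′ * N ^ D′                 ≤⟨ ℕ.+-mono-≤ (ℕ.*-monoʳ-≤ k (ℕ.^-monoʳ-≤ N (ℕ.m≤m⊔n D D′)))
                                                             (ℕ.*-monoʳ-≤ k′ (ℕ.^-monoʳ-≤ N (ℕ.m≤n⊔m D D′))) ⟩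
      k * N ^ (D ⊔ D′) + k′ * N ^ (D ⊔ D′)    ≡⟨ ℕ.*-distribʳ-+ (N ^ (D ⊔ D′)) k k′ ⟨
      (k + k′) * N ^ (D ⊔ D′)                 ∎
      where open ℕ.≤-Reasoning

    loop-bound : ∀ k D → N * (4 + (2 + k * N ^ D)) + 3 ≤ (9 + k) * N ^ suc D
    loop-bound k D = begin
      N * (6 + k * N ^ D) + 3              ≡⟨ cong (_+ 3) (ℕ.*-distribˡ-+ N 6 (k * N ^ D)) ⟩
      N * 6 + N * (k * N ^ D) + 3          ≡⟨ lemma N k (N ^ D) ⟩
      (6 * N + 3) + k * (N * N ^ D)        ≤⟨ ℕ.+-monoˡ-≤ (k * N ^ suc D) nine ⟩
      9 * N ^ suc D + k * N ^ suc D        ≡⟨ ℕ.*-distribʳ-+ (N ^ suc D) 9 k ⟨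
      (9 + k) * N ^ suc D                  ∎
      where
      open ℕ.≤-Reasoning
      lemma : ∀ N k X → N * 6 + N * (k * X) + 3 ≡ (6 * N + 3) + k * (N * X)
      lemma = solve-∀
      nine : 6 * N + 3 ≤ 9 * N ^ suc D
      nine = begin
        6 * N + 3 * 1   ≤⟨ ℕ.+-monoʳ-≤ (6 * N) (ℕ.*-monoʳ-≤ 3 {1} {N} (s≤s z≤n)) ⟩
        6 * N + 3 * N   ≡⟨ ℕ.*-distribʳ-+ N 6 3 ⟨
        9 * N           ≡⟨ cong (9 *_) (ℕ.*-identityʳ N) ⟨
        9 * (N * 1)     ≤⟨ ℕ.*-monoʳ-≤ 9 (ℕ.*-monoʳ-≤ N (ℕ.m^n>0 N D)) ⟩
        9 * N ^ suc D   ∎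

    drop-tabulate : ∀ {n k} (f : Fin n → B) (k<n : k < n) →
                    drop k (tabulate f) ≡ f (fromℕ< k<n) ∷ drop (suc k) (tabulate f)
    drop-tabulate {n = suc n} {zero}  f (s≤s z≤n)   = refl
    drop-tabulate {n = suc n} {suc k} f (s≤s k<n) = drop-tabulate (f ∘ suc) k<n

    drop-all : ∀ {n} (f : Fin n → B) → drop n (tabulate f) ≡ []
    drop-all {n = zero}  f = refl
    drop-all {n = suc n} f = drop-all (f ∘ suc)

    branch-bound : ∀ k c c′ {t s} → s ≤ k + t → t ≤ bound c ⊎ t ≤ bound c′ →
                   s ≤ (k + (coef c + coef c′)) * N ^ (depth c ⊔ depth c′)
    branch-bound k c c′ {t} s≤ t≤ = ℕ.≤-trans s≤
      (sum-bound k (coef c + coef c′) 0 (depth c ⊔ depth c′) (at-most k {D = 0} ℕ.≤-refl) (either t≤))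
      where
      either : t ≤ bound c ⊎ t ≤ bound c′ → t ≤ (coef c + coef c′) * N ^ (depth c ⊔ depth c′)
      either (inj₁ t≤c)  = subst (_≤ _) (ℕ.+-identityʳ t) (sum-bound (coef c) (coef c′) (depth c) (depth c′) t≤c z≤n)
      either (inj₂ t≤c′) = sum-bound (coef c) (coef c′) (depth c) (depth c′) z≤n t≤c′

    jumps : ∀ {x y u v : ℕ} → x < y → (if does (x ℕ.<? y) then u else v) ≡ u
    jumps {x} {y} x<y rewrite dec-true (x ℕ.<? y) x<y = refl

    falls : ∀ {x y u v : ℕ} → ¬ (x < y) → (if does (x ℕ.<? y) then u else v) ≡ v
    falls {x} {y} x≮y rewrite dec-false (x ℕ.<? y) x≮y = refl

    -- The correctness of the body is a hypothesis, so that the loop is treated outside the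
    -- recursion on commands.
    run-for : ∀ {P} i c e b {σ M W o} →
      (∀ {σ M W o} → Represents σ M W o →
         Reaches {K} P (5 + b) M W o (advance (5 + b) (compile c (suc e) (5 + b))) (bound c) λ M′ W′ o′ →
           Represents (eval c σ) M′ W′ o′ × (∀ k → k < suc e → M′ (counter k) ≡ M (counter k))) →
      CodeAt P b (compile (for i c) e b) → Represents σ M W o →
      Reaches {K} P b M W o (advance b (compile (for i c) e b)) (bound (for i c)) λ M′ W′ o′ →
        Represents (eval (for i c) σ) M′ W′ o′ × (∀ k → k < e → M′ (counter k) ≡ M (counter k))
    run-for {P} i c e b {σ} {M} {W} {o} body-runs at s =
      let M′ , W′ , o′ , t , r , (σ′ , s′ , eq , keep) , t≤ =
            loop-runs {P = P} {n = N} {d = e} {b = b} {body = set 1 0 ∷ add (scalar i) (counter e) 1 ∷ compile c (suc e) (5 + b)}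
              {bound = 2 + bound c} I (λ (_ , s , _) → size s) iteration at
              (σ , represents-counter M e s , cong (foldl F σ) (sym (everyone-allFin N)) , λ k k<e → ↦-index M {suc zero} {e} {k} (ℕ.<⇒≢ k<e))
      in M′ , W′ , o′ , t , r
         , (subst (λ σ → Represents σ M′ W′ o′)
              (trans (sym (cong (foldl F σ′) (drop-all {n = N} id))) eq) s′ , keep)
         , ℕ.≤-trans t≤ (loop-bound (coef c) (depth c))
      where
      F : Store → Fin N → Store
      F σ x = eval c (setV i x σ)
      -- The invariant describes the work still to be done: folding over the remaining vertices from
      -- the current store yields the final store. When no vertex remains, the current store is the
      -- final one.
      I : ℕ → Memory {K}
      I k M′ W′ o′ = ∃[ σ′ ] Represents σ′ M′ W′ o′ ×
        foldl F σ′ (drop k (allFin N)) ≡ foldl F σ (everyone N) × (∀ k → k < e → M′ (counter k) ≡ M (counter k))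
      iteration : ∀ {k M₁ W₁ o₁} → k < N → I k M₁ W₁ o₁ → M₁ (counter e) ≡ k →
        Reaches {K} P (3 + b) M₁ W₁ o₁ (advance (5 + b) (compile c (suc e) (5 + b))) (2 + bound c) λ M′ W′ o′ →
          M′ (counter e) ≡ k × I (suc k) (M′ [ 1 ↦ 1 ] [ counter e ↦ suc k ]) W′ o′
      iteration {k} {M₁} {W₁} {o₁} k<N (σ₁ , s₁ , eq₁ , keep₁) c≡k =
        let x = fromℕ< k<N
            s₂ = represents-setV (M₁ [ 1 ↦ 0 ]) i x (represents-cong M₁ (M₁ [ 1 ↦ 0 ]) s₁ refl (λ _ _ _ → refl))
                   (trans (ℕ.+-identityʳ _) (trans c≡k (sym (Fin.toℕ-fromℕ< k<N))))
            M′ , W′ , o′ , t , r , (s′ , keep) , t≤ = body-runs s₂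
            M₂ = M₁ [ 1 ↦ 0 ]
            unchanged = λ j → ↦-array M₂ {zero} {suc zero} {i} {j} {M₁ (counter e) + 0} (λ ())
        in M′ , W′ , o′ , _
           , step (proj₁ (proj₂ (proj₂ (proj₂ at)))) (step (proj₁ (proj₂ (proj₂ (proj₂ (proj₂ at))))) r)
           , (trans (keep e ℕ.≤-refl) (trans (unchanged e) c≡k)
             , F σ₁ x
             , represents-counter (M′ [ 1 ↦ 1 ]) e (represents-cong M′ (M′ [ 1 ↦ 1 ]) s′ refl (λ _ _ _ → refl))
             , trans (sym (cong (foldl F σ₁) (drop-tabulate id k<N))) eq₁
             , λ j j<e → trans (↦-index (M′ [ 1 ↦ 1 ]) {suc zero} {e} {j} (ℕ.<⇒≢ j<e))
                           (trans (keep j (ℕ.m≤n⇒m≤1+n j<e)) (trans (unchanged j) (keep₁ j j<e))))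
           , s≤s (s≤s t≤)

    -- The clause on counters below `e` protects the enclosing loops.
    run : ∀ {P} c e b {σ M W o} → CodeAt P b (compile c e b) → Represents σ M W o →
          Reaches {K} P b M W o (advance b (compile c e b)) (bound c) λ M′ W′ o′ →
            Represents (eval c σ) M′ W′ o′ × (∀ k → k < e → M′ (counter k) ≡ M (counter k))
    run skip e b at s = _ , _ , _ , _ , [] , (s , λ _ _ → refl) , z≤n
    run (c ⨾ c′) e b at s =
      let p = compile c e b
          at₁ , at₂ = CodeAt-++ b p at
          M₁ , W₁ , o₁ , t₁ , r₁ , (s₁ , keep₁) , t₁≤ = run c e b at₁ s
          M₂ , W₂ , o₂ , t₂ , r₂ , (s₂ , keep₂) , t₂≤ = run c′ e (advance b p) at₂ s₁
      in M₂ , W₂ , o₂ , _ , arriving (advance-++ b p) (r₁ ◅◅ r₂)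
         , (s₂ , λ k k<e → trans (keep₂ k k<e) (keep₁ k k<e))
         , sum-bound (coef c) (coef c′) (depth c) (depth c′) t₁≤ t₂≤
    run (mv i j) e b {σ} {M} (f₁ , f₂ , _) s = _ , _ , _ , _ , step f₁ (step f₂ [])
      , ( represents-setV (M [ 1 ↦ 0 ]) i (V σ j) (represents-cong M (M [ 1 ↦ 0 ]) s refl (λ _ _ _ → refl)) (trans (ℕ.+-identityʳ _) (scalars s j))
        , λ k _ → ↦-array (M [ 1 ↦ 0 ]) {zero} {suc zero} {i} {k} (λ ()))
      , at-most 2 {D = 0} ℕ.≤-refl
    run (lit i c) e b {σ} {M} (f₁ , _) s = _ , _ , _ , _ , step f₁ []
      , ( represents-setV M i (c ↑ˡ m) s (sym (Fin.toℕ-↑ˡ c m))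
        , λ k _ → ↦-array M {zero} {suc zero} {i} {k} (λ ()))
      , at-most 1 {D = 0} ℕ.≤-refl
    run (ld i a j) e b {σ} {M} (f₁ , f₂ , f₃ , f₄ , f₅ , f₆ , f₇ , _) s = _ , _ , _ , _
      , step f₁ (step f₂ (step f₃ (step f₄ (step f₅ (step f₆ (step f₇ []))))))
      , ( represents-setV L i (A σ a (V σ j)) (represents-cong M L s refl (λ _ _ _ → refl))
            (trans (cong L (locate-addr (array a) (M (scalar j))))
              (trans (cong (λ x → M (addr (array a) x)) {M (scalar j)} {toℕ (V σ j)} (scalars s j)) (arrays s a (V σ j))))
        , λ k _ → ↦-array L {zero} {suc zero} {i} {k} (λ ()))
      , at-most 7 {D = 0} ℕ.≤-refl
      where L = located (array a) (M (scalar j)) M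
    run (st a i j) e b {σ} {M} {W} {o} (f₁ , f₂ , f₃ , f₄ , f₅ , f₆ , f₇ , _) s = _ , _ , _ , _
      , step f₁ (step f₂ (step f₃ (step f₄ (step f₅ (step f₆ (step f₇ []))))))
      , subst (λ x → Represents (setA a (V σ i) (V σ j) σ) (L [ x ↦ M (scalar j) ]) W o ×
                     (∀ k → k < e → (L [ x ↦ M (scalar j) ]) (counter k) ≡ M (counter k)))
          (sym (trans (locate-addr (array a) (M (scalar i))) (cong (addr (array a)) {M (scalar i)} {toℕ (V σ i)} (scalars s i))))
          ( represents-setA L a (V σ i) (V σ j) (represents-cong M L s refl (λ _ _ _ → refl)) (scalars s j)
          , λ k _ → ↦-array L {array a} {suc zero} {toℕ (V σ i)} {k} (λ ()))
      , at-most 7 {D = 0} ℕ.≤-refl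
      where L = located (array a) (M (scalar i)) M
    run (dist r i j) e b {σ} {M} {W} (f₁ , f₂ , f₃ , f₄ , f₅ , f₆ , f₇ , f₈ , f₉ , _) s = _ , _ , _ , _
      , step f₁ (step f₂ (step f₃ (step f₄ (step f₅ (step f₆ (step f₇ (step f₈ (step f₉ []))))))))
      , ( represents-setR W r (d (V σ i) (V σ j)) (represents-cong M L′ s refl (λ _ _ _ → refl))
            (trans (cong₂ (λ x y → W (x + y))
                     (trans (cong L (locate-addr rowArray (M (scalar i))))
                       (trans (cong (λ x → M (addr rowArray x)) {M (scalar i)} {toℕ (V σ i)} (scalars s i)) (rowsAt s (V σ i))))
                     (scalars s j))
              (matrix s (V σ i) (V σ j)))
        , λ k _ → refl)
      , at-most 9 {D = 0} ℕ.≤-refl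
      where
      L = located rowArray (M (scalar i)) M
      L′ = L [ 2 ↦ L (L 2) ] [ 2 ↦ L (L 2) + M (scalar j) ]
    run (wdiv r p q) e b {σ} {M} {W} (f₁ , _) s = _ , _ , _ , _ , step f₁ []
      , (represents-setR W r (R σ p / R σ q) s (cong₂ _/_ (weights s p) (weights s q)) , λ _ _ → refl)
      , at-most 1 {D = 0} ℕ.≤-refl
    run (print i) e b {σ} (f₁ , _) s = _ , _ , _ , _ , step f₁ []
      , ( record { size = size s ; scalars = scalars s ; arrays = arrays s ; rowsAt = rowsAt s
                 ; weights = weights s ; matrix = matrix s
                 ; output = cong₂ _∷ʳ_ (output s) (scalars s i) }
        , λ _ _ → refl)
      , at-most 1 {D = 0} ℕ.≤-refl
    run (ifEq i j c c′) e b {σ} {M} {W} {o} (f₁ , f₂ , at) s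
      with CodeAt-++ (2 + b) (compile c e (2 + b)) at | V σ i ≟ᶠ V σ j
    ... | at₁ , f₃ , at₂ | yes i≡j =
      let M₁ , W₁ , o₁ , t₁ , r₁ , q , t₁≤ = run c e (2 + b) at₁ s
      in M₁ , W₁ , o₁ , _
         , arriving (advance-++ (2 + b) (compile c e (2 + b)))
             (step f₁ (departing (falls (ℕ.<-irrefl M≡)) (step f₂ (departing (falls (ℕ.<-irrefl (sym M≡)))
               (r₁ ◅◅ step f₃ [])))))
         , q , branch-bound 3 c c′ (ℕ.≤-reflexive (cong (2 +_) (ℕ.+-comm t₁ 1))) (inj₁ t₁≤)
      where
      M≡ : M (scalar i) ≡ M (scalar j)
      M≡ = trans (scalars s i) (trans (cong toℕ i≡j) (sym (scalars s j)))
    ... | at₁ , f₃ , at₂ | no i≢j =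
      let M₁ , W₁ , o₁ , t₁ , r₁ , q , t₁≤ = run c′ e (1 + advance (2 + b) (compile c e (2 + b))) at₂ s
          t , r , t≤ = enter r₁
      in M₁ , W₁ , o₁ , t , arriving (advance-++ (2 + b) (compile c e (2 + b))) r
         , q , branch-bound 3 c c′ t≤ (inj₂ t₁≤)
      where
      b′ = 1 + advance (2 + b) (compile c e (2 + b))
      -- The second branch is entered from either of the two comparisons, after one instruction or
      -- two.
      enter : ∀ {t γ} → _ ⊢ config b′ M W o ⟶[ t ] γ → ∃[ t′ ] _ ⊢ config b M W o ⟶[ t′ ] γ × t′ ≤ 3 + t
      enter {t} r with ℕ.<-cmp (M (scalar i)) (M (scalar j))
      ... | tri< i<j _ _ = _ , step f₁ (departing (jumps i<j) r) , s≤s (ℕ.m≤n+m t 2)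
      ... | tri≈ _ i≡j _ = contradiction
        (Fin.toℕ-injective (trans (sym (scalars s i)) (trans i≡j (scalars s j)))) i≢j
      ... | tri> i≮j _ j<i = _ , step f₁ (departing (falls i≮j) (step f₂ (departing (jumps j<i) r))) , s≤s (s≤s (ℕ.m≤n+m t 1))
    run (ifLess p q c c′) e b {σ} {M} {W} {o} (f₁ , at) s
      with CodeAt-++ (1 + b) (compile c′ e (1 + b)) at | R σ p <? R σ q in eq
    ... | at₁ , f₂ , at₂ | yes _ =
      let M₁ , W₁ , o₁ , t₁ , r₁ , post , t₁≤ = run c e (1 + advance (1 + b) (compile c′ e (1 + b))) at₂ s
      in M₁ , W₁ , o₁ , _ , arriving (advance-++ (1 + b) (compile c′ e (1 + b))) (step f₁ (departing
           (cong (if_then _ else _) (trans (cong₂ (λ x y → does (x <? y)) (weights s p) (weights s q)) (cong does eq))) r₁))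
         , post , branch-bound 2 c c′ (s≤s (ℕ.n≤1+n t₁)) (inj₁ t₁≤)
    ... | at₁ , f₂ , at₂ | no _ =
      let M₁ , W₁ , o₁ , t₁ , r₁ , post , t₁≤ = run c′ e (1 + b) at₁ s
      in M₁ , W₁ , o₁ , _ , arriving (advance-++ (1 + b) (compile c′ e (1 + b))) (step f₁ (departing
           (cong (if_then _ else _) (trans (cong₂ (λ x y → does (x <? y)) (weights s p) (weights s q)) (cong does eq)))
           (r₁ ◅◅ step f₂ [])))
         , post , branch-bound 2 c c′ (ℕ.≤-reflexive (cong suc (ℕ.+-comm t₁ 1))) (inj₂ t₁≤)
    run (for i c) e b at s = run-for i c e b
      (run c (suc e) (5 + b) (proj₁ (CodeAt-++ (5 + b) (compile c (suc e) (5 + b)) (proj₂ (proj₂ (proj₂ (proj₂ (proj₂ at)))))))) at s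

    -- The initial memory and the table of row addresses

    blank : Store
    blank = store (λ _ → zero) (λ _ _ → zero) (λ _ → 0#) []

    matrix-initial : ∀ u v → Config.W (initial G) (64 + (N * toℕ u + toℕ v)) ≡ d u v
    matrix-initial u v = begin
      Config.W (initial G) (64 + (N * toℕ u + toℕ v)) ≡⟨ cong (λ x → Config.W (initial G) (64 + x)) (sym (Fin.toℕ-combine u v)) ⟩
      Config.W (initial G) (64 + toℕ (combine u v))   ≡⟨ inside (combine u v) ⟩
      uncurry d (remQuot N (combine u v))             ≡⟨ cong (uncurry d) (Fin.remQuot-combine u v) ⟩
      d u v                                           ∎
      where
      open ≡-Reasoning
      inside : ∀ (x : Fin (N * N)) → Config.W (initial G) (64 + toℕ x) ≡ uncurry d (remQuot N x)
      inside x with toℕ x ℕ.<? N * N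
      ... | yes p = cong (λ y → uncurry d (remQuot N y)) (Fin.fromℕ<-toℕ x p)
      ... | no ≮ = contradiction (Fin.toℕ<n x) ≮

    record RowsUpTo (k : ℕ) (M : ℕ → ℕ) (W : ℕ → Carrier) (o : List ℕ) : Set where
      field
        size    : M 0 ≡ N
        zeros   : ∀ a j → a ≢ suc zero → a ≢ rowArray → M (addr a j) ≡ 0
        rowsAt  : ∀ j → j < k → M (addr rowArray j) ≡ 64 + N * j
        nextRow : M 4 ≡ 64 + N * k
        weights : W ≡ Config.W (initial G)
        output  : o ≡ []

    -- Per row, 8 instructions of the body and 4 of the loop; 3 more for entering and leaving the
    -- loop, and 1 to set the first address.
    rows-run : ∀ {P} → CodeAt P 0 rows →
               Reaches {K} P 0 (Config.M (initial G)) (Config.W (initial G)) [] (advance 0 rows)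
                 (1 + (N * 12 + 3)) (Represents blank)
    rows-run {P} (f₀ , at) =
      let M′ , W′ , o′ , t , r , inv , t≤ =
            loop-runs {P = P} {n = N} {d = 0} {b = 1} {body = body} {bound = 8} RowsUpTo
              RowsUpTo.size iteration at {M₀ [ 4 ↦ 64 ]} {W₀} {[]} start-rows
      in M′ , W′ , o′ , suc t , step f₀ r , done-rows inv , s≤s t≤
      where
      M₀ = Config.M (initial {K} G)
      W₀ = Config.W (initial {K} G)
      body : Program
      body = locate rowArray (counter 0) ++ store 2 4 ∷ add 4 4 0 ∷ []
      start-rows : RowsUpTo 0 (M₀ [ 4 ↦ 64 ] [ counter 0 ↦ 0 ]) W₀ []
      start-rows = record
        { size    = refl
        ; zeros   = λ a j a≢1 _ → ↦-array (M₀ [ 4 ↦ 64 ]) {suc zero} {a} {0} {j} a≢1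
        ; rowsAt  = λ _ ()
        ; nextRow = cong (64 +_) (sym (ℕ.*-zeroʳ N))
        ; weights = refl
        ; output  = refl
        }
      iteration : ∀ {k M W o} → k < N → RowsUpTo k M W o → M (counter 0) ≡ k →
        Reaches {K} P 4 M W o (advance 4 body) 8 λ M′ W′ o′ →
          M′ (counter 0) ≡ k × RowsUpTo (suc k) (M′ [ 1 ↦ 1 ] [ counter 0 ↦ suc k ]) W′ o′
      iteration {k} {M} {W} {o} k<N inv c≡k with proj₁ (CodeAt-++ {P} 4 body (proj₂ (proj₂ (proj₂ at))))
      ... | f₁ , f₂ , f₃ , f₄ , f₅ , f₆ , f₇ , f₈ , _ = _ , _ , _ , _
        , step f₁ (step f₂ (step f₃ (step f₄ (step f₅ (step f₆ (step f₇ (step f₈ [])))))))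
        , subst (λ x → F x (counter 0) ≡ k × RowsUpTo (suc k) (F x [ 1 ↦ 1 ] [ counter 0 ↦ suc k ]) W o)
            (sym (locate-addr rowArray (M (counter 0))))
            ( trans (↦-array L {rowArray} {suc zero} {M (counter 0)} {0} {M 4} (λ ())) c≡k
            , record
              { size    = RowsUpTo.size inv
              ; zeros   = λ a j a≢1 a≢r → trans (↦-array (L₁ [ 1 ↦ 1 ]) {suc zero} {a} {0} {j} a≢1)
                  (trans (↦-array L {rowArray} {a} {M (counter 0)} {j} a≢r) (RowsUpTo.zeros inv a j a≢1 a≢r))
              ; rowsAt  = λ j j<k → trans (↦-array (L₁ [ 1 ↦ 1 ]) {suc zero} {rowArray} {0} {j} (λ ())) (rowsAt′ j j<k)
              ; nextRow = trans (cong₂ _+_ (RowsUpTo.nextRow inv) (RowsUpTo.size inv)) (next-row 64 N k)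
              ; weights = RowsUpTo.weights inv
              ; output  = RowsUpTo.output inv
              })
        , ℕ.≤-refl
        where
        next-row : ∀ c N k → c + N * k + N ≡ c + N * suc k
        next-row = solve-∀
        L = located rowArray (M (counter 0)) M
        F : ℕ → ℕ → ℕ
        F x = L [ x ↦ M 4 ] [ 4 ↦ (L [ x ↦ M 4 ]) 4 + (L [ x ↦ M 4 ]) 0 ]
        L₁ = F (addr rowArray (M (counter 0)))
        rowsAt′ : ∀ j → j < suc k → L₁ (addr rowArray j) ≡ 64 + N * j
        rowsAt′ j j<1+k with j ℕ.≟ k
        ... | yes refl = trans (cong (λ x → L₁ (addr rowArray x)) {k} {M (counter 0)} (sym c≡k))
                           (trans (↦-same L (addr rowArray (M (counter 0)))) (RowsUpTo.nextRow inv))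
        ... | no  j≢k  = trans (↦-index L {rowArray} {M (counter 0)} {j} (λ eq → j≢k (trans eq c≡k)))
                           (RowsUpTo.rowsAt inv j (ℕ.≤∧≢⇒< (ℕ.≤-pred j<1+k) j≢k))
      done-rows : ∀ {M W o} → RowsUpTo N M W o → Represents blank M W o
      done-rows inv = record
        { size    = RowsUpTo.size inv
        ; scalars = λ i → RowsUpTo.zeros inv zero i (λ ()) (λ ())
        ; arrays  = λ a x → RowsUpTo.zeros inv (array a) (toℕ x) (λ ()) (λ ())
        ; rowsAt  = λ u → RowsUpTo.rowsAt inv (toℕ u) (Fin.toℕ<n u)
        ; weights = λ r → trans (cong (λ W → W (toℕ r)) (RowsUpTo.weights inv)) (low r)
        ; matrix  = λ u v → trans (cong (λ W → W (64 + (N * toℕ u + toℕ v))) (RowsUpTo.weights inv)) (matrix-initial u v)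
        ; output  = RowsUpTo.output inv
        }
        where
        low : ∀ (r : Fin 8) → W₀ (toℕ r) ≡ 0#
        low zero = refl
        low (suc zero) = refl
        low (suc (suc zero)) = refl
        low (suc (suc (suc zero))) = refl
        low (suc (suc (suc (suc zero)))) = refl
        low (suc (suc (suc (suc (suc zero))))) = refl
        low (suc (suc (suc (suc (suc (suc zero)))))) = refl
        low (suc (suc (suc (suc (suc (suc (suc zero))))))) = refl

    assemble-run : ∀ c → ∃[ t ] ∃[ γ ] assemble c ⊢ initial G ⇓[ t ] γ ×
                   Config.output γ ≡ out (eval c blank) × t ≤ 1 + (N * 12 + 3) + bound c
    -- The program is generalised to a variable about which only the placed code is known, so that
    -- the assembled program is not unfolded.
    assemble-run c = finish (assemble c) (proj₁ at) (proj₂ at)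
      (trans (cong (fetch (assemble c)) (sym (advance-++ 0 rows {compile c 0 (advance 0 rows)}))) (fetch-end (assemble c)))
      where
      at = CodeAt-++ {assemble c} 0 rows (CodeAt-self (assemble c))
      finish : ∀ P → CodeAt P 0 rows → CodeAt P (advance 0 rows) (compile c 0 (advance 0 rows)) →
               fetch P (advance (advance 0 rows) (compile c 0 (advance 0 rows))) ≡ nothing →
               ∃[ t ] ∃[ γ ] P ⊢ initial G ⇓[ t ] γ ×
                 Config.output γ ≡ out (eval c blank) × t ≤ 1 + (N * 12 + 3) + bound c
      finish P at₁ at₂ end =
        let M₁ , W₁ , o₁ , t₁ , r₁ , s₁ , t₁≤ = rows-run {P} at₁
            M₂ , W₂ , o₂ , t₂ , r₂ , (s₂ , _) , t₂≤ = run {P} c 0 (advance 0 rows) at₂ s₁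
        in t₁ + t₂ , config _ M₂ W₂ o₂ , ⟶⇒⇓ (r₁ ◅◅ r₂) end , Represents.output s₂ , ℕ.+-mono-≤ t₁≤ t₂≤

-- Enumerations of the vertices, and what commands leave unchanged

everyone-complete : ∀ {n} (x : Fin n) → x ∈ everyone n
everyone-complete {n} x = subst (x ∈_) (sym (everyone-allFin n)) (∈-allFin x)

everyone-unique : ∀ n → Unique (everyone n)
everyone-unique n = subst Unique (sym (everyone-allFin n)) (allFin⁺ n)

everyone-length : ∀ n → length (everyone n) ≡ n
everyone-length n = trans (cong length (everyone-allFin n)) (List.length-tabulate id)

≔-same : ∀ {n} {B : Set} (f : Fin n → B) x {v} → (f [ x ≔ v ]) x ≡ v
≔-same f x with x ≟ᶠ x
... | yes _   = refl
... | no  x≢x = contradiction refl x≢x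

≔-other : ∀ {n} {B : Set} (f : Fin n → B) {x y v} → y ≢ x → (f [ x ≔ v ]) y ≡ f y
≔-other f {x} {y} y≢x with y ≟ᶠ x
... | yes y≡x = contradiction y≡x y≢x
... | no  _   = refl

-- Which parts of the store a command cannot change.  For a closed command
-- these types reduce to products of unit types, which Agda infers.

KeepsV : Cmd → ℕ → Set
KeepsV skip             i = Unit
KeepsV (c ⨾ c′)         i = KeepsV c i × KeepsV c′ i
KeepsV (mv j _)         i = T (not (i ℕ.≡ᵇ j))
KeepsV (lit j _)        i = T (not (i ℕ.≡ᵇ j))
KeepsV (ld j _ _)       i = T (not (i ℕ.≡ᵇ j))
KeepsV (st _ _ _)       i = Unit
KeepsV (dist _ _ _)     i = Unit
KeepsV (wdiv _ _ _)     i = Unit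
KeepsV (print _)        i = Unit
KeepsV (ifEq _ _ c c′)  i = KeepsV c i × KeepsV c′ i
KeepsV (ifLess _ _ c c′) i = KeepsV c i × KeepsV c′ i
KeepsV (for j c)        i = T (not (i ℕ.≡ᵇ j)) × KeepsV c i

KeepsA : Cmd → Fin 13 → Set
KeepsA (c ⨾ c′)         a = KeepsA c a × KeepsA c′ a
KeepsA (st b _ _)       a = T (not (does (a ≟ᶠ b)))
KeepsA (ifEq _ _ c c′)  a = KeepsA c a × KeepsA c′ a
KeepsA (ifLess _ _ c c′) a = KeepsA c a × KeepsA c′ a
KeepsA (for _ c)        a = KeepsA c a
KeepsA _                a = Unit

KeepsR : Cmd → Fin 8 → Set
KeepsR (c ⨾ c′)         r = KeepsR c r × KeepsR c′ r
KeepsR (dist s _ _)     r = T (not (does (r ≟ᶠ s)))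
KeepsR (wdiv s _ _)     r = T (not (does (r ≟ᶠ s)))
KeepsR (ifEq _ _ c c′)  r = KeepsR c r × KeepsR c′ r
KeepsR (ifLess _ _ c c′) r = KeepsR c r × KeepsR c′ r
KeepsR (for _ c)        r = KeepsR c r
KeepsR _                r = Unit

Silent : Cmd → Set
Silent (c ⨾ c′)         = Silent c × Silent c′
Silent (print _)        = ⊥
Silent (ifEq _ _ c c′)  = Silent c × Silent c′
Silent (ifLess _ _ c c′) = Silent c × Silent c′
Silent (for _ c)        = Silent c
Silent _                = Unit

-- Edge lists are stored as two arrays; an entry with p k ≡ q k stands for no
-- edge, and an edge is deleted by making its entry such.
edges : ∀ {n} → (p q : Fin n → Fin n) → List (Fin n) → List (Edge n)
edges p q []       = []
edges p q (k ∷ ks) = if does (p k ≟ᶠ q k) then edges p q ks else (p k , q k) ∷ edges p q ks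

edges-skip : ∀ {n} (p q : Fin n → Fin n) {k} ks → p k ≡ q k → edges p q (k ∷ ks) ≡ edges p q ks
edges-skip p q {k} ks eq with p k ≟ᶠ q k
... | yes _ = refl
... | no neq = contradiction eq neq

edges-cong : ∀ {n} {p q p′ q′ : Fin n → Fin n} ks → (∀ {k} → k ∈ ks → p k ≡ p′ k) →
             (∀ {k} → k ∈ ks → q k ≡ q′ k) → edges p q ks ≡ edges p′ q′ ks
edges-cong         []       p≗ q≗ = refl
edges-cong {p = p} {q} (k ∷ ks) p≗ q≗
  rewrite p≗ (here refl) | q≗ (here refl) | edges-cong {p = p} {q} ks (p≗ ∘ there) (q≗ ∘ there) = refl

edges-length : ∀ {n} (p q : Fin n → Fin n) ks → length (edges p q ks) ℕ.≤ length ks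
edges-length p q []       = ℕ.z≤n
edges-length p q (k ∷ ks) with p k ≟ᶠ q k
... | yes _ = ℕ.m≤n⇒m≤1+n (edges-length p q ks)
... | no  _ = ℕ.s≤s (edges-length p q ks)

foldl-invariant : ∀ {A S : Set} {f : S → A → S} (I : S → Set) → (∀ σ x → I σ → I (f σ x)) →
                  ∀ xs σ → I σ → I (foldl f σ xs)
foldl-invariant         I pres []       σ i = i
foldl-invariant {f = f} I pres (x ∷ xs) σ i = foldl-invariant I pres xs (f σ x) (pres σ x i)

if-both : ∀ {B C : Set} b {x y : B} {f : B → C} {z} → f x ≡ z → f y ≡ z → f (if b then x else y) ≡ z
if-both true  fx fy = fx
if-both false fx fy = fy

-- The program

-- `vF` flags a non-empty `L`, `vStop` the end of merging in a round, `vInf` an infinite cost and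
-- `vHave` a saved solution. `vZero` is never written and keeps its initial value.
vI vJ vK vX vP vQ vA vB vC vE vZero vOne vStop vInf vHave vF vRound : ℕ
vI = 0
vJ = 1
vK = 2
vX = 3
vP = 4
vQ = 5
vA = 6
vB = 7
vC = 8
vE = 9
vZero = 10
vOne = 11
vStop = 12
vInf = 13
vHave = 14
vF = 15
vRound = 16

-- `comp` labels the components of the current Kruskal run; `lp`, `lq` hold `L` and `mp`, `mq` the
-- maximum spanning tree of G; `cls` is the map `class`, `col` the current colouring, `sol` the
-- saved one.
comp lp lq mp mq cls col sol : Fin 13
comp = # 0
lp   = # 1
lq   = # 2
mp   = # 3
mq   = # 4
cls  = # 5
col  = # 6
sol  = # 7

r0 r1 rS rD rCost rZero : Fin 8
r0    = # 0
r1    = # 1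
rS    = # 2
rD    = # 3
rCost = # 4
rZero = # 5

choose : Cmd
choose = mv vP vI ⨾ mv vQ vJ

-- `r0` has the weight of the pair held and `r1` that of the new pair; exchanging the two in the
-- comparison turns a search for the lightest pair into one for the heaviest.
challenger incumbent : Dir → Fin 8
challenger up   = r1
challenger down = r0
incumbent  up   = r0
incumbent  down = r1

scanStep : Dir → Fin 13 → Cmd
scanStep D a = ld vA a vI ⨾ ld vB a vJ ⨾ ifEq vA vB skip
  (ifEq vP vQ choose (dist r0 vP vQ ⨾ dist r1 vI vJ ⨾ ifLess (challenger D) (incumbent D) choose skip))

-- Equal entries in P and Q mean that no pair has been found; a real candidate has different labels,
-- hence different ends. With the colouring as labels the same scan finds the split.
scan : Dir → Fin 13 → Cmd
scan D a = lit vP zero ⨾ lit vQ zero ⨾ for vI (for vJ (scanStep D a))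

uniteStep : Fin 13 → Cmd
uniteStep a = ld vC a vX ⨾ ifEq vC vB (st a vX vA) skip

-- Both labels are read before the loop, so relabelling in place does not disturb the comparisons.
uniteCmd : Fin 13 → Cmd
uniteCmd a = ld vA a vP ⨾ ld vB a vQ ⨾ for vX (uniteStep a)

identity : Fin 13 → Cmd
identity a = for vX (st a vX vX)

copy : Fin 13 → Fin 13 → Cmd
copy a b = for vX (ld vC a vX ⨾ st b vX vC)

-- Once a single component is left the scan returns P = Q, which is stored as a blank entry; uniting
-- a vertex with itself then changes no label.
kruskalStep : Dir → Cmd
kruskalStep D = scan D comp ⨾ st lp vK vP ⨾ st lq vK vQ ⨾ uniteCmd comp

kruskal : Dir → Cmd
kruskal D = identity comp ⨾ for vK (kruskalStep D)

printEdges : Cmd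
printEdges = for vK (ld vP lp vK ⨾ ld vQ lq vK ⨾ ifEq vP vQ skip (print vP ⨾ print vQ))

printArray : Fin 13 → Cmd
printArray a = for vX (ld vC a vX ⨾ print vC)

flip : Cmd
flip = for vX (ld vC comp vX ⨾ ifEq vC vB (ld vC col vX ⨾ ifEq vC vZero (st col vX vOne) (st col vX vZero)) skip)

-- The colouring grows with the forest. If the ends of a new edge agree in colour, exchanging the
-- colours on the component of Q repairs this edge and spoils no earlier one, at linear cost.
attach : Cmd
attach = print vP ⨾ print vQ ⨾ ld vC col vP ⨾ ld vE col vQ ⨾ ifEq vC vE flip skip ⨾ uniteCmd comp

treeStep : Cmd
treeStep = ld vP mp vK ⨾ ld vQ mq vK ⨾ ld vP cls vP ⨾ ld vQ cls vQ ⨾ ld vA comp vP ⨾ ld vB comp vQ ⨾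
  ifEq vA vB skip attach

-- `comp` starts as `cls`, so the members of a supervertex are always recoloured together, and `col`
-- ends as the induced partition of V.
tree : Cmd
tree = copy cls comp ⨾ for vX (st col vX vZero) ⨾ for vK treeStep

diameterStep : Cmd
diameterStep = ld vA col vI ⨾ ld vB col vJ ⨾
  ifEq vA vB (dist r0 vP vQ ⨾ dist r1 vI vJ ⨾ ifLess r0 r1 choose skip) skip

-- The initial pair (0,0) is a legitimate candidate of weight 0, so there is no empty case as in
-- `scan`.
diameter : Cmd
diameter = lit vP zero ⨾ lit vQ zero ⨾ for vI (for vJ diameterStep)

save : Cmd
save = lit vHave (suc zero) ⨾ copy col sol

-- Once the cost is infinite nothing exceeds it. The quotient is computed twice, since registers
-- cannot be copied.
improveCmd : Cmd
improveCmd = ifEq vInf vZero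
  (ifLess rZero rD (wdiv r0 rS rD ⨾ ifLess rCost r0 (wdiv rCost rS rD ⨾ save) skip)
                   (lit vInf (suc zero) ⨾ save))
  skip

-- `vStop` imitates the exit from the inner while loop at the first edge heavier than the split. A
-- merged edge is deleted by overwriting its first end with its second.
mergeStep : Cmd
mergeStep = ld vP lp vK ⨾ ld vQ lq vK ⨾ ifEq vP vQ skip (ifEq vStop vZero
  (dist r0 vP vQ ⨾ ifLess rS r0 (lit vStop (suc zero)) (uniteCmd cls ⨾ st lp vK vQ)) skip)

mergeCmd : Cmd
mergeCmd = lit vStop zero ⨾ for vK mergeStep

roundCmd : Cmd
roundCmd = tree ⨾ printArray col ⨾ scan up col ⨾ dist rS vP vQ ⨾ diameter ⨾ dist rD vP vQ ⨾
  improveCmd ⨾ mergeCmd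

pending : Cmd
pending = lit vF zero ⨾ for vK (ld vP lp vK ⨾ ld vQ lq vK ⨾ ifEq vP vQ skip (lit vF (suc zero)))

-- The loop around it always runs n times; iterations that find `L` empty are idle.
roundStep : Cmd
roundStep = pending ⨾ ifEq vF vZero skip roundCmd

main : Cmd
main = lit vOne (suc zero) ⨾ kruskal down ⨾ copy lp mp ⨾ copy lq mq ⨾ kruskal up ⨾ printEdges ⨾
  identity cls ⨾ for vRound roundStep ⨾ ifEq vHave vZero skip (printArray sol)

-- Correctness of the program

module _ {K : OrderedField} {m : ℕ} (G : WeightedCompleteGraph K (2 ℕ.+ m)) where
  open OrderedField K using (Carrier; 0#; _/_; _<_; _<?_; _≤_; _≤?_; _≟_; isStrictTotalOrder)
  open IsStrictTotalOrder isStrictTotalOrder using (irrefl) renaming (trans to <-trans)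
  open WeightedCompleteGraph G
  open Interpreter G
  open Store
  open _⊑_

  private
    infix 4 _⊴[_]_
    _⊴[_]_ : Carrier → Dir → Carrier → Set
    _⊴[_]_ = _≤[_]_ {K}
    N = 2 ℕ.+ m

  private
    differs-ℕ : ∀ {i j} → T (not (i ℕ.≡ᵇ j)) → i ≢ j
    differs-ℕ {i} {j} t eq rewrite dec-true (i ℕ.≟ j) eq = t

    differs-Fin : ∀ {k} {i j : Fin k} → T (not (does (i ≟ᶠ j))) → i ≢ j
    differs-Fin {i = i} {j} t eq rewrite dec-true (i ≟ᶠ j) eq = t

  keepsV : ∀ c i {k : KeepsV c i} (σ : Store) → V (eval c σ) i ≡ V σ i
  keepsV skip             i           σ = refl
  keepsV (c ⨾ c′)         i {k , k′} σ = trans (keepsV c′ i {k′} (eval c σ)) (keepsV c i {k} σ)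
  keepsV (mv j _)         i {k}       σ = ↦-other (V σ) (differs-ℕ {i} {j} k)
  keepsV (lit j _)        i {k}       σ = ↦-other (V σ) (differs-ℕ {i} {j} k)
  keepsV (ld j _ _)       i {k}       σ = ↦-other (V σ) (differs-ℕ {i} {j} k)
  keepsV (st _ _ _)       i           σ = refl
  keepsV (dist _ _ _)     i           σ = refl
  keepsV (wdiv _ _ _)     i           σ = refl
  keepsV (print _)        i           σ = refl
  keepsV (ifEq j l c c′)  i {k , k′} σ =
    if-both (does (V σ j ≟ᶠ V σ l)) {f = λ σ → V σ i} (keepsV c i {k} σ) (keepsV c′ i {k′} σ)
  keepsV (ifLess r s c c′) i {k , k′} σ =
    if-both (does (R σ r <? R σ s)) {f = λ σ → V σ i} (keepsV c i {k} σ) (keepsV c′ i {k′} σ)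
  keepsV (for j c)        i {k , k′} σ =
    foldl-invariant (λ σ′ → V σ′ i ≡ V σ i)
      (λ σ′ x eq → trans (keepsV c i {k′} _) (trans (↦-other (V σ′) (differs-ℕ {i} {j} k)) eq)) (everyone N) σ refl

  keepsA : ∀ c a {k : KeepsA c a} (σ : Store) → A (eval c σ) a ≡ A σ a
  keepsA skip             a           σ = refl
  keepsA (c ⨾ c′)         a {k , k′} σ = trans (keepsA c′ a {k′} (eval c σ)) (keepsA c a {k} σ)
  keepsA (mv _ _)         a           σ = refl
  keepsA (lit _ _)        a           σ = refl
  keepsA (ld _ _ _)       a           σ = refl
  keepsA (st b _ _)       a {k}       σ = ≔-other (A σ) (differs-Fin {i = a} {b} k)
  keepsA (dist _ _ _)     a           σ = refl
  keepsA (wdiv _ _ _)     a           σ = refl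
  keepsA (print _)        a           σ = refl
  keepsA (ifEq j l c c′)  a {k , k′} σ =
    if-both (does (V σ j ≟ᶠ V σ l)) {f = λ σ → A σ a} (keepsA c a {k} σ) (keepsA c′ a {k′} σ)
  keepsA (ifLess r s c c′) a {k , k′} σ =
    if-both (does (R σ r <? R σ s)) {f = λ σ → A σ a} (keepsA c a {k} σ) (keepsA c′ a {k′} σ)
  keepsA (for j c)        a {k}       σ =
    foldl-invariant (λ σ′ → A σ′ a ≡ A σ a) (λ σ′ x eq → trans (keepsA c a {k} _) eq) (everyone N) σ refl

  keepsR : ∀ c r {k : KeepsR c r} (σ : Store) → R (eval c σ) r ≡ R σ r
  keepsR skip             r           σ = refl
  keepsR (c ⨾ c′)         r {k , k′} σ = trans (keepsR c′ r {k′} (eval c σ)) (keepsR c r {k} σ)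
  keepsR (mv _ _)         r           σ = refl
  keepsR (lit _ _)        r           σ = refl
  keepsR (ld _ _ _)       r           σ = refl
  keepsR (st _ _ _)       r           σ = refl
  keepsR (dist s _ _)     r {k}       σ = ≔-other (R σ) (differs-Fin {i = r} {s} k)
  keepsR (wdiv s _ _)     r {k}       σ = ≔-other (R σ) (differs-Fin {i = r} {s} k)
  keepsR (print _)        r           σ = refl
  keepsR (ifEq j l c c′)  r {k , k′} σ =
    if-both (does (V σ j ≟ᶠ V σ l)) {f = λ σ → R σ r} (keepsR c r {k} σ) (keepsR c′ r {k′} σ)
  keepsR (ifLess p q c c′) r {k , k′} σ =
    if-both (does (R σ p <? R σ q)) {f = λ σ → R σ r} (keepsR c r {k} σ) (keepsR c′ r {k′} σ)
  keepsR (for j c)        r {k}       σ =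
    foldl-invariant (λ σ′ → R σ′ r ≡ R σ r) (λ σ′ x eq → trans (keepsR c r {k} _) eq) (everyone N) σ refl

  silent : ∀ c {k : Silent c} (σ : Store) → out (eval c σ) ≡ out σ
  silent skip             σ = refl
  silent (c ⨾ c′) {k , k′} σ = trans (silent c′ {k′} (eval c σ)) (silent c {k} σ)
  silent (mv _ _)         σ = refl
  silent (lit _ _)        σ = refl
  silent (ld _ _ _)       σ = refl
  silent (st _ _ _)       σ = refl
  silent (dist _ _ _)     σ = refl
  silent (wdiv _ _ _)     σ = refl
  silent (ifEq j l c c′) {k , k′} σ =
    if-both (does (V σ j ≟ᶠ V σ l)) {f = out} (silent c {k} σ) (silent c′ {k′} σ)
  silent (ifLess p q c c′) {k , k′} σ =
    if-both (does (R σ p <? R σ q)) {f = out} (silent c {k} σ) (silent c′ {k′} σ)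
  silent (for j c) {k} σ =
    foldl-invariant (λ σ′ → out σ′ ≡ out σ) (λ σ′ x eq → trans (silent c {k} _) eq) (everyone N) σ refl

  -- Rules for loops over the vertices

  iteration : ℕ → Cmd → Store → Fin N → Store
  iteration i c σ x = eval c (setV i x σ)

  outside : ∀ {F : Store → Fin N → Store} a → (∀ σ x y → y ≢ x → A (F σ x) a y ≡ A σ a y) →
            ∀ xs σ {y} → y ∉ xs → A (foldl F σ xs) a y ≡ A σ a y
  outside     a local []       σ y∉ = refl
  outside {F} a local (x ∷ xs) σ y∉ =
    trans (outside a local xs (F σ x) (y∉ ∘ there)) (local σ x _ (y∉ ∘ here))

  -- For loops whose iteration at x writes entry x only: that entry still has its original value
  -- when x is reached and is not touched afterwards. `Q` carries what the iterations read
  -- elsewhere.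
  pointwise : ∀ {F : Store → Fin N → Store} a (f : Fin N → Fin N) (Q : Store → Set) →
              (∀ σ x → Q σ → Q (F σ x)) →
              (∀ σ x y → y ≢ x → A (F σ x) a y ≡ A σ a y) →
              ∀ σ → (∀ σ′ x → Q σ′ → A σ′ a x ≡ A σ a x → A (F σ′ x) a x ≡ f x) →
              Q σ → ∀ y → A (foldl F σ (everyone N)) a y ≡ f y
  pointwise {F} a f Q pres local σ₀ sets q y =
    go (everyone N) (everyone-unique N) σ₀ q (λ _ → refl) (everyone-complete y)
    where
    go : ∀ xs → Unique xs → ∀ σ → Q σ → (∀ {y} → y ∈ xs → A σ a y ≡ A σ₀ a y) →
         ∀ {y} → y ∈ xs → A (foldl F σ xs) a y ≡ f y
    go (x ∷ xs) (x∉ ∷ u) σ q old (here refl) =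
      trans (outside a local xs (F σ x) (λ x∈ → All.lookup x∉ x∈ refl)) (sets σ x q (old (here refl)))
    go (x ∷ xs) (x∉ ∷ u) σ q old (there y∈) =
      go xs u (F σ x) (pres σ x q)
        (λ {z} z∈ → trans (local σ x z (λ { refl → All.lookup x∉ z∈ refl })) (old (there z∈))) y∈

  -- The invariant is indexed by the list of pairs visited so far. Only the fact that every pair is
  -- eventually listed is exported, so order and repetition do not matter.
  pairs : ∀ {i j c} (I : List (Edge N) → Store → Set) →
          (∀ pre σ x → I pre σ → I pre (setV i x σ)) →
          (∀ pre σ x → I pre σ → I pre (setV j x σ)) →
          (∀ pre σ → I pre σ → I ((V σ i , V σ j) ∷ pre) (eval c σ)) →
          {_ : KeepsV c i} {_ : T (not (i ℕ.≡ᵇ j))} →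
          ∀ σ → I [] σ → ∃[ pre ] (∀ x y → (x , y) ∈ pre) × I pre (eval (for i (for j c)) σ)
  pairs {i} {j} {c} I resp-i resp-j pres {k} {i≢j} σ₀ inv =
    let pre , _ , all , inv′ = outer (everyone N) _ σ₀ inv
    in pre , (λ x y → all x y (everyone-complete x)) , inv′
    where
    inner : ∀ ys pre σ {x} → V σ i ≡ x → I pre σ →
            ∃[ pre′ ] (∀ e → e ∈ pre → e ∈ pre′) × (∀ y → y ∈ ys → (x , y) ∈ pre′) ×
              I pre′ (foldl (iteration j c) σ ys)
    inner []       _ _ eq inv = _ , (λ _ → id) , (λ _ ()) , inv
    inner (y ∷ ys) pre σ {x} eq inv =
      let eq₁ = trans (↦-other (V σ) (differs-ℕ {i} {j} i≢j)) eq
          inv₁ = pres pre (setV j y σ) (resp-j pre σ y inv)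
          pre′ , grow , all , inv′ = inner ys _ (iteration j c σ y) (trans (keepsV c i {k} (setV j y σ)) eq₁) inv₁
      in pre′ , (λ e → grow e ∘ there)
         , (λ { _ (here refl) → subst (_∈ pre′) (cong₂ _,_ eq₁ (↦-same (V σ) j)) (grow _ (here refl))
              ; z (there z∈)  → all z z∈ })
         , inv′
    outer : ∀ xs pre σ → I pre σ →
            ∃[ pre′ ] (∀ e → e ∈ pre → e ∈ pre′) × (∀ x y → x ∈ xs → (x , y) ∈ pre′) ×
              I pre′ (foldl (iteration i (for j c)) σ xs)
    outer []       _ _ inv = _ , (λ _ → id) , (λ _ _ ()) , inv
    outer (x ∷ xs) pre σ inv =
      let pre₁ , grow₁ , all₁ , inv₁ = inner (everyone N) pre (setV i x σ) (↦-same (V σ) i) (resp-i pre σ x inv)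
          pre₂ , grow₂ , all₂ , inv₂ = outer xs _ (iteration i (for j c) σ x) inv₁
      in pre₂ , (λ e → grow₂ e ∘ grow₁ e)
         , (λ { _ y (here refl) → grow₂ _ (all₁ y (everyone-complete y)) ; z y (there z∈) → all₂ z y z∈ })
         , inv₂

  -- The search for a best pair, and Kruskal's algorithm

  Best : Dir → (Fin N → Fin N) → (Edge N → Set) → Fin N → Fin N → Set
  Best D α S p q = (p ≡ q × (∀ {x y} → S (x , y) → α x ≡ α y)) ⊎
    (α p ≢ α q × (∀ {x y} → S (x , y) → α x ≢ α y → d p q ⊴[ D ] d x y))

  scanStep-spec : ∀ D a {α} pre (σ : Store) → A σ a ≡ α × Best D α (_∈ pre) (V σ vP) (V σ vQ) →
                  let σ′ = eval (scanStep D a) σ in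
                  A σ′ a ≡ α × Best D α (_∈ ((V σ vI , V σ vJ) ∷ pre)) (V σ′ vP) (V σ′ vQ)
  scanStep-spec D a pre σ (refl , best) with A σ a (V σ vI) ≟ᶠ A σ a (V σ vJ)
  ... | yes i~j = refl , extend best
    where
    extend : Best D _ _ _ _ → Best D _ _ _ _
    extend (inj₁ (eq , all))  = inj₁ (eq , λ { (here refl) → i~j ; (there e) → all e })
    extend (inj₂ (neq , all)) = inj₂ (neq , λ { (here refl) i≁j → contradiction i~j i≁j ; (there e) → all e })
  ... | no i≁j with V σ vP ≟ᶠ V σ vQ | best
  ...   | yes p≡q | inj₁ (_ , all) = refl , inj₂ (i≁j ,
            λ { (here refl) _ → ≤[]-refl {K} D ; (there e) x≁y → contradiction (all e) x≁y })
  ...   | yes p≡q | inj₂ (p≁q , _) = contradiction (cong (A σ a) p≡q) p≁q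
  ...   | no  p≢q | inj₁ (p≡q , _) = contradiction p≡q p≢q
  ...   | no  p≢q | inj₂ (p≁q , all) = compete D all
    where
    compete : ∀ D → (∀ {x y} → (x , y) ∈ _ → A σ a x ≢ A σ a y → d (V σ vP) (V σ vQ) ⊴[ D ] d x y) →
      let σ′ = eval (dist r0 vP vQ ⨾ dist r1 vI vJ ⨾ ifLess (challenger D) (incumbent D) choose skip)
                 (eval (ld vA a vI ⨾ ld vB a vJ) σ) in
      A σ′ a ≡ A σ a × Best D (A σ a) _ (V σ′ vP) (V σ′ vQ)
    compete up all with d (V σ vI) (V σ vJ) <? d (V σ vP) (V σ vQ)
    ... | yes lt = refl , inj₂ (i≁j , λ { (here refl) _ → ≤[]-refl {K} up
                                        ; (there e) x≁y → ≤[]-trans {K} up (inj₁ lt) (all e x≁y) })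
    ... | no  ≮ = refl , inj₂ (p≁q , λ { (here refl) _ → ≮⇒≥ {K} ≮ ; (there e) → all e })
    compete down all with d (V σ vP) (V σ vQ) <? d (V σ vI) (V σ vJ)
    ... | yes lt = refl , inj₂ (i≁j , λ { (here refl) _ → ≤[]-refl {K} down
                                        ; (there e) x≁y → ≤[]-trans {K} down (inj₁ lt) (all e x≁y) })
    ... | no  ≮ = refl , inj₂ (p≁q , λ { (here refl) _ → ≮⇒≥ {K} ≮ ; (there e) → all e })

  scan-spec : ∀ D a (σ : Store) → let σ′ = eval (scan D a) σ ; P = V σ′ vP ; Q = V σ′ vQ in
              (P ≡ Q × Trivial (A σ a)) ⊎
              (A σ a P ≢ A σ a Q × (∀ {x y} → A σ a x ≢ A σ a y → d P Q ⊴[ D ] d x y))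
  scan-spec D a σ with pairs {i = vI} {vJ} {scanStep D a} (λ pre σ′ → A σ′ a ≡ A σ a × Best D (A σ a) (_∈ pre) (V σ′ vP) (V σ′ vQ))
      (λ _ _ _ → id) (λ _ _ _ → id) (scanStep-spec D a) (eval (lit vP zero ⨾ lit vQ zero) σ)
      (refl , inj₁ (refl , λ ()))
  ... | _ , all , _ , inj₁ (p≡q , same) = inj₁ (p≡q , λ x y → same (all x y))
  ... | _ , all , _ , inj₂ (p≁q , best) = inj₂ (p≁q , best (all _ _))

  setA-row : ∀ (σ : Store) a x v → A (setA a x v σ) a ≡ A σ a [ x ≔ v ]
  setA-row σ a x v = ≔-same (A σ) a

  setA-here : ∀ (σ : Store) a x v → A (setA a x v σ) a x ≡ v
  setA-here σ a x v = trans (cong-app (setA-row σ a x v) x) (≔-same (A σ a) x)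

  setA-elsewhere : ∀ (σ : Store) a {x v} y → y ≢ x → A (setA a x v σ) a y ≡ A σ a y
  setA-elsewhere σ a {x} {v} y y≢x = trans (cong-app (setA-row σ a x v) y) (≔-other (A σ a) y≢x)

  identity-spec : ∀ a (σ : Store) y → A (eval (identity a) σ) a y ≡ y
  identity-spec a σ = pointwise {F = iteration vX (st a vX vX)} a id (λ _ → Unit) (λ _ _ _ → tt)
    (λ σ x y y≢x → setA-elsewhere (setV vX x σ) a y y≢x) σ
    (λ σ x _ _ → setA-here (setV vX x σ) a x x) tt

  copy-spec : ∀ a b → b ≢ a → ∀ (σ : Store) y → A (eval (copy a b) σ) b y ≡ A σ a y
  copy-spec a b b≢a σ = pointwise {F = iteration vX (ld vC a vX ⨾ st b vX vC)} b (A σ a) (λ σ′ → A σ′ a ≡ A σ a)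
    (λ σ x eq → trans (≔-other (A σ) (b≢a ∘ sym)) eq)
    (λ σ x y y≢x → setA-elsewhere (eval (ld vC a vX) (setV vX x σ)) b y y≢x) σ
    (λ σ′ x eq _ → trans (setA-here (eval (ld vC a vX) (setV vX x σ′)) b x (A σ′ a x)) (cong-app eq x)) refl

  unite-spec : ∀ a (σ : Store) y → A (eval (uniteCmd a) σ) a y ≡ unite (A σ a) (V σ vP) (V σ vQ) y
  unite-spec a σ = pointwise {F = iteration vX (uniteStep a)} a (unite (A σ a) (V σ vP) (V σ vQ))
    (λ σ′ → V σ′ vA ≡ A σ a (V σ vP) × V σ′ vB ≡ A σ a (V σ vQ))
    (λ σ′ x (eqA , eqB) → trans (keepsV (uniteStep a) vA (setV vX x σ′)) eqA
                         , trans (keepsV (uniteStep a) vB (setV vX x σ′)) eqB)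
    local (eval (ld vA a vP ⨾ ld vB a vQ) σ) sets (refl , refl)
    where
    local : ∀ (σ : Store) x y → y ≢ x → A (iteration vX (uniteStep a) σ x) a y ≡ A σ a y
    local σ x y y≢x with A σ a x ≟ᶠ V σ vB
    ... | yes _ = setA-elsewhere (eval (ld vC a vX) (setV vX x σ)) a y y≢x
    ... | no  _ = refl
    sets : ∀ σ′ x → V σ′ vA ≡ A σ a (V σ vP) × V σ′ vB ≡ A σ a (V σ vQ) → A σ′ a x ≡ A σ a x →
           A (iteration vX (uniteStep a) σ′ x) a x ≡ unite (A σ a) (V σ vP) (V σ vQ) x
    sets σ′ x (eqA , eqB) old rewrite sym eqA | sym eqB | sym old with A σ′ a x ≟ᶠ V σ′ vB
    ... | yes _ = setA-here (eval (ld vC a vX) (setV vX x σ′)) a x (V σ′ vA)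
    ... | no  _ = refl

  kruskal-step : ∀ D (σ : Store) k → let σ′ = iteration vK (kruskalStep D) σ k in
    ∃[ p ] ∃[ q ] A σ′ lp ≡ A σ lp [ k ≔ p ] × A σ′ lq ≡ A σ lq [ k ≔ q ] ×
      (∀ x → A σ′ comp x ≡ unite (A σ comp) p q x) ×
      ((p ≡ q × Trivial (A σ comp)) ⊎
       (A σ comp p ≢ A σ comp q × (∀ {x y} → A σ comp x ≢ A σ comp y → d p q ⊴[ D ] d x y)))
  kruskal-step D σ k = V σ₁ vP , V σ₁ vQ
    , trans (keepsA (uniteCmd comp) lp σ₂) (cong₂ (λ f x → f [ x ≔ V σ₁ vP ]) (keepsA (scan D comp) lp σ₀) (keepsV (scan D comp) vK σ₀))
    , trans (keepsA (uniteCmd comp) lq σ₂) (cong₂ (λ f x → f [ x ≔ V σ₁ vQ ]) (keepsA (scan D comp) lq σ₀) (keepsV (scan D comp) vK σ₀))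
    , (λ x → trans (unite-spec comp σ₂ x) (cong (λ α → unite α (V σ₁ vP) (V σ₁ vQ) x) (keepsA (scan D comp) comp σ₀)))
    , scan-spec D comp σ₀
    where
    σ₀ = setV vK k σ
    σ₁ = eval (scan D comp) σ₀
    σ₂ = eval (st lp vK vP ⨾ st lq vK vQ) σ₁

  -- Entry k is written in step k and never again, so the edge chosen there can be read from the
  -- final arrays; induction over the steps then builds the sequence directly.
  kruskal-spec : ∀ D (σ : Store) → let σ′ = eval (kruskal D) σ in
                 Greedy D (unmerged G) id (edges (A σ′ lp) (A σ′ lq) (everyone N))
  kruskal-spec D σ = Greedy-resp (⊑-cong start-id) (⊑-cong (λ x → sym (start-id x)))
    (go (everyone N) (everyone-unique N) (eval (identity comp) σ)
      -- There are n labels for n steps: the edges use up n - 1 steps, and the last one finds that a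
      -- single component is left.
      (inj₂ (⊤ , (λ _ → ∈⊤) , ℕ.≤-reflexive (trans (∣⊤∣≡n N) (sym (everyone-length N))))))
    where
    start-id : ∀ x → A (eval (identity comp) σ) comp x ≡ x
    start-id = identity-spec comp σ
    F : Store → Fin N → Store
    F = iteration vK (kruskalStep D)
    local : ∀ a → (∀ σ k → ∃[ v ] A (F σ k) a ≡ A σ a [ k ≔ v ]) →
            ∀ σ k y → y ≢ k → A (F σ k) a y ≡ A σ a y
    local a upd σ k y y≢k = trans (cong-app (proj₂ (upd σ k)) y) (≔-other (A σ a) y≢k)
    entry : ∀ a → (upd : ∀ σ k → ∃[ v ] A (F σ k) a ≡ A σ a [ k ≔ v ]) →
            ∀ xs σ k → k ∉ xs → A (foldl F (F σ k) xs) a k ≡ proj₁ (upd σ k)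
    entry a upd xs σ k k∉ = trans (outside {F = F} a (local a upd) xs (F σ k) k∉)
      (trans (cong-app (proj₂ (upd σ k)) k) (≔-same (A σ a) k))
    lp-upd : ∀ σ k → ∃[ v ] A (F σ k) lp ≡ A σ lp [ k ≔ v ]
    lp-upd σ k = let p , _ , eq , _ = kruskal-step D σ k in p , eq
    lq-upd : ∀ σ k → ∃[ v ] A (F σ k) lq ≡ A σ lq [ k ≔ v ]
    lq-upd σ k = let _ , q , _ , eq , _ = kruskal-step D σ k in q , eq
    -- The labels in use lie in a set that shrinks with every edge found.
    go : ∀ xs → Unique xs → ∀ σ →
         Trivial (A σ comp) ⊎ (∃[ S ] (∀ x → A σ comp x ∈ˢ S) × ∣ S ∣ ℕ.≤ length xs) →
         let σ′ = foldl F σ xs in Greedy D (unmerged G) (A σ comp) (edges (A σ′ lp) (A σ′ lq) xs)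
    go [] _ σ (inj₁ triv) = done triv
    go [] _ σ (inj₂ (S , ∈S , ∣S∣≤0)) =
      contradiction (ℕ.<-≤-trans (ℕ.≤-<-trans ℕ.z≤n (x∈p⇒∣p-x∣<∣p∣ (∈S zero))) ∣S∣≤0) (λ ())
    go (k ∷ xs) (k∉ ∷ u) σ few = cases outcome (A σ′ lp k ≟ᶠ A σ′ lq k)
      where
      σ′ = foldl F (F σ k) xs
      ρ = A σ comp
      k∉xs : k ∉ xs
      k∉xs k∈ = All.lookup k∉ k∈ refl
      chosen = kruskal-step D σ k
      p q : Fin N
      p = proj₁ chosen
      q = proj₁ (proj₂ chosen)
      united = proj₁ (proj₂ (proj₂ (proj₂ (proj₂ chosen))))
      outcome = proj₂ (proj₂ (proj₂ (proj₂ (proj₂ chosen))))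
      eq-p : A σ′ lp k ≡ p
      eq-p = entry lp lp-upd xs σ k k∉xs
      eq-q : A σ′ lq k ≡ q
      eq-q = entry lq lq-upd xs σ k k∉xs
      rest = edges (A σ′ lp) (A σ′ lq) xs
      fewer : ρ p ≢ ρ q → Trivial ρ ⊎ (∃[ S ] (∀ x → ρ x ∈ˢ S) × ∣ S ∣ ℕ.≤ suc (length xs)) →
              Trivial (A (F σ k) comp) ⊎
              (∃[ S ] (∀ x → A (F σ k) comp x ∈ˢ S) × ∣ S ∣ ℕ.≤ length xs)
      fewer p≁q (inj₁ triv)              = contradiction (triv p q) p≁q
      fewer p≁q (inj₂ (S , ∈S , ∣S∣≤)) = inj₂ (S Subset.- ρ q
              , (λ x → subst (_∈ˢ S Subset.- ρ q) (sym (united x)) (rename-∈ (∈S p) p≁q (∈S x)))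
              , ℕ.≤-pred (ℕ.≤-trans (x∈p⇒∣p-x∣<∣p∣ (∈S q)) ∣S∣≤))
      cases : (p ≡ q × Trivial ρ) ⊎ (ρ p ≢ ρ q × (∀ {x y} → ρ x ≢ ρ y → d p q ⊴[ D ] d x y)) →
              (dec : Dec (A σ′ lp k ≡ A σ′ lq k)) →
              Greedy D (unmerged G) ρ (if does dec then rest else (A σ′ lp k , A σ′ lq k) ∷ rest)
      cases (inj₁ (p≡q , triv)) (no neq) = contradiction (trans eq-p (trans p≡q (sym eq-q))) neq
      cases (inj₁ (p≡q , triv)) (yes _) =
        -- Both labellings are trivial, hence have the same kernel, and the rest of the run adds no
        -- edge.
        Greedy-resp (coarser λ _ → triv _ _) (coarser λ _ → triv′ _ _) (go xs u (F σ k) (inj₁ triv′))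
        where
        triv′ : Trivial (A (F σ k) comp)
        triv′ x y = trans (united x) (trans (⊑-apply (unite-coarsens ρ p q) (triv x y)) (sym (united y)))
      cases (inj₂ (p≁q , _)) (yes eq) = contradiction (cong ρ (trans (sym eq-p) (trans eq eq-q))) p≁q
      cases (inj₂ (p≁q , best)) (no _) =
        subst₂ (λ p q → Greedy D (unmerged G) ρ ((p , q) ∷ rest)) (sym eq-p) (sym eq-q)
          (step ∈⊤ ∈⊤ p≁q (λ _ _ → best)
            (Greedy-resp (⊑-cong united) (⊑-cong (λ x → sym (united x))) (go xs u (F σ k) (fewer p≁q few))))

  printEdges-spec : ∀ (σ : Store) → out (eval printEdges σ) ≡ out σ ++ writeEdges (edges (A σ lp) (A σ lq) (everyone N))
  printEdges-spec σ = go (everyone N) σ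
    where
    F : Store → Fin N → Store
    F = iteration vK (ld vP lp vK ⨾ ld vQ lq vK ⨾ ifEq vP vQ skip (print vP ⨾ print vQ))
    go : ∀ xs (σ : Store) → out (foldl F σ xs) ≡ out σ ++ writeEdges (edges (A σ lp) (A σ lq) xs)
    go []       σ = sym (List.++-identityʳ (out σ))
    go (k ∷ xs) σ with A σ lp k ≟ᶠ A σ lq k
    ... | yes _ = go xs _
    ... | no  _ = trans (go xs _) (trans
                    (List.++-assoc (out σ ∷ʳ toℕ (A σ lp k)) _ _) (List.++-assoc (out σ) _ _))

  printArray-spec : ∀ a (σ : Store) → out (eval (printArray a) σ) ≡ out σ ++ map (toℕ ∘ A σ a) (everyone N)
  printArray-spec a σ = go (everyone N) σ
    where
    go : ∀ xs (σ : Store) → out (foldl (iteration vX (ld vC a vX ⨾ print vC)) σ xs) ≡ out σ ++ map (toℕ ∘ A σ a) xs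
    go []       σ = sym (List.++-identityʳ (out σ))
    go (x ∷ xs) σ = trans (go xs _) (List.++-assoc (out σ) _ _)

  -- Two-colouring a growing forest

  Bit : Fin N → Set
  Bit c = c ≡ zero ⊎ c ≡ suc zero

  toggle : Fin N → Fin N
  toggle c = if does (c ≟ᶠ zero) then suc zero else zero

  toggle-bit : ∀ c → Bit (toggle c)
  toggle-bit c with c ≟ᶠ zero
  ... | yes _ = inj₂ refl
  ... | no  _ = inj₁ refl

  toggle-changes : ∀ {c} → Bit c → toggle c ≢ c
  toggle-changes (inj₁ refl) ()
  toggle-changes (inj₂ refl) ()

  toggle-injective : ∀ {c c′} → Bit c → Bit c′ → toggle c ≡ toggle c′ → c ≡ c′
  toggle-injective (inj₁ refl) (inj₁ refl) _ = refl
  toggle-injective (inj₂ refl) (inj₂ refl) _ = refl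
  toggle-injective (inj₁ refl) (inj₂ refl) ()
  toggle-injective (inj₂ refl) (inj₁ refl) ()

  flipped : (λ′ c : Fin N → Fin N) → Fin N → Fin N → Fin N
  flipped λ′ c b x = if does (λ′ x ≟ᶠ b) then toggle (c x) else c x

  Constants : Store → Set
  Constants σ = V σ vZero ≡ zero × V σ vOne ≡ suc zero × R σ rZero ≡ 0#

  flip-spec : ∀ (σ : Store) → Constants σ → ∀ y →
              A (eval flip σ) col y ≡ flipped (A σ comp) (A σ col) (V σ vB) y
  flip-spec σ (z , o , _) = pointwise {F = F} col (flipped (A σ comp) (A σ col) (V σ vB))
    (λ σ′ → A σ′ comp ≡ A σ comp × V σ′ vB ≡ V σ vB × V σ′ vZero ≡ zero × V σ′ vOne ≡ suc zero)
    (λ σ x (eq , eqB , z , o) → trans (keepsA c comp (setV vX x σ)) eq , trans (keepsV c vB (setV vX x σ)) eqB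
       , trans (keepsV c vZero (setV vX x σ)) z , trans (keepsV c vOne (setV vX x σ)) o)
    local σ sets (refl , refl , z , o)
    where
    c : Cmd
    c = ld vC comp vX ⨾ ifEq vC vB (ld vC col vX ⨾ ifEq vC vZero (st col vX vOne) (st col vX vZero)) skip
    F : Store → Fin N → Store
    F = iteration vX c
    local : ∀ (σ : Store) x y → y ≢ x → A (F σ x) col y ≡ A σ col y
    local σ x y y≢x with A σ comp x ≟ᶠ V σ vB
    ... | no  _ = refl
    ... | yes _ with A σ col x ≟ᶠ V σ vZero
    ...   | yes _ = ≔-other (A σ col) y≢x
    ...   | no  _ = ≔-other (A σ col) y≢x
    sets : ∀ (σ′ : Store) x → A σ′ comp ≡ A σ comp × V σ′ vB ≡ V σ vB × V σ′ vZero ≡ zero × V σ′ vOne ≡ suc zero →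
           A σ′ col x ≡ A σ col x → A (F σ′ x) col x ≡ flipped (A σ comp) (A σ col) (V σ vB) x
    sets σ′ x (eq , eqB , z , o) old rewrite sym eq | sym eqB | sym old with A σ′ comp x ≟ᶠ V σ′ vB
    ... | no  _ = refl
    ... | yes _ rewrite z with A σ′ col x ≟ᶠ zero
    ...   | yes _ = trans (≔-same (A σ′ col) x) o
    ...   | no  _ = trans (≔-same (A σ′ col) x) refl

  recolour : (λ′ c : Fin N → Fin N) → Fin N → Fin N → Fin N → Fin N
  recolour λ′ c p q = if does (c p ≟ᶠ c q) then flipped λ′ c (λ′ q) else c

  attach-spec : ∀ (σ : Store) → Constants σ → V σ vB ≡ A σ comp (V σ vQ) →
    let σ′ = eval attach σ ; p = V σ vP ; q = V σ vQ in
    out σ′ ≡ out σ ++ toℕ p ∷ toℕ q ∷ [] × (∀ x → A σ′ comp x ≡ unite (A σ comp) p q x) ×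
    (∀ x → A σ′ col x ≡ recolour (A σ comp) (A σ col) p q x)
  attach-spec σ const eqB =
      trans (silent (uniteCmd comp) σ₂) (trans (silent (ifEq vC vE flip skip) σ₁) (List.++-assoc (out σ) _ _))
    , (λ x → trans (unite-spec comp σ₂ x) (cong-app (cong₂ (λ f (p , q) → unite f p q)
         (keepsA (ifEq vC vE flip skip) comp σ₁)
         (cong₂ _,_ (keepsV (ifEq vC vE flip skip) vP σ₁) (keepsV (ifEq vC vE flip skip) vQ σ₁))) x))
    , (λ x → trans (cong-app (keepsA (uniteCmd comp) col σ₂) x) (colours x))
    where
    σ₁ = eval (print vP ⨾ print vQ ⨾ ld vC col vP ⨾ ld vE col vQ) σ
    σ₂ = eval (ifEq vC vE flip skip) σ₁
    colours : ∀ x → A σ₂ col x ≡ recolour (A σ comp) (A σ col) (V σ vP) (V σ vQ) x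
    colours x with A σ col (V σ vP) ≟ᶠ A σ col (V σ vQ)
    ... | yes _ = trans (flip-spec σ₁ const x) (cong (λ b → flipped (A σ comp) (A σ col) b x) eqB)
    ... | no  _ = refl

  flipped-bit : ∀ λ′ c b → (∀ x → Bit (c x)) → ∀ x → Bit (flipped λ′ c b x)
  flipped-bit λ′ c b bits x with λ′ x ≟ᶠ b
  ... | yes _ = toggle-bit (c x)
  ... | no  _ = bits x

  flipped-cong : ∀ λ′ c b {u v} → λ′ u ≡ λ′ v → c u ≡ c v → flipped λ′ c b u ≡ flipped λ′ c b v
  flipped-cong λ′ c b λ≡ c≡ = cong₂ (λ l k → if does (l ≟ᶠ b) then toggle k else k) λ≡ c≡

  flipped-contrast : ∀ λ′ c b → (∀ x → Bit (c x)) → ∀ {u v} → λ′ u ≡ λ′ v → c u ≢ c v →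
                     flipped λ′ c b u ≢ flipped λ′ c b v
  flipped-contrast λ′ c b bits {u} {v} λ≡ c≢ with λ′ u ≟ᶠ b | λ′ v ≟ᶠ b
  ... | yes _   | yes _   = c≢ ∘ toggle-injective (bits u) (bits v)
  ... | no  _   | no  _   = c≢
  ... | yes u~b | no  v≁b = contradiction (trans (sym λ≡) u~b) v≁b
  ... | no  u≁b | yes v~b = contradiction (trans λ≡ v~b) u≁b

  recolour-bit : ∀ λ′ c p q → (∀ x → Bit (c x)) → ∀ x → Bit (recolour λ′ c p q x)
  recolour-bit λ′ c p q bits x with c p ≟ᶠ c q
  ... | yes _ = flipped-bit λ′ c (λ′ q) bits x
  ... | no  _ = bits x

  recolour-cong : ∀ λ′ c p q {u v} → λ′ u ≡ λ′ v → c u ≡ c v → recolour λ′ c p q u ≡ recolour λ′ c p q v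
  recolour-cong λ′ c p q λ≡ c≡ with c p ≟ᶠ c q
  ... | yes _ = flipped-cong λ′ c (λ′ q) λ≡ c≡
  ... | no  _ = c≡

  recolour-contrast : ∀ λ′ c p q → (∀ x → Bit (c x)) → ∀ {u v} → λ′ u ≡ λ′ v → c u ≢ c v →
                      recolour λ′ c p q u ≢ recolour λ′ c p q v
  recolour-contrast λ′ c p q bits λ≡ c≢ with c p ≟ᶠ c q
  ... | yes _ = flipped-contrast λ′ c (λ′ q) bits λ≡ c≢
  ... | no  _ = c≢

  -- The ends lie in different components, so when their colours agree exactly one of them is
  -- toggled.
  recolour-separates : ∀ λ′ c p q → (∀ x → Bit (c x)) → λ′ p ≢ λ′ q → recolour λ′ c p q p ≢ recolour λ′ c p q q
  recolour-separates λ′ c p q bits p≁q with c p ≟ᶠ c q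
  ... | no  c≢ = c≢
  ... | yes c≡ with λ′ p ≟ᶠ λ′ q | λ′ q ≟ᶠ λ′ q
  ...   | yes p~q | _       = contradiction p~q p≁q
  ...   | no  _   | no  q≁q = contradiction refl q≁q
  ...   | no  _   | yes _   = λ eq → toggle-changes (bits q) (trans (sym eq) c≡)

  module TreeLoop (p q π : Fin N → Fin N) where

    F : Store → Fin N → Store
    F = iteration vK treeStep

    record Ready (σ : Store) : Set where
      field
        constants : Constants σ
        p≡        : A σ mp ≡ p
        q≡        : A σ mq ≡ q
        π≡        : A σ cls ≡ π
        coarse    : π ⊑ A σ comp
        bits      : ∀ x → Bit (A σ col x)
        constant  : π ⊑ A σ col

    -- `contrast` carries properness to the end: an edge is proper just after it is attached, its
    -- ends are then in one component, and later recolourings toggle both or neither.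
    record Coloured (σ σ′ : Store) (T : List (Edge N)) : Set where
      field
        output   : out σ′ ≡ out σ ++ writeEdges T
        bits     : ∀ x → Bit (A σ′ col x)
        constant : π ⊑ A σ′ col
        contrast : ∀ {u v} → A σ comp u ≡ A σ comp v → A σ col u ≢ A σ col v → A σ′ col u ≢ A σ′ col v
        proper   : All (λ (u , v) → A σ′ col u ≢ A σ′ col v) T

    tree-loop : ∀ xs σ → Ready σ → Coloured σ (foldl F σ xs) (kept G π (A σ comp) (edges p q xs))
    tree-loop []       σ r = record
      { output   = sym (List.++-identityʳ (out σ))
      ; bits     = Ready.bits r
      ; constant = Ready.constant r
      ; contrast = λ _ → id
      ; proper   = []
      }
    tree-loop (k ∷ xs) σ ready@(record { p≡ = refl ; q≡ = refl ; π≡ = refl }) = go (p k ≟ᶠ q k) (ρ P ≟ᶠ ρ Q)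
      where
      open Ready ready
      ρ = A σ comp
      P = π (p k)
      Q = π (q k)
      rest = edges p q xs
      loaded = eval (ld vP mp vK ⨾ ld vQ mq vK ⨾ ld vP cls vP ⨾ ld vQ cls vQ ⨾ ld vA comp vP ⨾ ld vB comp vQ)
                  (setV vK k σ)
      skipped : Coloured σ (foldl F loaded xs) (kept G π ρ rest)
      skipped = record
        { output = Coloured.output r ; bits = Coloured.bits r ; constant = Coloured.constant r
        ; contrast = Coloured.contrast r ; proper = Coloured.proper r }
        where
        r = tree-loop xs loaded record
          { constants = constants ; p≡ = refl ; q≡ = refl ; π≡ = refl
          ; coarse = coarse ; bits = bits ; constant = constant }
      attached : ρ P ≢ ρ Q → Coloured σ (foldl F (eval attach loaded) xs) ((P , Q) ∷ kept G π (unite ρ P Q) rest)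
      attached P≁Q = record
        { output   = trans (Coloured.output r) (trans (cong₂ _++_ (proj₁ spec) (cong writeEdges kept≡))
                       (List.++-assoc (out σ) (toℕ P ∷ toℕ Q ∷ []) _))
        ; bits     = Coloured.bits r
        ; constant = Coloured.constant r
        ; contrast = λ {u} {v} u~v c≢ → Coloured.contrast r (joined u v (⊑-apply (unite-coarsens ρ P Q) u~v))
                       (recoloured u v (recolour-contrast ρ (A σ col) P Q bits u~v c≢))
        ; proper   = Coloured.contrast r (joined P Q (unite-unites ρ P Q))
                       (recoloured P Q (recolour-separates ρ (A σ col) P Q bits P≁Q))
                   ∷ subst (All _) kept≡ (Coloured.proper r)
        }
        where
        σ′ = eval attach loaded
        spec = attach-spec loaded constants refl
        united = proj₁ (proj₂ spec)
        colours = proj₂ (proj₂ spec)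
        joined : ∀ u v → unite ρ P Q u ≡ unite ρ P Q v → A σ′ comp u ≡ A σ′ comp v
        joined u v eq = trans (united u) (trans eq (sym (united v)))
        recoloured : ∀ u v → recolour ρ (A σ col) P Q u ≢ recolour ρ (A σ col) P Q v → A σ′ col u ≢ A σ′ col v
        recoloured u v neq eq = neq (trans (sym (colours u)) (trans eq (colours v)))
        r = tree-loop xs σ′ record
          { constants = trans (keepsV attach vZero loaded) (proj₁ constants)
                      , trans (keepsV attach vOne loaded) (proj₁ (proj₂ constants))
                      , trans (keepsR attach rZero loaded) (proj₂ (proj₂ constants))
          ; p≡ = keepsA attach mp loaded
          ; q≡ = keepsA attach mq loaded
          ; π≡ = keepsA attach cls loaded
          ; coarse = coarser λ {x} {y} eq → joined x y (⊑-apply (unite-coarsens ρ P Q) (⊑-apply coarse eq))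
          ; bits = λ x → subst Bit (sym (colours x)) (recolour-bit ρ (A σ col) P Q bits x)
          ; constant = coarser λ {x} {y} eq → trans (colours x)
              (trans (recolour-cong ρ (A σ col) P Q (⊑-apply coarse eq) (⊑-apply constant eq)) (sym (colours y)))
          }
        kept≡ : kept G π (A σ′ comp) rest ≡ kept G π (unite ρ P Q) rest
        kept≡ = kept-cong G π rest united
      go : (e : Dec (p k ≡ q k)) (e′ : Dec (ρ P ≡ ρ Q)) →
           Coloured σ (foldl F (if does e′ then loaded else eval attach loaded) xs)
             (kept G π ρ (if does e then rest else (p k , q k) ∷ rest))
      go (yes _)    (yes _)   = skipped
      -- The program has no separate test for blank entries: one yields P = Q, so the comparison of
      -- components already skips it.
      go (yes eq)   (no P≁Q)  = contradiction (cong (ρ ∘ π) eq) P≁Q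
      go (no _)     e′ with e′ | ρ P ≟ᶠ ρ Q
      ... | yes _   | yes _   = skipped
      ... | yes P~Q | no  P≁Q = contradiction P~Q P≁Q
      ... | no  P≁Q | yes P~Q = contradiction P~Q P≁Q
      ... | no  P≁Q | no  _   = attached P≁Q

  tree-spec : ∀ (σ : Store) → Constants σ → let σ′ = eval tree σ ; T = kept G (A σ cls) (A σ cls) (edges (A σ mp) (A σ mq) (everyone N)) in
              out σ′ ≡ out σ ++ writeEdges T × (∀ x → Bit (A σ′ col x)) × A σ cls ⊑ A σ′ col ×
              All (λ (u , v) → A σ′ col u ≢ A σ′ col v) T
  tree-spec σ (z , o , rz) =
      trans (Coloured.output r) (cong₂ _++_ (silent blanking σ) (cong writeEdges kept≡))
    , Coloured.bits r , Coloured.constant r , subst (All _) kept≡ (Coloured.proper r)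
    where
    open TreeLoop (A σ mp) (A σ mq) (A σ cls)
    fill blanking : Cmd
    fill = for vX (st col vX vZero)
    blanking = copy cls comp ⨾ fill
    σ₁ = eval (copy cls comp) σ
    σ₂ = eval blanking σ
    comp≗ : ∀ x → A σ₂ comp x ≡ A σ cls x
    comp≗ x = trans (cong-app (keepsA fill comp σ₁) x) (copy-spec cls comp (λ ()) σ x)
    col≡zero : ∀ x → A σ₂ col x ≡ zero
    col≡zero = pointwise {F = iteration vX (st col vX vZero)} col (λ _ → zero) (λ σ′ → V σ′ vZero ≡ zero) (λ _ _ → id)
      (λ σ x y y≢x → ≔-other (A σ col) y≢x) σ₁ (λ σ′ x z _ → trans (≔-same (A σ′ col) x) z)
      (trans (keepsV (copy cls comp) vZero σ) z)
    r = tree-loop (everyone N) σ₂ record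
      { constants = trans (keepsV blanking vZero σ) z , trans (keepsV blanking vOne σ) o , trans (keepsR blanking rZero σ) rz
      ; p≡ = keepsA blanking mp σ
      ; q≡ = keepsA blanking mq σ
      ; π≡ = keepsA blanking cls σ
      ; coarse = ⊑-cong (λ x → sym (comp≗ x))
      ; bits = λ x → inj₁ (col≡zero x)
      ; constant = coarser λ {x} {y} _ → trans (col≡zero x) (sym (col≡zero y))
      }
    kept≡ = kept-cong G (A σ cls) (edges (A σ mp) (A σ mq) (everyone N)) comp≗

  -- Diameter, split and the comparison of ratios

  <-≤-trans : ∀ {x y z} → x < y → y ≤ z → x < z
  <-≤-trans x<y (inj₁ y<z)  = <-trans x<y y<z
  <-≤-trans x<y (inj₂ refl) = x<y

  diameter-spec : ∀ (σ : Store) → let σ′ = eval diameter σ ; P = V σ′ vP ; Q = V σ′ vQ ; c = A σ col in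
                  c P ≡ c Q × (∀ x y → c x ≡ c y → d x y ≤ d P Q)
  diameter-spec σ =
    let _ , all , _ , same , best = pairs {i = vI} {vJ} {diameterStep} I (λ _ _ _ → id) (λ _ _ _ → id) preserved
          (eval (lit vP zero ⨾ lit vQ zero) σ) (refl , refl , λ ())
    in same , λ x y → best (all x y)
    where
    c = A σ col
    I : List (Edge N) → Store → Set
    I pre σ′ = A σ′ col ≡ c × c (V σ′ vP) ≡ c (V σ′ vQ) ×
      (∀ {x y} → (x , y) ∈ pre → c x ≡ c y → d x y ≤ d (V σ′ vP) (V σ′ vQ))
    preserved : ∀ pre σ′ → I pre σ′ → I ((V σ′ vI , V σ′ vJ) ∷ pre) (eval diameterStep σ′)
    preserved pre σ′ (eq , same , best) rewrite sym eq with A σ′ col (V σ′ vI) ≟ᶠ A σ′ col (V σ′ vJ)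
    ... | no  i≁j = refl , same , λ { (here refl) i~j → contradiction i~j i≁j ; (there e) → best e }
    ... | yes i~j with d (V σ′ vP) (V σ′ vQ) <? d (V σ′ vI) (V σ′ vJ)
    ...   | yes lt = refl , i~j , λ { (here refl) _ → ≤[]-refl {K} up
                                    ; (there e) x~y → ≤[]-trans {K} up (best e x~y) (inj₁ lt) }
    ...   | no  ≮  = refl , same , λ { (here refl) _ → ≮⇒≥ {K} ≮ ; (there e) → best e }

  bit : Fin N → Fin 2
  bit c = if does (c ≟ᶠ zero) then zero else suc zero

  bit-toℕ : ∀ {c} → Bit c → toℕ (bit c) ≡ toℕ c
  bit-toℕ (inj₁ refl) = refl
  bit-toℕ (inj₂ refl) = refl

  bit-injective : ∀ {c c′} → Bit c → Bit c′ → bit c ≡ bit c′ → c ≡ c′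
  bit-injective b b′ eq = Fin.toℕ-injective (trans (sym (bit-toℕ b)) (trans (cong toℕ eq) (bit-toℕ b′)))

  bit-surjective : ∀ {c c′} → Bit c → Bit c′ → c ≢ c′ → ∀ i → bit c ≡ i ⊎ bit c′ ≡ i
  bit-surjective (inj₁ refl) (inj₁ refl) neq i          = contradiction refl neq
  bit-surjective (inj₂ refl) (inj₂ refl) neq i          = contradiction refl neq
  bit-surjective (inj₁ refl) (inj₂ refl) neq zero       = inj₁ refl
  bit-surjective (inj₁ refl) (inj₂ refl) neq (suc zero) = inj₂ refl
  bit-surjective (inj₂ refl) (inj₁ refl) neq zero       = inj₂ refl
  bit-surjective (inj₂ refl) (inj₁ refl) neq (suc zero) = inj₁ refl

  d-nonneg : ∀ x y → 0# ≤ d x y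
  d-nonneg x y with x ≟ᶠ y
  ... | yes refl = inj₂ (sym (d-diagonal x))
  ... | no  x≢y  = inj₁ (d-positive x≢y)

  module _ {k} (P : Partition N k) where

    -- One pair serves both levels of minima: it attains the split of its own cluster, and it bounds
    -- from below every value that is the split of some cluster.
    split-spec : ∀ {p q} → cluster P p ≢ cluster P q →
                 (∀ {x y} → cluster P x ≢ cluster P y → d p q ≤ d x y) → IsSplit G P (d p q)
    split-spec {p} {q} p≁q best =
        (cluster P p , (p , q , refl , p≁q ∘ sym , refl) , λ { _ (x , y , x~ , y≁ , refl) → best (λ x~y → y≁ (trans (sym x~y) x~)) })
      , λ { _ (_ , (x , y , refl , y≁x , refl) , _) → best (y≁x ∘ sym) }

    diameter-correct : ∀ {p q} → cluster P p ≡ cluster P q →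
                       (∀ {x y} → cluster P x ≡ cluster P y → d x y ≤ d p q) → IsDiameter G P (d p q)
    diameter-correct {p} {q} p~q best =
        (cluster P p , (p , q , refl , sym p~q , refl) , λ { _ (x , y , x~ , y~ , refl) → best (trans x~ (sym y~)) })
      , λ { _ (_ , (x , y , x~ , y~ , refl) , _) → best (trans x~ (sym y~)) }

  RepCost : Store → Carrier ⁺ → Set
  RepCost σ c = (V σ vInf ≡ zero × c ≡ [ R σ rCost ]) ⊎ (V σ vInf ≡ suc zero × c ≡ ⊤⁺)

  RepSolution : Store → Maybe (Partition N 2) → Set
  RepSolution σ s = (V σ vHave ≡ zero × s ≡ nothing) ⊎
    (V σ vHave ≡ suc zero × ∃[ P ] s ≡ just P × (∀ x → toℕ (A σ sol x) ≡ toℕ (cluster P x)))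

  save-spec : ∀ (σ : Store) P → (∀ x → toℕ (A σ col x) ≡ toℕ (cluster P x)) → RepSolution (eval save σ) (just P)
  save-spec σ P col≡ = inj₂ (keepsV (copy col sol) vHave (eval (lit vHave (suc zero)) σ) , P , refl ,
    λ x → trans (cong toℕ (copy-spec col sol (λ ()) (eval (lit vHave (suc zero)) σ) x)) (col≡ x))

  -- As δ is not negative, the program's test 0 < δ decides whether δ = 0, the case in which the
  -- ratio is infinite.
  improve-spec : ∀ (σ : Store) S P {s δ} → Constants σ → R σ rS ≡ s → R σ rD ≡ δ → 0# ≤ δ →
    (∀ x → toℕ (A σ col x) ≡ toℕ (cluster P x)) → RepCost σ (State.cost S) → RepSolution σ (State.solution S) →
    let σ′ = eval improveCmd σ ; S′ = improve G P (ratio {K} s δ) S in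
    RepCost σ′ (State.cost S′) × RepSolution σ′ (State.solution S′) ×
    State.L S′ ≡ State.L S × State.G′ S′ ≡ State.G′ S × State.class S′ ≡ State.class S
  improve-spec σ (state _ sol L H π) P {s} {δ} (z , o , rz) refl refl 0≤δ col≡ (inj₂ (inf , refl)) repS
    rewrite inf | z with δ ≟ 0#
  ... | yes _ = inj₂ (inf , refl) , repS , refl , refl , refl
  ... | no  _ = inj₂ (inf , refl) , repS , refl , refl , refl
  improve-spec σ (state _ sol L H π) P {s} {δ} (z , o , rz) refl refl 0≤δ col≡ (inj₁ (inf , refl)) repS
    rewrite inf | z | rz with 0# <? δ | δ ≟ 0#
  ... | yes 0<δ | yes δ≡0 = contradiction (sym δ≡0) (λ 0≡δ → irrefl 0≡δ 0<δ)
  ... | no  0≮δ | no  δ≢0 = contradiction 0≤δ λ { (inj₁ 0<δ) → 0≮δ 0<δ ; (inj₂ 0≡δ) → δ≢0 (sym 0≡δ) }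
  ... | no  _   | yes _   = inj₂ (keepsV save vInf (eval (lit vInf (suc zero)) σ) , refl)
                          , save-spec (eval (lit vInf (suc zero)) σ) P col≡ , refl , refl , refl
  ... | yes _   | no  _ with R σ rCost <? s / δ
  ...   | no  _ = inj₁ (inf , refl) , repS , refl , refl , refl
  ...   | yes _ = inj₁ (trans (keepsV save vInf σ₁) inf , cong [_] (sym (keepsR save rCost σ₁)))
                , save-spec σ₁ P col≡ , refl , refl , refl
    where σ₁ = eval (wdiv r0 rS rD ⨾ wdiv rCost rS rD) σ

  -- The merging loop

  merge-continue : ∀ {s c sl p q L H π} → d p q ≤ s → mergeUpTo G s (state c sl ((p , q) ∷ L) H π) ≡
                   mergeUpTo G s (state c sl L (merge (π p) (π q) H) (unite π p q))
  merge-continue {s} {p = p} {q} d≤s with d p q ≤? s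
  ... | yes _   = refl
  ... | no  d≰s = contradiction d≤s d≰s

  merge-stop : ∀ {s c sl p q L H π} → ¬ (d p q ≤ s) →
               mergeUpTo G s (state c sl ((p , q) ∷ L) H π) ≡ state c sl ((p , q) ∷ L) H π
  merge-stop {s} {p = p} {q} d≰s with d p q ≤? s
  ... | yes d≤s = contradiction d≤s d≰s
  ... | no  _   = refl

  merge-length : ∀ {s c sl} L {H π} → length (State.L (mergeUpTo G s (state c sl L H π))) ℕ.≤ length L
  merge-length []                = ℕ.z≤n
  merge-length {s} ((p , q) ∷ L) with d p q ≤? s
  ... | yes _ = ℕ.m≤n⇒m≤1+n (merge-length L)
  ... | no  _ = ℕ.≤-refl

  module MergeLoop (s : Carrier) where

    F : Store → Fin N → Store
    F = iteration vK mergeStep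

    record Merges (σ : Store) (xs : List (Fin N)) c sl (S : State G) : Set where
      field
        L≡          : State.L S ≡ edges (A σ lp) (A σ lq) xs
        class≡      : ∀ x → A σ cls x ≡ State.class S x
        contraction : IsContraction G (State.class S) (State.G′ S)
        light       : Greedy up (unmerged G) (State.class S) (State.L S)
        cost≡       : State.cost S ≡ c
        solution≡   : State.solution S ≡ sl

    record Ready (σ : Store) (xs : List (Fin N)) (H : Merged {K} N) (π : Fin N → Fin N) : Set where
      field
        zero≡       : V σ vZero ≡ zero
        running     : V σ vStop ≡ zero
        split≡      : R σ rS ≡ s
        class≡      : ∀ x → A σ cls x ≡ π x
        contraction : IsContraction G π H
        light       : Greedy up (unmerged G) π (edges (A σ lp) (A σ lq) xs)

    idle : ∀ xs σ → V σ vStop ≡ suc zero → V σ vZero ≡ zero →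
           let σ′ = foldl F σ xs in A σ′ lp ≡ A σ lp × A σ′ lq ≡ A σ lq × A σ′ cls ≡ A σ cls
    idle xs σ stop z = proj₂ (proj₂ (foldl-invariant {f = F} I preserved xs σ (stop , z , refl , refl , refl)))
      where
      I : Store → Set
      I σ′ = V σ′ vStop ≡ suc zero × V σ′ vZero ≡ zero × A σ′ lp ≡ A σ lp × A σ′ lq ≡ A σ lq × A σ′ cls ≡ A σ cls
      preserved : ∀ σ′ k → I σ′ → I (F σ′ k)
      preserved σ′ k (stop , z , eqs) with A σ′ lp k ≟ᶠ A σ′ lq k
      ... | yes _ = stop , z , eqs
      ... | no  _ with V σ′ vStop ≟ᶠ V σ′ vZero
      ...   | yes eq = contradiction (trans (sym stop) (trans eq z)) (λ ())
      ...   | no  _  = stop , z , eqs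

    local : ∀ σ k y → y ≢ k → A (F σ k) lp y ≡ A σ lp y
    local σ k y y≢k with A σ lp k ≟ᶠ A σ lq k
    ... | yes _ = refl
    ... | no  _ with V σ vStop ≟ᶠ V σ vZero
    ...   | no  _ = refl
    ...   | yes _ with R σ rS <? d (A σ lp k) (A σ lq k)
    ...     | yes _ = refl
    ...     | no  _ = trans (≔-other (A σ₁ lp) (λ eq → y≢k (trans eq (keepsV (uniteCmd cls) vK σ₀)))) (cong-app (keepsA (uniteCmd cls) lp σ₀) y)
      where
      σ₀ = eval (ld vP lp vK ⨾ ld vQ lq vK ⨾ dist r0 vP vQ) (setV vK k σ)
      σ₁ = eval (uniteCmd cls) σ₀

    -- The scan over entries runs in step with the recursion over `L`, blank entries corresponding
    -- to no edge. Greediness of the rest of `L` guarantees that each merge joins two different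
    -- supervertices.
    merge-loop : ∀ xs → Unique xs → ∀ σ c sl {H π} → Ready σ xs H π →
                 Merges (foldl F σ xs) xs c sl (mergeUpTo G s (state c sl (edges (A σ lp) (A σ lq) xs) H π))
    merge-loop [] _ σ c sl r = record
      { L≡ = refl ; class≡ = Ready.class≡ r ; contraction = Ready.contraction r ; light = Ready.light r
      ; cost≡ = refl ; solution≡ = refl }
    merge-loop (k ∷ xs) (k∉ ∷ u) σ c sl {H} {π} r =
      go (p ≟ᶠ q) (V σ vStop ≟ᶠ V σ vZero) (R σ rS <? d p q) light
      where
      open Ready r
      p = A σ lp k
      q = A σ lq k
      rest = edges (A σ lp) (A σ lq) xs
      k∉xs : k ∉ xs
      k∉xs k∈ = All.lookup k∉ k∈ refl
      loaded = eval (ld vP lp vK ⨾ ld vQ lq vK) (setV vK k σ)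
      stopped = eval (dist r0 vP vQ ⨾ lit vStop (suc zero)) loaded
      before = eval (dist r0 vP vQ) loaded
      united = eval (uniteCmd cls) before
      merged′ = eval (st lp vK vQ) united
      lp≡ : A merged′ lp ≡ A σ lp [ k ≔ q ]
      lp≡ = cong₂ (λ f (x , y) → f [ x ≔ y ]) (keepsA (uniteCmd cls) lp before)
        (cong₂ _,_ (keepsV (uniteCmd cls) vK before) (keepsV (uniteCmd cls) vQ before))
      lq≡ : A merged′ lq ≡ A σ lq
      lq≡ = keepsA (uniteCmd cls) lq before
      -- Later iterations do not touch entry k, so an entry that is blank now is blank at the end
      -- and contributes no edge to the final list.
      degenerate : ∀ σ′ → A σ′ lp k ≡ A σ′ lq k → let σ″ = foldl F σ′ xs in
                   edges (A σ″ lp) (A σ″ lq) (k ∷ xs) ≡ edges (A σ″ lp) (A σ″ lq) xs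
      degenerate σ′ eq = edges-skip (A σ″ lp) (A σ″ lq) xs
        (trans (outside {F = F} lp local xs σ′ k∉xs)
          (trans eq (sym (cong-app (foldl-invariant {f = F} (λ σ₁ → A σ₁ lq ≡ A σ′ lq)
            (λ σ₁ x eq → trans (keepsA mergeStep lq (setV vK x σ₁)) eq) xs σ′ refl) k))))
        where σ″ = foldl F σ′ xs
      extend : ∀ σ′ S → A σ′ lp k ≡ A σ′ lq k → Merges (foldl F σ′ xs) xs c sl S → Merges (foldl F σ′ xs) (k ∷ xs) c sl S
      extend σ′ S eq M = record
        { L≡ = trans (Merges.L≡ M) (sym (degenerate σ′ eq)) ; class≡ = Merges.class≡ M
        ; contraction = Merges.contraction M ; light = Merges.light M
        ; cost≡ = Merges.cost≡ M ; solution≡ = Merges.solution≡ M }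
      go : (e : Dec (p ≡ q)) (e₁ : Dec (V σ vStop ≡ V σ vZero)) (e₂ : Dec (R σ rS < d p q)) →
           Greedy up (unmerged G) π (if does e then rest else (p , q) ∷ rest) →
           Merges (foldl F (if does e then loaded else if does e₁ then (if does e₂ then stopped else merged′) else loaded) xs)
             (k ∷ xs) c sl (mergeUpTo G s (state c sl (if does e then rest else (p , q) ∷ rest) H π))
      go (yes eq) _ _ light = extend loaded _ eq (merge-loop xs u loaded c sl record
        { zero≡ = zero≡ ; running = running ; split≡ = split≡ ; class≡ = class≡ ; contraction = contraction ; light = light })
      go (no _) (no ≢) _ _ = contradiction (trans running (sym zero≡)) ≢
      go (no p≢q) (yes _) (yes s<d) light = subst (Merges (foldl F stopped xs) (k ∷ xs) c sl) (sym (merge-stop d≰s)) record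
        { L≡ = sym (trans (cong₂ (λ f g → edges f g (k ∷ xs)) (proj₁ idled) (proj₁ (proj₂ idled)))
                     (cong (λ b → if b then rest else (p , q) ∷ rest) (dec-false (p ≟ᶠ q) p≢q)))
        ; class≡ = λ x → trans (cong-app (proj₂ (proj₂ idled)) x) (class≡ x)
        ; contraction = contraction ; light = light ; cost≡ = refl ; solution≡ = refl }
        where
        idled = idle xs stopped refl zero≡
        d≰s : ¬ (d p q ≤ s)
        d≰s d≤s = irrefl refl (<-≤-trans (subst (_< d p q) split≡ s<d) d≤s)
      go (no _) (yes _) (no s≮d) light with light
      ... | step _ _ p≁q _ light′ = subst (Merges (foldl F merged′ xs) (k ∷ xs) c sl) (sym (merge-continue d≤s))
          (extend merged′ _ here≡
            (subst (λ L → Merges (foldl F merged′ xs) xs c sl (mergeUpTo G s (state c sl L (merge (π p) (π q) H) (unite π p q))))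
              rest≡ (merge-loop xs u merged′ c sl record
                { zero≡ = trans (keepsV (uniteCmd cls) vZero before) zero≡
                ; running = trans (keepsV (uniteCmd cls) vStop before) running
                ; split≡ = trans (keepsR (uniteCmd cls) rS before) split≡
                ; class≡ = λ x → trans (unite-spec cls before x) (unite-cong class≡ p q x)
                ; contraction = contraction-merge G contraction p≁q
                ; light = subst (Greedy up (unmerged G) (unite π p q)) (sym rest≡) light′ })))
        where
        d≤s : d p q ≤ s
        d≤s = subst (d p q ≤_) split≡ (≮⇒≥ {K} s≮d)
        here≡ : A merged′ lp k ≡ A merged′ lq k
        here≡ = trans (cong-app lp≡ k) (trans (≔-same (A σ lp) k) (sym (cong-app lq≡ k)))
        rest≡ : edges (A merged′ lp) (A merged′ lq) xs ≡ rest
        rest≡ = edges-cong xs (λ {j} j∈ → trans (cong-app lp≡ j) (≔-other (A σ lp) (λ { refl → k∉xs j∈ })))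
                              (λ {j} _ → cong-app lq≡ j)

    merge-spec : ∀ σ c sl {H π} → Constants σ → R σ rS ≡ s → (∀ x → A σ cls x ≡ π x) → IsContraction G π H →
                 Greedy up (unmerged G) π (edges (A σ lp) (A σ lq) (everyone N)) →
                 Merges (eval mergeCmd σ) (everyone N) c sl
                   (mergeUpTo G s (state c sl (edges (A σ lp) (A σ lq) (everyone N)) H π))
    merge-spec σ c sl (z , _) s≡ cls≡ C light = merge-loop (everyone N) (everyone-unique N) (eval (lit vStop zero) σ) c sl record
      { zero≡ = z ; running = refl ; split≡ = s≡ ; class≡ = cls≡ ; contraction = C ; light = light }

  -- One round of the algorithm

  remaining : Store → List (Edge N)
  remaining σ = edges (A σ lp) (A σ lq) (everyone N)

  pending-spec : ∀ (σ : Store) → let f = V (eval pending σ) vF in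
    (f ≡ zero × remaining σ ≡ []) ⊎ (f ≡ suc zero × ∃[ e ] ∃[ L ] remaining σ ≡ e ∷ L)
  pending-spec σ = go (everyone N) (eval (lit vF zero) σ) refl
    where
    c : Cmd
    c = ld vP lp vK ⨾ ld vQ lq vK ⨾ ifEq vP vQ skip (lit vF (suc zero))
    F : Store → Fin N → Store
    F = iteration vK c
    stays : ∀ (σ : Store) k → V σ vF ≡ suc zero → V (F σ k) vF ≡ suc zero
    stays σ k eq with A σ lp k ≟ᶠ A σ lq k
    ... | yes _ = eq
    ... | no  _ = refl
    go : ∀ xs (σ : Store) → V σ vF ≡ zero → let f = V (foldl F σ xs) vF ; L = edges (A σ lp) (A σ lq) xs in
         (f ≡ zero × L ≡ []) ⊎ (f ≡ suc zero × ∃[ e ] ∃[ L′ ] L ≡ e ∷ L′)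
    go []       σ eq = inj₁ (eq , refl)
    go (k ∷ xs) σ eq with A σ lp k ≟ᶠ A σ lq k
    ... | yes _ = go xs (eval (ld vP lp vK ⨾ ld vQ lq vK) (setV vK k σ)) eq
    ... | no  _ = inj₂ (foldl-invariant {f = F} (λ σ → V σ vF ≡ suc zero) stays xs
                          (eval (ld vP lp vK ⨾ ld vQ lq vK ⨾ lit vF (suc zero)) (setV vK k σ)) refl
                       , _ , _ , refl)

  -- `light` compares weights of G over the class labelling, because the split and the inner loop
  -- refer to `d` and not to the weights of G′. `heavy` concerns arrays that no round changes.
  record Rep (σ : Store) (S : State G) : Set where
    field
      constants   : Constants σ
      heavy       : Greedy down (unmerged G) id (edges (A σ mp) (A σ mq) (everyone N))
      L≡          : State.L S ≡ remaining σ
      class≡      : ∀ x → A σ cls x ≡ State.class S x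
      contraction : IsContraction G (State.class S) (State.G′ S)
      light       : Greedy up (unmerged G) (State.class S) (State.L S)
      cost≡       : RepCost σ (State.cost S)
      solution≡   : RepSolution σ (State.solution S)

  constants-keep : ∀ c {_ : KeepsV c vZero} {_ : KeepsV c vOne} {_ : KeepsR c rZero} (σ : Store) →
                   Constants σ → Constants (eval c σ)
  constants-keep c {k₁} {k₂} {k₃} σ (z , o , rz) =
    trans (keepsV c vZero {k₁} σ) z , trans (keepsV c vOne {k₂} σ) o , trans (keepsR c rZero {k₃} σ) rz

  cost-keep : ∀ c {_ : KeepsV c vInf} {_ : KeepsR c rCost} (σ : Store) {x} → RepCost σ x → RepCost (eval c σ) x
  cost-keep c {k₁} {k₂} σ (inj₁ (eq , refl)) = inj₁ (trans (keepsV c vInf {k₁} σ) eq , cong [_] (sym (keepsR c rCost {k₂} σ)))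
  cost-keep c {k₁} {k₂} σ (inj₂ (eq , refl)) = inj₂ (trans (keepsV c vInf {k₁} σ) eq , refl)

  solution-keep : ∀ c {_ : KeepsV c vHave} {_ : KeepsA c sol} (σ : Store) {x} → RepSolution σ x → RepSolution (eval c σ) x
  solution-keep c {k₁} {k₂} σ (inj₁ (eq , refl)) = inj₁ (trans (keepsV c vHave {k₁} σ) eq , refl)
  solution-keep c {k₁} {k₂} σ (inj₂ (eq , P , refl , sol≡)) =
    inj₂ (trans (keepsV c vHave {k₁} σ) eq , P , refl , λ x → trans (cong toℕ (cong-app (keepsA c sol {k₂} σ) x)) (sol≡ x))

  writeRound : List (Edge N) × Partition N 2 → List ℕ
  writeRound (T , P) = writeEdges T ++ writePartition P

  module _ {σ : Store} {S : State G} (rep : Rep σ S) {p₀ q₀ L₀} (L-cons : State.L S ≡ (p₀ , q₀) ∷ L₀) where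
    open Rep rep

    private
      π = A σ cls

    maxTree : List (Edge N)
    maxTree = kept G π π (edges (A σ mp) (A σ mq) (everyone N))

    private
      σ₁ = eval tree σ
      σ₂ = eval (printArray col) σ₁
      σ₃ = eval (scan up col) σ₂
      σ₄ = eval (dist rS vP vQ) σ₃
      σ₅ = eval diameter σ₄
      front back : Cmd
      front = tree ⨾ printArray col ⨾ scan up col ⨾ dist rS vP vQ ⨾ diameter ⨾ dist rD vP vQ
      back = scan up col ⨾ dist rS vP vQ ⨾ diameter ⨾ dist rD vP vQ ⨾ improveCmd ⨾ mergeCmd
      σ₆ = eval front σ
      c = A σ₁ col

      spec = tree-spec σ constants
      bits = proj₁ (proj₂ spec)
      constant = proj₁ (proj₂ (proj₂ spec))
      differ = proj₂ (proj₂ (proj₂ spec))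

      contraction-π : IsContraction G π (State.G′ S)
      contraction-π = contraction-cong G (λ x → sym (class≡ x)) contraction
      open IsContraction contraction-π using (π-in; π-fixes)

      tree-greedy : Greedy down (State.G′ S) π maxTree
      tree-greedy = kept-greedy G contraction-π (edges (A σ mp) (A σ mq) (everyone N)) ⊑-refl (coarser (cong π)) heavy

      light-head : Greedy up (unmerged G) (State.class S) ((p₀ , q₀) ∷ L₀)
      light-head = subst (Greedy up (unmerged G) (State.class S)) L-cons light

      classes-differ : π p₀ ≢ π q₀
      classes-differ eq with light-head
      ... | step _ _ p≁q _ _ = p≁q (trans (sym (class≡ p₀)) (trans eq (class≡ q₀)))

      -- The first edge of `L` joins two different supervertices, so the tree has an edge and both
      -- colours occur; otherwise one cluster would be empty.
      two-coloured : ∃[ u ] ∃[ v ] c u ≢ c v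
      two-coloured = go maxTree tree-greedy differ
        where
        go : ∀ T → Greedy down (State.G′ S) π T → All (λ (u , v) → c u ≢ c v) T → ∃[ u ] ∃[ v ] c u ≢ c v
        go []            g _         = ⊥-elim (Greedy-nonempty classes-differ g)
        go ((u , v) ∷ _) g (u≁v ∷ _) = u , v , u≁v

    clusters : Partition N 2
    clusters = record
      { cluster = bit ∘ c
      ; nonEmpty = λ i → let u , v , u≁v = two-coloured in pick (bit-surjective (bits u) (bits v) u≁v i) }
      where
      pick : ∀ {u v i} → bit (c u) ≡ i ⊎ bit (c v) ≡ i → ∃[ x ] bit (c x) ≡ i
      pick (inj₁ eq) = _ , eq
      pick (inj₂ eq) = _ , eq

    private
      separates : ∀ {x y} → c x ≢ c y → bit (c x) ≢ bit (c y)
      separates x≁y = x≁y ∘ bit-injective (bits _) (bits _)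

      s δ : Carrier
      s = d (V σ₃ vP) (V σ₃ vQ)
      δ = d (V σ₅ vP) (V σ₅ vQ)

      split-found : c (V σ₃ vP) ≢ c (V σ₃ vQ) × (∀ {x y} → c x ≢ c y → s ≤ d x y)
      split-found with scan-spec up col σ₂
      ... | inj₁ (_ , triv) = let u , v , u≁v = two-coloured in
              contradiction (subst (λ c → c u ≡ c v) (keepsA (printArray col) col σ₁) (triv u v)) u≁v
      ... | inj₂ found = subst (λ c → c (V σ₃ vP) ≢ c (V σ₃ vQ) × (∀ {x y} → c x ≢ c y → s ≤ d x y))
              (keepsA (printArray col) col σ₁) found

      diameter-found : c (V σ₅ vP) ≡ c (V σ₅ vQ) × (∀ x y → c x ≡ c y → d x y ≤ δ)
      diameter-found = subst (λ c → c (V σ₅ vP) ≡ c (V σ₅ vQ) × (∀ x y → c x ≡ c y → d x y ≤ δ))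
        (keepsA (printArray col ⨾ scan up col ⨾ dist rS vP vQ) col σ₁) (diameter-spec σ₄)

    this-round : IsRound G S maxTree clusters
    this-round = record
      { T-max = record
        { spanning = Greedy-spanning π-in π-fixes tree-greedy
        ; maximum = Greedy-optimum π-in π-fixes tree-greedy
        }
      ; colour = bit ∘ c
      ; proper = All.map separates differ
      ; induced = λ x → cong bit (⊑-apply constant (sym (trans (cong π (sym (class≡ x))) (π-fixes (π-in x)))))
      ; s = s
      ; δ = δ
      ; s-isSplit = split-spec clusters (separates (proj₁ split-found))
          (λ x≁y → proj₂ split-found (λ eq → x≁y (cong bit eq)))
      ; δ-isDiameter = diameter-correct clusters (cong bit (proj₁ diameter-found))
          (λ x~y → proj₂ diameter-found _ _ (bit-injective (bits _) (bits _) x~y))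
      }

    round-output : out (eval roundCmd σ) ≡ out σ ++ writeRound (maxTree , clusters)
    round-output = begin
      out (eval roundCmd σ)                                            ≡⟨ silent back σ₂ ⟩
      out σ₂                                                         ≡⟨ printArray-spec col σ₁ ⟩
      out σ₁ ++ map (toℕ ∘ c) (everyone N)                           ≡⟨ cong₂ _++_ (proj₁ spec) colours≡ ⟩
      (out σ ++ writeEdges maxTree) ++ writePartition clusters             ≡⟨ List.++-assoc (out σ) _ _ ⟩
      out σ ++ writeRound (maxTree , clusters)                             ∎
      where
      open ≡-Reasoning
      colours≡ : map (toℕ ∘ c) (everyone N) ≡ writePartition clusters
      colours≡ = trans (List.map-cong (λ x → sym (bit-toℕ (bits x))) (everyone N))
                   (cong (map (toℕ ∘ bit ∘ c)) (everyone-allFin N))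

    private
      improved = improve-spec σ₆ S clusters {s} {δ} (constants-keep front σ constants)
        (keepsR (diameter ⨾ dist rD vP vQ) rS σ₄) refl (d-nonneg _ _)
        (λ x → trans (cong toℕ (cong-app (keepsA (printArray col ⨾ scan up col ⨾ dist rS vP vQ ⨾ diameter ⨾ dist rD vP vQ) col σ₁) x))
                 (sym (bit-toℕ (bits x))))
        (cost-keep front σ cost≡) (solution-keep front σ solution≡)
      S₇ = improve G clusters (ratio {K} s δ) S
      σ₇ = eval improveCmd σ₆
      upto : Cmd
      upto = tree ⨾ printArray col ⨾ scan up col ⨾ dist rS vP vQ ⨾ diameter ⨾ dist rD vP vQ ⨾ improveCmd

      remaining₇ : remaining σ₇ ≡ State.L S
      remaining₇ = trans (cong₂ (λ f g → edges f g (everyone N)) (keepsA upto lp σ) (keepsA upto lq σ)) (sym L≡)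

    open MergeLoop s using (Merges; merge-spec)

    private
      -- `improve` alters only the cost and the solution, but it is a conditional on whole states,
      -- so its other fields are unchanged only up to a proved equality.
      relabel : ∀ S′ {L H π} → State.L S′ ≡ L → State.G′ S′ ≡ H → State.class S′ ≡ π →
                Merges (eval mergeCmd σ₇) (everyone N) (State.cost S′) (State.solution S′)
                  (mergeUpTo G s (state (State.cost S′) (State.solution S′) L H π)) →
                Merges (eval mergeCmd σ₇) (everyone N) (State.cost S′) (State.solution S′) (mergeUpTo G s S′)
      relabel S′ refl refl refl M = M

      merges : Merges (eval mergeCmd σ₇) (everyone N) (State.cost S₇) (State.solution S₇) (after G this-round)
      merges = relabel S₇ (trans (proj₁ (proj₂ (proj₂ improved))) (sym remaining₇))
        (proj₁ (proj₂ (proj₂ (proj₂ improved)))) (proj₂ (proj₂ (proj₂ (proj₂ improved))))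
        (merge-spec σ₇ (State.cost S₇) (State.solution S₇) (constants-keep upto σ constants)
          (trans (keepsR improveCmd rS σ₆) (keepsR (diameter ⨾ dist rD vP vQ) rS σ₄))
          (λ x → trans (cong-app (keepsA upto cls σ) x) (class≡ x)) contraction
          (subst (Greedy up (unmerged G) (State.class S)) (sym remaining₇) light))

    round-rep : Rep (eval roundCmd σ) (after G this-round)
    round-rep = record
      { constants   = constants-keep roundCmd σ constants
      ; heavy       = subst₂ (λ f g → Greedy down (unmerged G) id (edges f g (everyone N)))
                        (sym (keepsA roundCmd mp σ)) (sym (keepsA roundCmd mq σ)) heavy
      ; L≡          = Merges.L≡ merges
      ; class≡      = Merges.class≡ merges
      ; contraction = Merges.contraction merges
      ; light       = Merges.light merges
      ; cost≡       = subst (RepCost (eval roundCmd σ)) (sym (Merges.cost≡ merges)) (cost-keep mergeCmd σ₇ (proj₁ improved))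
      ; solution≡   = subst (RepSolution (eval roundCmd σ)) (sym (Merges.solution≡ merges))
                        (solution-keep mergeCmd σ₇ (proj₁ (proj₂ improved)))
      }

    round-progress : length (State.L (after G this-round)) ℕ.< length (State.L S)
    round-progress = go S₇ (trans (proj₁ (proj₂ (proj₂ improved))) L-cons)
      where
      first≤s : d p₀ q₀ ≤ s
      -- The pair attaining the split has different colours, hence different classes, and the first
      -- edge of `L` is lightest among the pairs between different classes.
      first≤s = Greedy-first light-head ∈⊤ ∈⊤ λ eq →
        proj₁ split-found (⊑-apply constant (trans (class≡ _) (trans eq (sym (class≡ _)))))
      go : ∀ S′ → State.L S′ ≡ (p₀ , q₀) ∷ L₀ → length (State.L (mergeUpTo G s S′)) ℕ.< length (State.L S)
      go (state c′ sl _ H π′) refl = subst₂ ℕ._<_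
        (sym (cong (length ∘ State.L) (merge-continue {s} {c′} {sl} {p₀} {q₀} {L₀} {H} {π′} first≤s)))
        (sym (cong length L-cons)) (ℕ.s≤s (merge-length {s} {c′} {sl} L₀))

  pending-rep : ∀ {σ : Store} {S} k → Rep σ S → Rep (iteration vRound pending σ k) S
  pending-rep {σ} {S} k rep = record
    { constants   = constants-keep pending σ₀ constants
    ; heavy       = subst₂ (λ f g → Greedy down (unmerged G) id (edges f g (everyone N)))
                      (sym (keepsA pending mp σ₀)) (sym (keepsA pending mq σ₀)) heavy
    ; L≡          = trans L≡ (cong₂ (λ f g → edges f g (everyone N)) (sym (keepsA pending lp σ₀)) (sym (keepsA pending lq σ₀)))
    ; class≡      = λ x → trans (cong-app (keepsA pending cls σ₀) x) (class≡ x)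
    ; contraction = contraction
    ; light       = light
    ; cost≡       = cost-keep pending σ₀ cost≡
    ; solution≡   = solution-keep pending σ₀ solution≡
    }
    where
    open Rep rep
    σ₀ = setV vRound k σ

  -- The outer loop and the whole program

  prepend : ∀ {o o′ x : List ℕ} → o ≡ o′ → o ++ x ≡ o′ ++ x
  prepend = cong (_++ _)

  append : ∀ (o x : List ℕ) {o₁ o′ y} → o′ ≡ o₁ ++ y → o₁ ≡ o ++ x → o′ ≡ o ++ (x ++ y)
  append o x {y = y} refl refl = List.++-assoc o x y

  -- The iterations left always number at least the edges left in `L`: a round uses one iteration
  -- and removes at least one edge. When none is left, `L` is empty and the algorithm returns.
  rounds-spec : ∀ xs (σ : Store) S → Rep σ S → length (State.L S) ℕ.≤ length xs →
    let σ′ = foldl (iteration vRound roundStep) σ xs in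
    ∃[ rs ] ∃[ R ] Loop G S rs R × out σ′ ≡ out σ ++ concatMap writeRound rs × RepSolution σ′ R
  rounds-spec []       σ S rep short = [] , State.solution S , return (ℕ.≤⇒≯ short)
    , sym (List.++-identityʳ (out σ)) , Rep.solution≡ rep
  rounds-spec (k ∷ xs) σ S rep short = go (pending-spec (setV vRound k σ)) (V σ₁ vF ≟ᶠ V σ₁ vZero)
    where
    F = iteration vRound roundStep
    σ₁ = iteration vRound pending σ k
    rep₁ = pending-rep k rep
    zero≡ = proj₁ (Rep.constants rep₁)
    silent₁ = silent pending (setV vRound k σ)
    go : (V σ₁ vF ≡ zero × remaining σ ≡ []) ⊎ (V σ₁ vF ≡ suc zero × ∃[ e ] ∃[ L ] remaining σ ≡ e ∷ L) →
         (e : Dec (V σ₁ vF ≡ V σ₁ vZero)) → let σ′ = foldl F (if does e then σ₁ else eval roundCmd σ₁) xs in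
         ∃[ rs ] ∃[ R ] Loop G S rs R × out σ′ ≡ out σ ++ concatMap writeRound rs × RepSolution σ′ R
    go (inj₁ (f≡ , none)) (no neq) = contradiction (trans f≡ (sym zero≡)) neq
    go (inj₂ (f≡ , _))    (yes eq) = contradiction (trans (sym f≡) (trans eq zero≡)) λ ()
    go (inj₁ (f≡ , none)) (yes _) =
      let rs , R , loop , out≡ , sol = rounds-spec xs σ₁ S rep₁
            (subst (λ L → length L ℕ.≤ length xs) (sym (trans (Rep.L≡ rep) none)) ℕ.z≤n)
      in rs , R , loop , trans out≡ (prepend silent₁) , sol
    go (inj₂ (f≡ , (p₀ , q₀) , L₀ , some)) (no _) =
      let L-cons = trans (Rep.L≡ rep) some
          r = this-round rep₁ L-cons
          rs , R , loop , out≡ , sol = rounds-spec xs (eval roundCmd σ₁) (after G r) (round-rep rep₁ L-cons)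
            (ℕ.≤-pred (ℕ.<-≤-trans (round-progress rep₁ L-cons) short))
      in _ , R , round (subst (λ L → 1 ℕ.≤ length L) (sym L-cons) (ℕ.s≤s ℕ.z≤n)) r loop
         , append (out σ) (writeRound (maxTree rep₁ L-cons , clusters rep₁ L-cons)) out≡ (trans (round-output rep₁ L-cons) (prepend silent₁))
         , sol

  main-spec : ∃[ E ] out (eval main blank) ≡ trace {G = G} E
  main-spec = E , output (proj₂ (proj₂ (proj₂ result)))
    where
    setup search : Cmd
    setup = lit vOne (suc zero) ⨾ kruskal down
    search = for vRound roundStep
    σ₁ = eval setup blank
    σ₂ = eval (copy lp mp) σ₁
    σ₃ = eval (copy lq mq) σ₂
    σ₄ = eval (kruskal up) σ₃
    σ₅ = eval printEdges σ₄
    σ₆ = eval (identity cls) σ₅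
    before : Cmd
    before = setup ⨾ copy lp mp ⨾ copy lq mq ⨾ kruskal up ⨾ printEdges ⨾ identity cls
    later = kruskal up ⨾ printEdges ⨾ identity cls
    L = remaining σ₄
    light = kruskal-spec up σ₃

    mp≡ : ∀ x → A σ₆ mp x ≡ A σ₁ lp x
    mp≡ x = trans (cong-app (keepsA (copy lq mq ⨾ later) mp σ₂) x) (copy-spec lp mp (λ ()) σ₁ x)
    mq≡ : ∀ x → A σ₆ mq x ≡ A σ₁ lq x
    mq≡ x = trans (cong-app (keepsA later mq σ₃) x)
      (trans (copy-spec lq mq (λ ()) σ₂ x) (cong-app (keepsA (copy lp mp) lq σ₁) x))
    remaining₆ : remaining σ₆ ≡ L
    remaining₆ = cong₂ (λ f g → edges f g (everyone N))
      (keepsA (printEdges ⨾ identity cls) lp σ₄) (keepsA (printEdges ⨾ identity cls) lq σ₄)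

    rep : Rep σ₆ (start G L)
    rep = record
      { constants   = keepsV before vZero blank
                    , keepsV (kruskal down ⨾ copy lp mp ⨾ copy lq mq ⨾ later) vOne (eval (lit vOne (suc zero)) blank)
                    , keepsR before rZero blank
      ; heavy       = subst (Greedy down (unmerged G) id) (sym (edges-cong (everyone N) (λ {k} _ → mp≡ k) (λ {k} _ → mq≡ k)))
                        (kruskal-spec down (eval (lit vOne (suc zero)) blank))
      ; L≡          = sym remaining₆
      ; class≡      = identity-spec cls σ₅
      ; contraction = contraction-id G
      ; light       = light
      ; cost≡       = inj₁ (keepsV before vInf blank , cong [_] (sym (keepsR before rCost blank)))
      ; solution≡   = inj₁ (keepsV before vHave blank , refl)
      }

    -- The initial budget holds because `L` is read from n array entries.
    result = rounds-spec (everyone N) σ₆ (start G L) rep (edges-length (A σ₄ lp) (A σ₄ lq) (everyone N))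

    E : Execution G
    E = record
      { sortedTree = L
      ; isSorted   = record
        { tree      = L
        ; tree-min  = record
          { spanning = Greedy-spanning (λ _ → ∈⊤) (λ _ → refl) light
          ; minimum  = Greedy-optimum (λ _ → ∈⊤) (λ _ → refl) light
          }
        ; listed    = ↭-refl
        ; ascending = Greedy-sorted light
        }
      ; rounds = proj₁ result
      ; result = proj₁ (proj₂ result)
      ; loop   = proj₁ (proj₂ (proj₂ result))
      }

    printed : out σ₆ ≡ writeEdges L
    printed = trans (silent (identity cls) σ₅) (trans (printEdges-spec σ₄)
      (cong (_++ writeEdges L) (silent (setup ⨾ copy lp mp ⨾ copy lq mq ⨾ kruskal up) blank)))

    output : out (eval search σ₆) ≡ out σ₆ ++ concatMap writeRound (proj₁ result) × RepSolution (eval search σ₆) (proj₁ (proj₂ result)) →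
             out (eval main blank) ≡ trace {G = G} E
    output (out≡ , saved) = trans (finish (proj₁ (proj₂ result)) saved (V σ₇ vHave ≟ᶠ V σ₇ vZero))
      (trans (prepend (trans out≡ (prepend printed))) (List.++-assoc (writeEdges L) _ _))
      where
      σ₇ = eval search σ₆
      zero≡ : V σ₇ vZero ≡ zero
      zero≡ = trans (keepsV search vZero σ₆) (proj₁ (Rep.constants rep))
      finish : ∀ R → RepSolution σ₇ R → (e : Dec (V σ₇ vHave ≡ V σ₇ vZero)) →
               out (if does e then σ₇ else eval (printArray sol) σ₇) ≡ out σ₇ ++ writeResult R
      finish _ (inj₁ (h≡ , refl)) (yes _) = sym (List.++-identityʳ (out σ₇))
      finish _ (inj₁ (h≡ , refl)) (no neq) = contradiction (trans h≡ (sym zero≡)) neq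
      finish _ (inj₂ (h≡ , _)) (yes eq) = contradiction (trans (sym h≡) (trans eq zero≡)) λ ()
      finish _ (inj₂ (h≡ , P , refl , sol≡)) (no _) = trans (printArray-spec sol σ₇) (cong (out σ₇ ++_)
        (trans (List.map-cong sol≡ (everyone N)) (cong (map (toℕ ∘ cluster P)) (everyone-allFin N))))

open import Data.Nat.Base using (_≤_; _*_; _^_; s≤s)

theorem4p3 : ∃[ program ] ∃[ c ] ∀ (K : OrderedField) (n : ℕ) → 2 ≤ n →
    ∀ (G : WeightedCompleteGraph K n) →
    ∃[ t ] program carriesOutMRSDon G inTime t × t ≤ c * n ^ 3
-- The row table costs 12n + 4 instructions, at most 16n; the rest is the bound for `main`, whose
-- depth computes to 3.
theorem4p3 = assemble main , 16 ℕ.+ coef main , correct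
  where
  correct : ∀ (K : OrderedField) (n : ℕ) → 2 ≤ n → ∀ (G : WeightedCompleteGraph K n) →
            ∃[ t ] assemble main carriesOutMRSDon G inTime t × t ≤ (16 ℕ.+ coef main) * n ^ 3
  correct K (suc (suc m)) (s≤s (s≤s _)) G =
    let t , γ , runs , output , t≤ = Interpreter.assemble-run G main
        E , traced = main-spec G
    in t , (E , γ , runs , trans output traced) , ℕ.≤-trans t≤ (cubic (coef main))
    where
    N = 2 ℕ.+ m
    cubic : ∀ k → 1 ℕ.+ (N * 12 ℕ.+ 3) ℕ.+ k * N ^ 3 ≤ (16 ℕ.+ k) * N ^ 3
    cubic k = begin
      1 ℕ.+ (N * 12 ℕ.+ 3) ℕ.+ k * N ^ 3   ≡⟨ cong (ℕ._+ k * N ^ 3) (trans (ℕ.+-comm 1 _) (ℕ.+-assoc (N * 12) 3 1)) ⟩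
      N * 12 ℕ.+ 4 * 1 ℕ.+ k * N ^ 3       ≤⟨ ℕ.+-monoˡ-≤ (k * N ^ 3) (ℕ.+-monoʳ-≤ (N * 12) (ℕ.*-monoʳ-≤ 4 {1} {N} (s≤s ℕ.z≤n))) ⟩
      N * 12 ℕ.+ 4 * N ℕ.+ k * N ^ 3       ≡⟨ cong (λ x → x ℕ.+ 4 * N ℕ.+ k * N ^ 3) (ℕ.*-comm N 12) ⟩
      12 * N ℕ.+ 4 * N ℕ.+ k * N ^ 3       ≡⟨ cong (ℕ._+ k * N ^ 3) (ℕ.*-distribʳ-+ N 12 4) ⟨
      16 * N ℕ.+ k * N ^ 3                 ≤⟨ ℕ.+-monoˡ-≤ (k * N ^ 3) (ℕ.*-monoʳ-≤ 16 (ℕ.m≤m*n N (N ^ 2) {{ℕ.m^n≢0 N 2}})) ⟩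
      16 * N ^ 3 ℕ.+ k * N ^ 3             ≡⟨ ℕ.*-distribʳ-+ (N ^ 3) 16 k ⟨
      (16 ℕ.+ k) * N ^ 3                   ∎
      where open ℕ.≤-Reasoning
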